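{- Let $\mathcal{D}$ be one of the following nine step sets: $\{(0,1),(1,0),(-1,-1),(0,-1)\}$, $\{(0,1),(1,0),(-1,-1),(1,-1)\}$, $\{(0,1),(1,1),(-1,0),(0,-1)\}$, $\{(0,1),(-1,0),(1,0),(1,-1)\}$, $\{(0,1),(1,1),(-1,0),(1,0),(-1,-1)\}$, $\{(0,1),(1,1),(-1,0),(-1,-1),(0,-1)\}$, $\{(0,1),(1,0),(-1,-1),(0,-1),(1,-1)\}$, $\{(0,1),(1,1),(-1,0),(1,0),(0,-1)\}$, $\{(-1,1),(0,1),(1,0),(0,-1),(1,-1)\}$. Then the generating series $Q_{\mathcal{D}}(x,y,t)$ is $x$-hyperalgebraic and $y$-hyperalgebraic.
   Context: For a step set $\mathcal{D}\subset\{0,\pm1\}^2\setminus\{(0,0)\}$, let $q_{i,j,k}$ be the number of walks of $k$ steps in $\mathcal{D}$ starting at $(0,0)$, ending at $(i,j)$ and staying in the quarter plane $\mathbb{Z}_{\ge0}^2$, and $Q_{\mathcal{D}}(x,y,t)=\sum_{i,j,k\ge0}q_{i,j,k}x^iy^jt^k$. The series is $x$-hyperalgebraic if, seen as a function of $x$, it satisfies some nonzero polynomial differential equation (in $\partial/\partial x$) with coefficients in $\mathbb{Q}(x,y,t)$; similarly for $y$. -}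

module Defs where

open import Data.Bool using (Bool; true; false; _∧_; if_then_else_)
open import Data.Nat as ℕ using (ℕ; zero; suc; _∸_)
open import Data.Integer as ℤ using (ℤ; +_; 0ℤ)
open import Data.Rational as ℚ using (ℚ; 0ℚ; 1ℚ)
open import Data.Product using (_×_; _,_; proj₁; proj₂; ∃; Σ)
open import Data.List using (List; []; _∷_; map; concatMap; length; filterᵇ; foldr)
open import Data.Vec using (Vec; []; _∷_)
open import Relation.Binary.PropositionalEquality using (_≡_)
open import Relation.Nullary using (¬_)

Step : Set
Step = ℤ × ℤ

StepSet : Set
StepSet = List Step

words : StepSet → ℕ → List (List Step)
words D zero    = [] ∷ []
words D (suc k) = concatMap (λ s → map (s ∷_) (words D k)) D

goodFrom : ℤ → ℤ → ℤ → ℤ → List Step → Bool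
goodFrom a b i j [] = (a ℤ.≤ᵇ i) ∧ (i ℤ.≤ᵇ a) ∧ (b ℤ.≤ᵇ j) ∧ (j ℤ.≤ᵇ b)
goodFrom a b i j ((u , v) ∷ w) =
  let a' = a ℤ.+ u ; b' = b ℤ.+ v in
  (0ℤ ℤ.≤ᵇ a') ∧ (0ℤ ℤ.≤ᵇ b') ∧ goodFrom a' b' i j w

walkCount : StepSet → ℕ → ℕ → ℕ → ℕ
walkCount D i j k = length (filterᵇ (goodFrom 0ℤ 0ℤ (+ i) (+ j)) (words D k))

-- Formal power series in x, y, t over ℚ (coefficient of x^i y^j t^k)

FPS : Set
FPS = ℕ → ℕ → ℕ → ℚ

Q : StepSet → FPS
Q D i j k = + walkCount D i j k ℚ./ 1

sumTo : ℕ → (ℕ → ℚ) → ℚ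
sumTo zero    f = f 0
sumTo (suc n) f = sumTo n f ℚ.+ f (suc n)

_⊕_ : FPS → FPS → FPS
(F ⊕ G) i j k = F i j k ℚ.+ G i j k

_⊛_ : FPS → FPS → FPS
(F ⊛ G) i j k =
  sumTo i λ a → sumTo j λ b → sumTo k λ c →
    F a b c ℚ.* G (i ∸ a) (j ∸ b) (k ∸ c)

zeroS : FPS
zeroS _ _ _ = 0ℚ

mono : ℚ → ℕ → ℕ → ℕ → FPS
mono q a b e i j k =
  if (i ℕ.≡ᵇ a) ∧ (j ℕ.≡ᵇ b) ∧ (k ℕ.≡ᵇ e) then q else 0ℚ

pow : FPS → ℕ → FPS
pow F zero    = mono 1ℚ 0 0 0
pow F (suc n) = F ⊛ pow F n

data Var : Set where
  varX varY : Var

∂ : Var → FPS → FPS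
∂ varX F i j k = (+ suc i ℚ./ 1) ℚ.* F (suc i) j k
∂ varY F i j k = (+ suc j ℚ./ 1) ℚ.* F i (suc j) k

∂^ : Var → ℕ → FPS → FPS
∂^ v zero    F = F
∂^ v (suc n) F = ∂ v (∂^ v n F)

-- Polynomials P ∈ ℚ[x,y,t][z₀,…,z_n], given as finite lists of terms

record Term (n : ℕ) : Set where
  constructor term
  field
    coeff : ℚ
    ex ey et : ℕ
    ez : Vec ℕ (suc n)

Poly : ℕ → Set
Poly n = List (Term n)

eqVecᵇ : ∀ {m} → Vec ℕ m → Vec ℕ m → Bool
eqVecᵇ [] [] = true
eqVecᵇ (a ∷ as) (b ∷ bs) = (a ℕ.≡ᵇ b) ∧ eqVecᵇ as bs

polyCoeff : ∀ {n} → Poly n → ℕ → ℕ → ℕ → Vec ℕ (suc n) → ℚ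
polyCoeff P a b c e = foldr step 0ℚ P
  where
  step : _ → ℚ → ℚ
  step (term q a' b' c' e') acc =
    if (a ℕ.≡ᵇ a') ∧ (b ℕ.≡ᵇ b') ∧ (c ℕ.≡ᵇ c') ∧ eqVecᵇ e e'
    then q ℚ.+ acc else acc

NonZeroPoly : ∀ {n} → Poly n → Set
NonZeroPoly {n} P =
  Σ ℕ λ a → Σ ℕ λ b → Σ ℕ λ c → Σ (Vec ℕ (suc n)) λ e → ¬ (polyCoeff P a b c e ≡ 0ℚ)

zProd : ∀ {m} → Var → FPS → ℕ → Vec ℕ m → FPS
zProd v F l []       = mono 1ℚ 0 0 0
zProd v F l (e ∷ es) = pow (∂^ v l F) e ⊛ zProd v F (suc l) es

evalPoly : ∀ {n} → Var → Poly n → FPS → FPS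
evalPoly v P F = foldr (λ { (term q a b c e) acc → (mono q a b c ⊛ zProd v F 0 e) ⊕ acc }) zeroS P

-- F is v-hyperalgebraic: it satisfies a nonzero polynomial differential
-- equation in ∂/∂v with coefficients in ℚ[x,y,t] (equivalently ℚ(x,y,t),
-- after clearing denominators)
Hyperalgebraic : Var → FPS → Set
Hyperalgebraic v F =
  Σ ℕ λ n → Σ (Poly n) λ P → NonZeroPoly P × (∀ i j k → evalPoly v P F i j k ≡ 0ℚ)

st : ℤ → ℤ → Step
st a b = a , b

nineStepSets : List StepSet
nineStepSets =
    (st (+ 0) (+ 1) ∷ st (+ 1) (+ 0) ∷ st (ℤ.- + 1) (ℤ.- + 1) ∷ st (+ 0) (ℤ.- + 1) ∷ [])
  ∷ (st (+ 0) (+ 1) ∷ st (+ 1) (+ 0) ∷ st (ℤ.- + 1) (ℤ.- + 1) ∷ st (+ 1) (ℤ.- + 1) ∷ [])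
  ∷ (st (+ 0) (+ 1) ∷ st (+ 1) (+ 1) ∷ st (ℤ.- + 1) (+ 0) ∷ st (+ 0) (ℤ.- + 1) ∷ [])
  ∷ (st (+ 0) (+ 1) ∷ st (ℤ.- + 1) (+ 0) ∷ st (+ 1) (+ 0) ∷ st (+ 1) (ℤ.- + 1) ∷ [])
  ∷ (st (+ 0) (+ 1) ∷ st (+ 1) (+ 1) ∷ st (ℤ.- + 1) (+ 0) ∷ st (+ 1) (+ 0) ∷ st (ℤ.- + 1) (ℤ.- + 1) ∷ [])
  ∷ (st (+ 0) (+ 1) ∷ st (+ 1) (+ 1) ∷ st (ℤ.- + 1) (+ 0) ∷ st (ℤ.- + 1) (ℤ.- + 1) ∷ st (+ 0) (ℤ.- + 1) ∷ [])
  ∷ (st (+ 0) (+ 1) ∷ st (+ 1) (+ 0) ∷ st (ℤ.- + 1) (ℤ.- + 1) ∷ st (+ 0) (ℤ.- + 1) ∷ st (+ 1) (ℤ.- + 1) ∷ [])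
  ∷ (st (+ 0) (+ 1) ∷ st (+ 1) (+ 1) ∷ st (ℤ.- + 1) (+ 0) ∷ st (+ 1) (+ 0) ∷ st (+ 0) (ℤ.- + 1) ∷ [])
  ∷ (st (ℤ.- + 1) (+ 1) ∷ st (+ 0) (+ 1) ∷ st (+ 1) (+ 0) ∷ st (+ 0) (ℤ.- + 1) ∷ st (+ 1) (ℤ.- + 1) ∷ [])
  ∷ []

{-# OPTIONS --safe #-}
module Submission where

-- On the curve K = 0, where K = x y (1 - t Σ x^u y^v), the functional equation K Q = x y - R(x) - S(y)
-- and a decoupling x y = F(x) + G(y) make I(x) = F - R and J(y) = S - G a pair of invariants:
-- I(x) - J(y) is K times a series with poles only at x = 0 and y = 0.  Modulo K the discriminants of K
-- are squares of partial derivatives of K, so (Δx I′², Δy J′²) is again a pair of invariants.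
-- In all nine cases one of I, J has a simple pole at 0, hence a quartic polynomial P in I cancels the
-- poles of Δx I′²; pole-free invariants are constant because A(x) - B(y) = K M forces M = 0 for a
-- power series M.  So Δx I′² = P(I) and Δy J′² = P(J), where the coefficients of P are independent of
-- x and y, and differentiating five times along d/dI eliminates them (together with J, which is a
-- constant for ∂/∂x).  The result is an equation for Q over ℚ[x,y,t] of degree one in the sixth derivative.

open import Defs
open import Level using (0ℓ)
open import Algebra.Bundles using (CommutativeRing)
import Algebra.Properties.CommutativeMonoid.Mult as CommutativeMult
import Algebra.Properties.Ring as RingProperties
import Algebra.Properties.Semiring.Exp as SemiringExp
import Algebra.Properties.Semiring.Mult as SemiringMult
import Algebra.Solver.Ring.NaturalCoefficients.Default as NatSolver
open import Algebra.Structures using (IsCommutativeRing)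
open import Data.Bool using (Bool; true; false; _∧_; if_then_else_) renaming (T to IsTrue)
import Data.Bool.Properties as Bool
open import Data.Empty using (⊥-elim)
open import Data.Fin using (Fin; toℕ) renaming (zero to fzero; suc to fsuc)
open import Data.Integer as ℤ using (ℤ; +_; -[1+_]; 0ℤ; 1ℤ)
import Data.Integer.Properties as ℤ
open import Data.List using (List; []; _∷_; _++_; map; concatMap; length; filterᵇ)
open import Data.List.Membership.Propositional using (_∈_)
open import Data.List.Relation.Unary.Any using (here; there)
open import Data.Nat as ℕ using (ℕ; zero; suc; z≤n; s≤s)
import Data.Nat.Properties as ℕ
open import Algebra.Properties.CommutativeSemigroup ℕ.+-commutativeSemigroup using (interchange)
open import Data.Product using (Σ; _×_; _,_; proj₁; proj₂)
open import Data.Rational as ℚ using (ℚ; 0ℚ; 1ℚ)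
import Data.Rational.Properties as ℚ
import Data.Rational.Unnormalised as ℚᵘ
import Data.Rational.Unnormalised.Properties as ℚᵘ
open import Data.Sum as Sum using (_⊎_; inj₁; inj₂)
open import Data.Unit using (⊤; tt)
open import Data.Vec as Vec using (Vec; []; _∷_; lookup; zipWith; replicate)
open import Data.Vec.N-ary using (N-ary; _$ⁿ_)
open import Function using (_∘_; case_of_)
import Relation.Binary.Reasoning.Setoid as SetoidReasoning
open import Relation.Binary.PropositionalEquality as ≡ using (_≡_; _≢_)
open import Relation.Nullary using (Dec; yes; no)

-- The ring of power series is not localised. I and J are therefore kept as numerator and
-- denominator, polynomials in them become homogeneous forms and derivatives become Wronskians. The
-- residue of the invariant with the simple pole is a multiple of t, not a unit, so poles are
-- cancelled only after multiplication by powers of it. The degree 4 comes from the pole: if I has a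
-- simple pole, I′² has a pole of order 4, and Δx is a polynomial. The coefficients of P are unknown
-- series in t; all that is available is that they are constant, and this is all that the
-- elimination uses. The main obstacle is nontriviality: the equation must be nonzero as a
-- polynomial in independent jets, not merely vanish at Q. Its slope in the sixth derivative is (ζ
-- W)^5 times the derivative of the initial expression in the first-order jet. This slope involves
-- only jets of order 0 and 1, so one integer point settles it. The unknown enters through K (e + m
-- Q), with e and m polynomials, rather than through R or S; so all expressions are differential
-- polynomials in Q itself.

-- Power series in one variable over a commutative ring.

module Series (R : CommutativeRing 0ℓ 0ℓ) where
  open CommutativeRing R
  open RingProperties ring using (-0#≈0#)
  open SemiringMult semiring using (×-comm-*; ×-assoc-*) renaming (_×_ to _·_; ×-congʳ to ·-congʳ)
  open CommutativeMult +-commutativeMonoid using () renaming (×-distrib-+ to ·-distrib-+)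
  open NatSolver commutativeSemiring
  open SetoidReasoning setoid

  Ser : Set
  Ser = ℕ → Carrier

  infix 4 _≋_
  _≋_ : Ser → Ser → Set
  F ≋ G = ∀ n → F n ≈ G n

  -- Recursion on the degree with `F` shifted, instead of a sum over indices, makes the ring laws
  -- structural inductions; `conv-sum` recovers the usual formula.
  conv : Ser → Ser → Ser
  conv F G zero    = F 0 * G 0
  conv F G (suc n) = F 0 * G (suc n) + conv (F ∘ suc) G n

  const : Carrier → Ser
  const c zero    = c
  const c (suc _) = 0#

  X : Ser
  X zero    = 0#
  X (suc n) = const 1# n

  conv-cong : ∀ {F F′ G G′} → F ≋ F′ → G ≋ G′ → conv F G ≋ conv F′ G′
  conv-cong p q zero    = *-cong (p 0) (q 0)
  conv-cong p q (suc n) = +-cong (*-cong (p 0) (q (suc n))) (conv-cong (p ∘ suc) q n)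

  conv-zeroˡ : ∀ {F} G → F ≋ (λ _ → 0#) → ∀ n → conv F G n ≈ 0#
  conv-zeroˡ G p zero    = trans (*-congʳ (p 0)) (zeroˡ _)
  conv-zeroˡ G p (suc n) =
    trans (+-cong (trans (*-congʳ (p 0)) (zeroˡ _)) (conv-zeroˡ G (p ∘ suc) n)) (+-identityˡ 0#)

  const-conv : ∀ c F n → conv (const c) F n ≈ c * F n
  const-conv c F zero    = refl
  const-conv c F (suc n) = trans (+-congˡ (conv-zeroˡ F (λ _ → refl) n)) (+-identityʳ _)

  X-conv : ∀ F n → conv X F (suc n) ≈ F n
  X-conv F n = begin
    0# * F (suc n) + conv (X ∘ suc) F n ≈⟨ +-cong (zeroˡ _) (const-conv 1# F n) ⟩
    0# + 1# * F n                       ≈⟨ trans (+-identityˡ _) (*-identityˡ _) ⟩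
    F n                                 ∎

  conv-suc : ∀ F G n → conv F G (suc n) ≈ conv F (G ∘ suc) n + F (suc n) * G 0
  conv-suc F G zero    = refl
  conv-suc F G (suc n) = trans (+-congˡ (conv-suc (F ∘ suc) G n)) (sym (+-assoc _ _ _))

  conv-comm : ∀ F G → conv F G ≋ conv G F
  conv-comm F G zero    = *-comm _ _
  conv-comm F G (suc n) = begin
    F 0 * G (suc n) + conv (F ∘ suc) G n ≈⟨ +-cong (*-comm _ _) (conv-comm (F ∘ suc) G n) ⟩
    G (suc n) * F 0 + conv G (F ∘ suc) n ≈⟨ +-comm _ _ ⟩
    conv G (F ∘ suc) n + G (suc n) * F 0 ≈⟨ conv-suc G F n ⟨
    conv G F (suc n)                     ∎

  conv-distribʳ : ∀ F G H n → conv (λ m → F m + G m) H n ≈ conv F H n + conv G H n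
  conv-distribʳ F G H zero    = distribʳ _ _ _
  conv-distribʳ F G H (suc n) = trans (+-congˡ (conv-distribʳ (F ∘ suc) (G ∘ suc) H n))
    (solve 5 (λ a b h u v → (a :+ b) :* h :+ (u :+ v) := (a :* h :+ u) :+ (b :* h :+ v)) refl
      (F 0) (G 0) (H (suc n)) (conv (F ∘ suc) H n) (conv (G ∘ suc) H n))

  conv-scaleˡ : ∀ c F G n → conv (λ m → c * F m) G n ≈ c * conv F G n
  conv-scaleˡ c F G zero    = *-assoc _ _ _
  conv-scaleˡ c F G (suc n) = trans (+-cong (*-assoc _ _ _) (conv-scaleˡ c (F ∘ suc) G n)) (sym (distribˡ _ _ _))

  conv-assoc : ∀ F G H → conv (conv F G) H ≋ conv F (conv G H)
  conv-assoc F G H zero    = *-assoc _ _ _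
  conv-assoc F G H (suc n) = begin
    F 0 * G 0 * H (suc n) + conv (λ m → F 0 * G (suc m) + conv (F ∘ suc) G m) H n
      ≈⟨ +-congˡ (conv-distribʳ (λ m → F 0 * G (suc m)) (conv (F ∘ suc) G) H n) ⟩
    F 0 * G 0 * H (suc n) + (conv (λ m → F 0 * G (suc m)) H n + conv (conv (F ∘ suc) G) H n)
      ≈⟨ +-congˡ (+-cong (conv-scaleˡ (F 0) (G ∘ suc) H n) (conv-assoc (F ∘ suc) G H n)) ⟩
    F 0 * G 0 * H (suc n) + (F 0 * conv (G ∘ suc) H n + conv (F ∘ suc) (conv G H) n)
      ≈⟨ solve 5 (λ a b c d e → a :* b :* c :+ (a :* d :+ e) := a :* (b :* c :+ d) :+ e) refl
           (F 0) (G 0) (H (suc n)) (conv (G ∘ suc) H n) (conv (F ∘ suc) (conv G H) n) ⟩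
    F 0 * (G 0 * H (suc n) + conv (G ∘ suc) H n) + conv (F ∘ suc) (conv G H) n ∎

  seriesRing : CommutativeRing 0ℓ 0ℓ
  seriesRing = record
    { Carrier = Ser
    ; _≈_ = _≋_
    ; _+_ = λ F G n → F n + G n
    ; _*_ = conv
    ; -_ = λ F n → - F n
    ; 0# = λ _ → 0#
    ; 1# = const 1#
    ; isCommutativeRing = record
      { isRing = record
        { +-isAbelianGroup = record
          { isGroup = record
            { isMonoid = record
              { isSemigroup = record
                { isMagma = record
                  { isEquivalence = record
                    { refl = λ _ → refl ; sym = λ p n → sym (p n) ; trans = λ p q n → trans (p n) (q n) }
                  ; ∙-cong = λ p q n → +-cong (p n) (q n) }
                ; assoc = λ F G H n → +-assoc (F n) (G n) (H n) }
              ; identity = (λ F n → +-identityˡ (F n)) , (λ F n → +-identityʳ (F n)) }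
            ; inverse = (λ F n → -‿inverseˡ (F n)) , (λ F n → -‿inverseʳ (F n))
            ; ⁻¹-cong = λ p n → -‿cong (p n) }
          ; comm = λ F G n → +-comm (F n) (G n) }
        ; *-cong = conv-cong
        ; *-assoc = conv-assoc
        ; *-identity = identityˡ , (λ F n → trans (conv-comm F (const 1#) n) (identityˡ F n))
        ; distrib = (λ F G H n → trans (conv-comm F (λ m → G m + H m) n)
                        (trans (conv-distribʳ G H F n) (+-cong (conv-comm G F n) (conv-comm H F n))))
                  , (λ F G H → conv-distribʳ G H F) }
      ; *-comm = conv-comm } }
    where
    identityˡ : ∀ F → conv (const 1#) F ≋ F
    identityˡ F n = trans (const-conv 1# F n) (*-identityˡ (F n))

  D : Ser → Ser
  D F n = suc n · F (suc n)

  private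
    E : Ser → Ser
    E F n = n · F n

    -- The Euler operator does not shift indices, so its Leibniz rule goes by induction on the
    -- degree; `D` is `E` followed by a shift and inherits the rule.
    E-leibniz : ∀ F G n → n · conv F G n ≈ conv (E F) G n + conv F (E G) n
    E-leibniz F G zero    = sym (trans (+-cong (zeroˡ _) (zeroʳ _)) (+-identityˡ 0#))
    E-leibniz F G (suc n) = begin
      suc n · (F 0 * G (suc n) + conv F′ G n)
        ≈⟨ ·-distrib-+ _ _ (suc n) ⟩
      suc n · (F 0 * G (suc n)) + (conv F′ G n + n · conv F′ G n)
        ≈⟨ +-cong (sym (×-comm-* (suc n) (F 0) (G (suc n)))) (+-congˡ (E-leibniz F′ G n)) ⟩
      F 0 * E G (suc n) + (conv F′ G n + (conv (E F′) G n + conv F′ (E G) n))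
        ≈⟨ solve 4 (λ a b c d → a :+ (b :+ (c :+ d)) := (b :+ c) :+ (a :+ d)) refl _ _ _ _ ⟩
      (conv F′ G n + conv (E F′) G n) + (F 0 * E G (suc n) + conv F′ (E G) n)
        ≈⟨ +-congʳ (conv-distribʳ F′ (E F′) G n) ⟨
      conv (E F ∘ suc) G n + (F 0 * E G (suc n) + conv F′ (E G) n)
        ≈⟨ +-congʳ (trans (+-congʳ (zeroˡ _)) (+-identityˡ _)) ⟨
      (0# * G (suc n) + conv (E F ∘ suc) G n) + (F 0 * E G (suc n) + conv F′ (E G) n) ∎
      where
      F′ : Ser
      F′ = F ∘ suc

  D-leibniz : ∀ F G n → D (conv F G) n ≈ conv (D F) G n + conv F (D G) n
  D-leibniz F G n = begin
    suc n · conv F G (suc n)                        ≈⟨ E-leibniz F G (suc n) ⟩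
    (0# * G (suc n) + conv (D F) G n) + conv F (E G) (suc n)
      ≈⟨ +-cong (trans (+-congʳ (zeroˡ _)) (+-identityˡ _)) (conv-suc F (E G) n) ⟩
    conv (D F) G n + (conv F (D G) n + F (suc n) * 0#)
      ≈⟨ +-congˡ (trans (+-congˡ (zeroʳ _)) (+-identityʳ _)) ⟩
    conv (D F) G n + conv F (D G) n ∎

  lift-* : (φ : Carrier → Carrier) → (∀ a b → φ (a + b) ≈ φ a + φ b) → (∀ a b → φ (a * b) ≈ φ a * φ b) →
    ∀ F G n → φ (conv F G n) ≈ conv (φ ∘ F) (φ ∘ G) n
  lift-* φ φ+ φ* F G zero    = φ* _ _
  lift-* φ φ+ φ* F G (suc n) = trans (φ+ _ _) (+-cong (φ* _ _) (lift-* φ φ+ φ* (F ∘ suc) G n))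

  lift-leibniz : (d : Carrier → Carrier) → (∀ a b → d (a + b) ≈ d a + d b) →
    (∀ a b → d (a * b) ≈ d a * b + a * d b) →
    ∀ F G n → d (conv F G n) ≈ conv (d ∘ F) G n + conv F (d ∘ G) n
  lift-leibniz d d+ d* F G zero    = d* _ _
  lift-leibniz d d+ d* F G (suc n) = begin
    d (F 0 * G (suc n) + conv (F ∘ suc) G n)
      ≈⟨ trans (d+ _ _) (+-cong (d* _ _) (lift-leibniz d d+ d* (F ∘ suc) G n)) ⟩
    (d (F 0) * G (suc n) + F 0 * d (G (suc n))) + (conv (d ∘ F ∘ suc) G n + conv (F ∘ suc) (d ∘ G) n)
      ≈⟨ solve 4 (λ a b c e → (a :+ b) :+ (c :+ e) := (a :+ c) :+ (b :+ e)) refl _ _ _ _ ⟩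
    (d (F 0) * G (suc n) + conv (d ∘ F ∘ suc) G n) + (F 0 * d (G (suc n)) + conv (F ∘ suc) (d ∘ G) n) ∎

  sum : ℕ → (ℕ → Carrier) → Carrier
  sum zero    f = f 0
  sum (suc n) f = sum n f + f (suc n)

  conv-sum : ∀ F G n → conv F G n ≈ sum n (λ a → F a * G (n ℕ.∸ a))
  conv-sum F G zero    = refl
  conv-sum F G (suc n) = trans (+-congˡ (conv-sum (F ∘ suc) G n)) (sym (sum-suc n (λ a → F a * G (suc n ℕ.∸ a))))
    where
    sum-suc : ∀ n f → sum (suc n) f ≈ f 0 + sum n (f ∘ suc)
    sum-suc zero    f = refl
    sum-suc (suc n) f = trans (+-congʳ (sum-suc n f)) (+-assoc _ _ _)

  const-+ : ∀ a b n → const (a + b) n ≈ const a n + const b n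
  const-+ a b zero    = refl
  const-+ a b (suc n) = sym (+-identityˡ 0#)

  const-* : ∀ a b n → const (a * b) n ≈ conv (const a) (const b) n
  const-* a b zero    = refl
  const-* a b (suc n) = sym (trans (const-conv a (const b) (suc n)) (zeroʳ a))

  const-neg : ∀ a n → const (- a) n ≈ - const a n
  const-neg a zero    = refl
  const-neg a (suc n) = sym -0#≈0#

  const-cong : ∀ {a b} → a ≈ b → const a ≋ const b
  const-cong p zero    = p
  const-cong p (suc n) = refl

  const-0 : const 0# ≋ (λ _ → 0#)
  const-0 zero    = refl
  const-0 (suc n) = refl

-- Integers inside the rationals, ring expressions and polynomial normal forms.

fromℤ : ℤ → ℚ
fromℤ i = i ℚ./ 1

private
  toℚᵘ-fromℤ : ∀ i → ℚ.toℚᵘ (fromℤ i) ℚᵘ.≃ ℚᵘ.mkℚᵘ i 0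
  toℚᵘ-fromℤ i = ℚ.toℚᵘ-fromℚᵘ (ℚᵘ.mkℚᵘ i 0)

fromℤ-+ : ∀ i j → fromℤ (i ℤ.+ j) ≡ fromℤ i ℚ.+ fromℤ j
fromℤ-+ i j = ℚ.toℚᵘ-injective (ℚᵘ.≃-trans (toℚᵘ-fromℤ (i ℤ.+ j))
  (ℚᵘ.≃-sym (ℚᵘ.≃-trans (ℚ.toℚᵘ-homo-+ (fromℤ i) (fromℤ j)) (ℚᵘ.≃-trans (ℚᵘ.+-cong (toℚᵘ-fromℤ i) (toℚᵘ-fromℤ j))
    (ℚᵘ.*≡* (≡.cong (ℤ._* + 1) (≡.cong₂ ℤ._+_ (ℤ.*-identityʳ i) (ℤ.*-identityʳ j))))))))

fromℤ-* : ∀ i j → fromℤ (i ℤ.* j) ≡ fromℤ i ℚ.* fromℤ j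
fromℤ-* i j = ℚ.toℚᵘ-injective (ℚᵘ.≃-trans (toℚᵘ-fromℤ (i ℤ.* j))
  (ℚᵘ.≃-sym (ℚᵘ.≃-trans (ℚ.toℚᵘ-homo-* (fromℤ i) (fromℤ j)) (ℚᵘ.*-cong (toℚᵘ-fromℤ i) (toℚᵘ-fromℤ j)))))

fromℤ-neg : ∀ i → fromℤ (ℤ.- i) ≡ ℚ.- fromℤ i
fromℤ-neg i = ℚ.toℚᵘ-injective (ℚᵘ.≃-trans (toℚᵘ-fromℤ (ℤ.- i))
  (ℚᵘ.≃-sym (ℚᵘ.≃-trans (ℚ.toℚᵘ-homo‿- (fromℤ i)) (ℚᵘ.-‿cong (toℚᵘ-fromℤ i)))))

infixl 6 _:+_ _:-_
infixl 7 _:*_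
infix 8 :-_
infixr 8 _:^_

data Exp (V : Set) : Set where
  con       : ℤ → Exp V
  var       : V → Exp V
  _:+_ _:*_ : Exp V → Exp V → Exp V
  :-_       : Exp V → Exp V

_:-_ : ∀ {V} → Exp V → Exp V → Exp V
a :- b = a :+ :- b

_:^_ : ∀ {V} → Exp V → ℕ → Exp V
a :^ zero  = con 1ℤ
a :^ suc n = a :* a :^ n

mapVar : ∀ {V W} → (V → W) → Exp V → Exp W
mapVar f (con c)  = con c
mapVar f (var v)  = var (f v)
mapVar f (a :+ b) = mapVar f a :+ mapVar f b
mapVar f (a :* b) = mapVar f a :* mapVar f b
mapVar f (:- a)   = :- mapVar f a

∧-true : ∀ a b → a ∧ b ≡ true → a ≡ true × b ≡ true
∧-true true true _ = ≡.refl , ≡.refl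

≡ᵇ-sound : ∀ m n → (m ℕ.≡ᵇ n) ≡ true → m ≡ n
≡ᵇ-sound m n p = ℕ.≡ᵇ⇒≡ m n (≡.subst IsTrue (≡.sym p) _)

eqVecᵇ-sound : ∀ {m} (a b : Vec ℕ m) → eqVecᵇ a b ≡ true → a ≡ b
eqVecᵇ-sound []       []       _ = ≡.refl
eqVecᵇ-sound (a ∷ as) (b ∷ bs) p with ∧-true (a ℕ.≡ᵇ b) (eqVecᵇ as bs) p
... | q , r = ≡.cong₂ _∷_ (≡ᵇ-sound a b q) (eqVecᵇ-sound as bs r)

-- insert merges equal exponent vectors and drops vanishing terms, so that nf (a :- b) is [] when a and b agree.
module NormalForm {n : ℕ} where
  NF : Set
  NF = List (ℤ × Vec ℕ n)

  cons : ℤ → Vec ℕ n → NF → NF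
  cons (+ 0) m P = P
  cons c     m P = (c , m) ∷ P

  insert : ℤ → Vec ℕ n → NF → NF
  insert c m []            = cons c m []
  insert c m ((d , l) ∷ P) = if eqVecᵇ m l then cons (c ℤ.+ d) l P else (d , l) ∷ insert c m P

  plus : NF → NF → NF
  plus []            Q = Q
  plus ((c , m) ∷ P) Q = insert c m (plus P Q)

  scale : ℤ → Vec ℕ n → NF → NF → NF
  scale c m []            acc = acc
  scale c m ((d , l) ∷ Q) acc = insert (c ℤ.* d) (zipWith ℕ._+_ m l) (scale c m Q acc)

  times : NF → NF → NF
  times []            Q = []
  times ((c , m) ∷ P) Q = scale c m Q (times P Q)

unitVec : ∀ {n} → Fin n → Vec ℕ n
unitVec fzero    = 1 ∷ replicate _ 0
unitVec (fsuc i) = 0 ∷ unitVec i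

open NormalForm

nf : ∀ {n} → Exp (Fin n) → NF {n}
nf (con c)  = cons c (replicate _ 0) []
nf (var i)  = (1ℤ , unitVec i) ∷ []
nf (a :+ b) = plus (nf a) (nf b)
nf (a :* b) = times (nf a) (nf b)
nf (:- a)   = scale (ℤ.- 1ℤ) (replicate _ 0) (nf a) []

-- Algebras over the rationals, with a reflective ring solver.

record ℚ-Algebra : Set₁ where
  field
    commRing : CommutativeRing 0ℓ 0ℓ
  open CommutativeRing commRing public hiding (zero)
  open SemiringExp semiring public using (_^_; ^-congˡ; ^-assocʳ; ^-homo-*)
  open RingProperties (CommutativeRing.ring commRing) public using (-0#≈0#; -‿distribˡ-*)
  field
    ι   : ℚ → Carrier
    ι-+ : ∀ p q → ι (p ℚ.+ q) ≈ ι p + ι q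
    ι-* : ∀ p q → ι (p ℚ.* q) ≈ ι p * ι q
    ι-- : ∀ p → ι (ℚ.- p) ≈ - ι p
    ι-0 : ι 0ℚ ≈ 0#
    ι-1 : ι 1ℚ ≈ 1#

  private
    ι-cong : ∀ {p q} → p ≡ q → ι p ≈ ι q
    ι-cong ≡.refl = refl

  -- 0 and 1 are singled out so that terms of the ring language evaluate to 0# and 1# on the nose.
  ⟦_⟧ℤ : ℤ → Carrier
  ⟦ + 0 ⟧ℤ = 0#
  ⟦ + 1 ⟧ℤ = 1#
  ⟦ c ⟧ℤ   = ι (fromℤ c)

  ⟦⟧ℤ-ι : ∀ c → ⟦ c ⟧ℤ ≈ ι (fromℤ c)
  ⟦⟧ℤ-ι (+ 0)             = sym ι-0
  ⟦⟧ℤ-ι (+ 1)             = sym ι-1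
  ⟦⟧ℤ-ι (+ suc (suc n))   = refl
  ⟦⟧ℤ-ι (-[1+ n ])        = refl

  ⟦_⟧ : ∀ {V} → Exp V → (V → Carrier) → Carrier
  ⟦ con c ⟧  ρ = ⟦ c ⟧ℤ
  ⟦ var v ⟧  ρ = ρ v
  ⟦ a :+ b ⟧ ρ = ⟦ a ⟧ ρ + ⟦ b ⟧ ρ
  ⟦ a :* b ⟧ ρ = ⟦ a ⟧ ρ * ⟦ b ⟧ ρ
  ⟦ :- a ⟧   ρ = - ⟦ a ⟧ ρ

  monomial : ∀ {n} → Vec ℕ n → (Fin n → Carrier) → Carrier
  monomial []      ρ = 1#
  monomial (e ∷ m) ρ = ρ fzero ^ e * monomial m (λ i → ρ (fsuc i))

  evalNF : ∀ {n} → NF {n} → (Fin n → Carrier) → Carrier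
  evalNF []            ρ = 0#
  evalNF ((c , m) ∷ P) ρ = ι (fromℤ c) * monomial m ρ + evalNF P ρ

  private
    open NatSolver commutativeSemiring using (solve; _:=_) renaming (_:+_ to _:⊕_; _:*_ to _:⊗_)

    swap-+ : ∀ a b c → a + (b + c) ≈ b + (a + c)
    swap-+ a b c = solve 3 (λ a b c → a :⊕ (b :⊕ c) := b :⊕ (a :⊕ c)) refl a b c

  monomial-0 : ∀ n (ρ : Fin n → Carrier) → monomial (replicate n 0) ρ ≈ 1#
  monomial-0 zero    ρ = refl
  monomial-0 (suc n) ρ = trans (*-identityˡ _) (monomial-0 n _)

  monomial-unit : ∀ {n} (i : Fin n) ρ → monomial (unitVec i) ρ ≈ ρ i
  monomial-unit {suc n} fzero    ρ = trans (*-cong (*-identityʳ _) (monomial-0 n _)) (*-identityʳ _)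
  monomial-unit {suc n} (fsuc i) ρ = trans (*-identityˡ _) (monomial-unit i _)

  monomial-+ : ∀ {n} (m l : Vec ℕ n) ρ → monomial (zipWith ℕ._+_ m l) ρ ≈ monomial m ρ * monomial l ρ
  monomial-+ []      []      ρ = sym (*-identityʳ 1#)
  monomial-+ (d ∷ m) (e ∷ l) ρ = trans (*-cong (^-homo-* (ρ fzero) d e) (monomial-+ m l _))
    (solve 4 (λ a b c d → a :⊗ b :⊗ (c :⊗ d) := a :⊗ c :⊗ (b :⊗ d)) refl
      (ρ fzero ^ d) (ρ fzero ^ e) (monomial m (λ i → ρ (fsuc i))) (monomial l (λ i → ρ (fsuc i))))

  module _ {n : ℕ} (ρ : Fin n → Carrier) where
    cons-eval : ∀ c m P → evalNF (cons c m P) ρ ≈ ι (fromℤ c) * monomial m ρ + evalNF P ρ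
    cons-eval (+ 0)       m P = sym (trans (+-congʳ (trans (*-congʳ ι-0) (zeroˡ _))) (+-identityˡ _))
    cons-eval (+ suc _)   m P = refl
    cons-eval (-[1+ _ ])  m P = refl

    insert-eval : ∀ c m P → evalNF (insert c m P) ρ ≈ ι (fromℤ c) * monomial m ρ + evalNF P ρ
    insert-eval c m [] = cons-eval c m []
    insert-eval c m ((d , l) ∷ P) with eqVecᵇ m l in eq
    ... | false = trans (+-congˡ (insert-eval c m P)) (swap-+ _ _ _)
    ... | true with ≡.refl ← eqVecᵇ-sound m l eq = trans (cons-eval (c ℤ.+ d) m P)
      (trans (+-congʳ (trans (*-congʳ (trans (ι-cong (fromℤ-+ c d)) (ι-+ _ _))) (distribʳ _ _ _))) (+-assoc _ _ _))

    plus-eval : ∀ P Q → evalNF (plus P Q) ρ ≈ evalNF P ρ + evalNF Q ρ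
    plus-eval []            Q = sym (+-identityˡ _)
    plus-eval ((c , m) ∷ P) Q = trans (insert-eval c m (plus P Q)) (trans (+-congˡ (plus-eval P Q)) (sym (+-assoc _ _ _)))

    scale-eval : ∀ c m Q acc → evalNF (scale c m Q acc) ρ ≈ ι (fromℤ c) * monomial m ρ * evalNF Q ρ + evalNF acc ρ
    scale-eval c m []            acc = sym (trans (+-congʳ (zeroʳ _)) (+-identityˡ _))
    scale-eval c m ((d , l) ∷ Q) acc = trans (insert-eval (c ℤ.* d) _ (scale c m Q acc))
      (trans (+-cong (*-cong (trans (ι-cong (fromℤ-* c d)) (ι-* _ _)) (monomial-+ m l ρ)) (scale-eval c m Q acc))
        (solve 6 (λ c m d l q a → c :⊗ d :⊗ (m :⊗ l) :⊕ (c :⊗ m :⊗ q :⊕ a) := c :⊗ m :⊗ (d :⊗ l :⊕ q) :⊕ a) refl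
          (ι (fromℤ c)) (monomial m ρ) (ι (fromℤ d)) (monomial l ρ) (evalNF Q ρ) (evalNF acc ρ)))

    times-eval : ∀ P Q → evalNF (times P Q) ρ ≈ evalNF P ρ * evalNF Q ρ
    times-eval []            Q = sym (zeroˡ _)
    times-eval ((c , m) ∷ P) Q = trans (scale-eval c m Q (times P Q)) (trans (+-congˡ (times-eval P Q)) (sym (distribʳ _ _ _)))

    nf-eval : ∀ e → evalNF (nf e) ρ ≈ ⟦ e ⟧ ρ
    nf-eval (con c)  = trans (cons-eval c _ []) (trans (+-identityʳ _)
      (trans (*-cong (sym (⟦⟧ℤ-ι c)) (monomial-0 n ρ)) (*-identityʳ _)))
    nf-eval (var i)  = trans (+-identityʳ _) (trans (*-cong ι-1 (monomial-unit i ρ)) (*-identityˡ _))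
    nf-eval (a :+ b) = trans (plus-eval (nf a) (nf b)) (+-cong (nf-eval a) (nf-eval b))
    nf-eval (a :* b) = trans (times-eval (nf a) (nf b)) (*-cong (nf-eval a) (nf-eval b))
    nf-eval (:- a)   = trans (scale-eval (ℤ.- 1ℤ) (replicate _ 0) (nf a) []) (trans (+-identityʳ _)
      (trans (*-cong (trans (*-cong (trans (ι-- 1ℚ) (-‿cong ι-1)) (monomial-0 n ρ)) (*-identityʳ _)) (nf-eval a))
        (trans (sym (-‿distribˡ-* 1# _)) (-‿cong (*-identityˡ _)))))

    nf-sound : ∀ a b → nf (a :- b) ≡ [] → ⟦ a ⟧ ρ ≈ ⟦ b ⟧ ρ
    nf-sound a b p = begin
      ⟦ a ⟧ ρ                            ≈⟨ trans (+-assoc _ _ _) (trans (+-congˡ (-‿inverseˡ _)) (+-identityʳ _)) ⟨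
      ⟦ a ⟧ ρ - ⟦ b ⟧ ρ + ⟦ b ⟧ ρ        ≈⟨ +-congʳ (nf-eval (a :- b)) ⟨
      evalNF (nf (a :- b)) ρ + ⟦ b ⟧ ρ   ≡⟨ ≡.cong (λ P → evalNF P ρ + ⟦ b ⟧ ρ) p ⟩
      0# + ⟦ b ⟧ ρ                       ≈⟨ +-identityˡ _ ⟩
      ⟦ b ⟧ ρ                            ∎
      where open SetoidReasoning setoid

  infix 4 _≔_
  _≔_ : ∀ {V} → Exp V → Exp V → Exp V × Exp V
  _≔_ = _,_

  private
    close : ∀ n → N-ary n (Exp (Fin n)) (Exp (Fin n) × Exp (Fin n)) → Exp (Fin n) × Exp (Fin n)
    close n f = f $ⁿ Vec.map var (Vec.allFin n)

    ∀ⁿ : ∀ n → (Vec Carrier n → Set) → Set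
    ∀ⁿ zero    P = P []
    ∀ⁿ (suc n) P = ∀ x → ∀ⁿ n (λ xs → P (x ∷ xs))

    ∀ⁿ-intro : ∀ n {P : Vec Carrier n → Set} → (∀ xs → P xs) → ∀ⁿ n P
    ∀ⁿ-intro zero    p = p []
    ∀ⁿ-intro (suc n) p = λ x → ∀ⁿ-intro n (λ xs → p (x ∷ xs))

  -- The normal form is computed from closed syntax with integer coefficients, without touching the
  -- carrier; so the hypothesis is discharged by `refl` in every algebra.
  ring! : ∀ n (f : N-ary n (Exp (Fin n)) (Exp (Fin n) × Exp (Fin n))) →
    nf (proj₁ (close n f) :- proj₂ (close n f)) ≡ [] →
    ∀ⁿ n (λ xs → ⟦ proj₁ (close n f) ⟧ (lookup xs) ≈ ⟦ proj₂ (close n f) ⟧ (lookup xs))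
  ring! n f p = ∀ⁿ-intro n (λ xs → nf-sound (lookup xs) (proj₁ (close n f)) (proj₂ (close n f)) p)

  x-y≈0⇒x≈y : ∀ {x y} → x - y ≈ 0# → x ≈ y
  x-y≈0⇒x≈y {x} {y} p = trans (ring! 2 (λ a b → a ≔ a :- b :+ b) ≡.refl x y) (trans (+-congʳ p) (+-identityˡ y))

  x≈y⇒x-y≈0 : ∀ {x y} → x ≈ y → x - y ≈ 0#
  x≈y⇒x-y≈0 {x} {y} p = trans (+-congʳ p) (-‿inverseʳ y)

-- Derivations of an algebra.

module Derivations (A : ℚ-Algebra) where
  open ℚ-Algebra A

  nat : ℕ → Carrier
  nat zero    = 0#
  nat (suc n) = 1# + nat n

  record Derivation (d : Carrier → Carrier) : Set where
    field
      d-cong : ∀ {a b} → a ≈ b → d a ≈ d b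
      d-+    : ∀ a b → d (a + b) ≈ d a + d b
      d-*    : ∀ a b → d (a * b) ≈ d a * b + a * d b
      d-ι    : ∀ q → d (ι q) ≈ 0#

    d-0 : d 0# ≈ 0#
    d-0 = trans (d-cong (sym ι-0)) (d-ι 0ℚ)

    d-1 : d 1# ≈ 0#
    d-1 = trans (d-cong (sym ι-1)) (d-ι 1ℚ)

    d-neg : ∀ a → d (- a) ≈ - d a
    d-neg a = x-y≈0⇒x≈y (begin
      d (- a) - - d a ≈⟨ ring! 2 (λ u v → u :- (:- v) ≔ u :+ v) ≡.refl (d (- a)) (d a) ⟩
      d (- a) + d a   ≈⟨ d-+ _ _ ⟨
      d (- a + a)     ≈⟨ trans (d-cong (-‿inverseˡ a)) d-0 ⟩
      0#              ∎)
      where open SetoidReasoning setoid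

    d-sub : ∀ a b → d (a - b) ≈ d a - d b
    d-sub a b = trans (d-+ a (- b)) (+-congˡ (d-neg b))

    d-*₀ : ∀ {a b} → d a ≈ 0# → d b ≈ 0# → d (a * b) ≈ 0#
    d-*₀ {a} {b} p q = trans (d-* a b) (trans (+-cong (trans (*-congʳ p) (zeroˡ _)) (trans (*-congˡ q) (zeroʳ _))) (+-identityˡ 0#))

    d-+₀ : ∀ {a b} → d a ≈ 0# → d b ≈ 0# → d (a + b) ≈ 0#
    d-+₀ {a} {b} p q = trans (d-+ a b) (trans (+-cong p q) (+-identityˡ 0#))

    d-sub₀ : ∀ {a b} → d a ≈ 0# → d b ≈ 0# → d (a - b) ≈ 0#
    d-sub₀ {a} {b} p q = d-+₀ p (trans (d-neg b) (trans (-‿cong q) -0#≈0#))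

    d-^₀ : ∀ {a} n → d a ≈ 0# → d (a ^ n) ≈ 0#
    d-^₀ zero    p = d-1
    d-^₀ (suc n) p = d-*₀ p (d-^₀ n p)

    d-^ : ∀ a n → d (a ^ suc n) ≈ nat (suc n) * a ^ n * d a
    d-^ a zero    = trans (d-* a 1#) (trans (+-congˡ (*-congˡ d-1))
      (ring! 2 (λ u v → v :* con 1ℤ :+ u :* con 0ℤ ≔ (con 1ℤ :+ con 0ℤ) :* con 1ℤ :* v) ≡.refl a (d a)))
    d-^ a (suc n) = trans (d-* a (a ^ suc n)) (trans (+-congˡ (*-congˡ (d-^ a n)))
      (ring! 4 (λ u v p m → v :* (u :* p) :+ u :* ((con 1ℤ :+ m) :* p :* v)
                          ≔ (con 1ℤ :+ (con 1ℤ :+ m)) :* (u :* p) :* v) ≡.refl a (d a) (a ^ n) (nat n)))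

-- Homogeneous forms and the elimination of their coefficients.

module Forms (A : ℚ-Algebra) where
  open ℚ-Algebra A
  open Derivations A
  open SetoidReasoning setoid

  -- With P(X) the polynomial with coefficients `c`, this is z^n P(a/z): the form stands for a
  -- polynomial in a quotient that the ring need not contain.
  form : ℕ → (ℕ → Carrier) → Carrier → Carrier → Carrier
  form zero    c a z = c 0
  form (suc n) c a z = c (suc n) * a ^ suc n + z * form n c a z

  -- The coefficients of ∂/∂a of the form.
  shifted : (ℕ → Carrier) → ℕ → Carrier
  shifted c k = nat (suc k) * c (suc k)

  form-scale : ∀ s n c a z → s * form n c a z ≈ form n (λ k → s * c k) a z
  form-scale s zero    c a z = refl
  form-scale s (suc n) c a z = trans
    (ring! 5 (λ s c p z f → s :* (c :* p :+ z :* f) ≔ s :* c :* p :+ z :* (s :* f)) ≡.refl s (c (suc n)) (a ^ suc n) z (form n c a z))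
    (+-congˡ (*-congˡ (form-scale s n c a z)))

  pow-diff : ∀ n p q {k} {m} → p - q ≈ k * m → Σ Carrier λ m′ → p ^ n - q ^ n ≈ k * m′
  pow-diff zero p q _ = 0# , trans (-‿inverseʳ 1#) (sym (zeroʳ _))
  pow-diff (suc n) p q {k} {m} e with pow-diff n p q e
  ... | m′ , e′ = m * p ^ n + q * m′ , (begin
    p * p ^ n - q * q ^ n                     ≈⟨ ring! 4 (λ p q u v → p :* u :- q :* v ≔ (p :- q) :* u :+ q :* (u :- v)) ≡.refl p q (p ^ n) (q ^ n) ⟩
    (p - q) * p ^ n + q * (p ^ n - q ^ n)     ≈⟨ +-cong (*-congʳ e) (*-congˡ e′) ⟩
    k * m * p ^ n + q * (k * m′)              ≈⟨ ring! 5 (λ k m u q v → k :* m :* u :+ q :* (k :* v) ≔ k :* (m :* u :+ q :* v)) ≡.refl k m (p ^ n) q m′ ⟩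
    k * (m * p ^ n + q * m′)                  ∎)

  *-^ : ∀ a b n → (a * b) ^ n ≈ a ^ n * b ^ n
  *-^ a b zero    = sym (*-identityˡ 1#)
  *-^ a b (suc n) = trans (*-congˡ (*-^ a b n))
    (ring! 4 (λ a b u v → a :* b :* (u :* v) ≔ a :* u :* (b :* v)) ≡.refl a b (a ^ n) (b ^ n))

  -- The left side is (z w)^n (P(a/z) - P(b/w)), and the hypothesis makes a/z - b/w a multiple of
  -- `k` up to the denominator z w; `pow-diff` treats one power at a time.
  form-diff : ∀ n c a b z w {k m} → w * a - z * b ≈ k * m →
    Σ Carrier λ m′ → w ^ n * form n c a z - z ^ n * form n c b w ≈ k * m′
  form-diff zero c a b z w e = 0# , trans (-‿inverseʳ _) (sym (zeroʳ _))
  form-diff (suc n) c a b z w {k} e = c (suc n) * m′ + w * z * m , (begin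
    w * w ^ n * (c (suc n) * a ^ suc n + z * form n c a z) - z * z ^ n * (c (suc n) * b ^ suc n + w * form n c b w)
      ≈⟨ ring! 9 (λ w wn c a z f zn b g → w :* wn :* (c :* a :+ z :* f) :- z :* zn :* (c :* b :+ w :* g)
           ≔ c :* (w :* wn :* a :- z :* zn :* b) :+ w :* z :* (wn :* f :- zn :* g)) ≡.refl
           w (w ^ n) (c (suc n)) (a ^ suc n) z (form n c a z) (z ^ n) (b ^ suc n) (form n c b w) ⟩
    c (suc n) * (w ^ suc n * a ^ suc n - z ^ suc n * b ^ suc n) + w * z * (w ^ n * form n c a z - z ^ n * form n c b w)
      ≈⟨ +-cong (*-congˡ p′) (*-congˡ p) ⟩
    c (suc n) * (k * m′) + w * z * (k * m)
      ≈⟨ ring! 5 (λ c k m′ v m → c :* (k :* m′) :+ v :* (k :* m) ≔ k :* (c :* m′ :+ v :* m)) ≡.refl (c (suc n)) k m′ (w * z) m ⟩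
    k * (c (suc n) * m′ + w * z * m) ∎)
    where
    m m′ : Carrier
    m = proj₁ (form-diff n c a b z w e)
    p : w ^ n * form n c a z - z ^ n * form n c b w ≈ k * m
    p = proj₂ (form-diff n c a b z w e)
    m′ = proj₁ (pow-diff (suc n) (w * a) (z * b) e)
    p′ : w ^ suc n * a ^ suc n - z ^ suc n * b ^ suc n ≈ k * m′
    p′ = trans (sym (+-cong (*-^ w a (suc n)) (-‿cong (*-^ z b (suc n))))) (proj₂ (pow-diff (suc n) (w * a) (z * b) e))

  module Wronskian {d} (dd : Derivation d) (z : Carrier) where
    open Derivation dd

    -- This is z² times the derivative of u/z.
    wr : Carrier → Carrier
    wr u = z * d u - d z * u

    form-d₀ : ∀ n c {a} → (∀ k → d (c k) ≈ 0#) → d a ≈ 0# → d z ≈ 0# → d (form n c a z) ≈ 0#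
    form-d₀ zero    c dc da dz = dc 0
    form-d₀ (suc n) c dc da dz = d-+₀ (d-*₀ (dc _) (d-^₀ (suc n) da)) (d-*₀ dz (form-d₀ n c dc da dz))

    private
      form-step : ∀ n c a → d (c (suc n)) ≈ 0# →
        z * d (form (suc n) c a z) - nat (suc n) * d z * form (suc n) c a z
          ≈ shifted c n * a ^ n * wr a + z * (z * d (form n c a z) - nat n * d z * form n c a z)
      form-step n c a dc = begin
        z * d (c (suc n) * a ^ suc n + z * form n c a z) - nat (suc n) * d z * form (suc n) c a z
          ≈⟨ +-congʳ (*-congˡ (trans (d-+ _ _) (+-cong (trans (d-* _ _) (+-cong (trans (*-congʳ dc) (zeroˡ _)) (*-congˡ (d-^ a n)))) (d-* _ _)))) ⟩
        z * ((0# + c (suc n) * (nat (suc n) * a ^ n * d a)) + (d z * form n c a z + z * d (form n c a z)))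
          - nat (suc n) * d z * (c (suc n) * a ^ suc n + z * form n c a z)
          ≈⟨ +-congʳ (*-congˡ (+-congʳ (+-identityˡ _))) ⟩
        z * (c (suc n) * (nat (suc n) * a ^ n * d a) + (d z * form n c a z + z * d (form n c a z)))
          - nat (suc n) * d z * (c (suc n) * a ^ suc n + z * form n c a z)
          ≈⟨ ring! 9 (λ z c N an da dz f df a →
               z :* (c :* ((z :^ 0 :+ N) :* an :* da) :+ (dz :* f :+ z :* df)) :- (z :^ 0 :+ N) :* dz :* (c :* (a :* an) :+ z :* f)
               ≔ (z :^ 0 :+ N) :* c :* an :* (z :* da :- dz :* a) :+ z :* (z :* df :- N :* dz :* f)) ≡.refl
               z (c (suc n)) (nat n) (a ^ n) (d a) (d z) (form n c a z) (d (form n c a z)) a ⟩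
        shifted c n * a ^ n * wr a + z * (z * d (form n c a z) - nat n * d z * form n c a z) ∎

    form-const : ∀ c a → d (c 0) ≈ 0# → z * d (form 0 c a z) - nat 0 * d z * form 0 c a z ≈ 0#
    form-const c a dc = trans (+-cong (trans (*-congˡ dc) (zeroʳ z)) (-‿cong (trans (*-congʳ (zeroˡ _)) (zeroˡ _))))
      (-‿inverseʳ 0#)

    -- Chain rule for P(a/z), multiplied by z^(n+2): the term with `nat (suc n)` removes the
    -- derivative of the homogenising power of `z`.
    form-wr : ∀ n c a → (∀ k → d (c k) ≈ 0#) →
      z * d (form (suc n) c a z) - nat (suc n) * d z * form (suc n) c a z ≈ wr a * form n (shifted c) a z
    form-wr zero c a dc = trans (form-step 0 c a (dc 1)) (trans (+-congˡ (trans (*-congˡ (form-const c a (dc 0))) (zeroʳ z)))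
      (trans (+-identityʳ _) (trans (*-congʳ (*-identityʳ _)) (*-comm _ _))))
    form-wr (suc n) c a dc = trans (form-step (suc n) c a (dc (suc (suc n)))) (trans (+-congˡ (*-congˡ (form-wr n c a dc)))
      (ring! 5 (λ s p w z f → s :* p :* w :+ z :* (w :* f) ≔ w :* (s :* p :+ z :* f)) ≡.refl (shifted c (suc n)) (a ^ suc n) (wr a) z (form n (shifted c) a z)))

    -- If f ≈ W ^ 2n · G with G a form of degree m, then step n m W f ≈ W ^ 2(n+1) · ∂G/∂a,
    -- up to splitting W as s * wr a with s constant.
    step : ℕ → ℕ → Carrier → Carrier → Carrier
    step n m W f = z * W * d f - (nat n + nat n) * (z * d W * f) - nat m * (d z * W * f)

    step-cong : ∀ n m {W W′ f f′} → W ≈ W′ → f ≈ f′ → step n m W f ≈ step n m W′ f′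
    step-cong n m p q = +-cong (+-cong (*-cong (*-congˡ p) (d-cong q)) (-‿cong (*-congˡ (*-cong (*-congˡ (d-cong p)) q))))
      (-‿cong (*-congˡ (*-cong (*-congˡ p) q)))

    ode : Carrier → Carrier → Carrier
    ode W f = step 4 0 W (step 3 1 W (step 2 2 W (step 1 3 W (step 0 4 W f))))

    ode-cong : ∀ {W W′ f f′} → W ≈ W′ → f ≈ f′ → ode W f ≈ ode W′ f′
    ode-cong p q = step-cong 4 0 p (step-cong 3 1 p (step-cong 2 2 p (step-cong 1 3 p (step-cong 0 4 p q))))

    module _ (a s W : Carrier) (ds : d s ≈ 0#) (W≈ : W ≈ s * wr a) where
      private
        P : ℕ → Carrier
        P n = (W * wr a) ^ n

        dW : d W ≈ s * d (wr a)
        dW = trans (d-cong W≈) (trans (d-* _ _) (trans (+-congʳ (trans (*-congʳ ds) (zeroˡ _))) (+-identityˡ _)))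

        -- `W` and `wr a` differ by the constant factor `s`, hence have the same logarithmic
        -- derivative; the n-th power of their product contributes 2n times that of `W`.
        P-d : ∀ n → W * d (P n) ≈ (nat n + nat n) * d W * P n
        P-d zero = trans (trans (*-congˡ d-1) (zeroʳ W)) (sym (trans (*-congʳ (trans (*-congʳ (+-identityˡ 0#)) (zeroˡ _))) (zeroˡ _)))
        P-d (suc n) = begin
          W * d (W * wr a * P n)
            ≈⟨ *-congˡ (trans (d-* _ _) (+-congʳ (*-congʳ (d-* _ _)))) ⟩
          W * ((d W * wr a + W * d (wr a)) * P n + W * wr a * d (P n))
            ≈⟨ ring! 6 (λ W dW w dw P dP → W :* ((dW :* w :+ W :* dw) :* P :+ W :* w :* dP)
                 ≔ W :* P :* (dW :* w) :+ W :* P :* (W :* dw) :+ W :* w :* (W :* dP)) ≡.refl W (d W) (wr a) (d (wr a)) (P n) (d (P n)) ⟩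
          W * P n * (d W * wr a) + W * P n * (W * d (wr a)) + W * wr a * (W * d (P n))
            ≈⟨ +-cong (+-congˡ (*-congˡ Wdw)) (*-congˡ (P-d n)) ⟩
          W * P n * (d W * wr a) + W * P n * (d W * wr a) + W * wr a * ((nat n + nat n) * d W * P n)
            ≈⟨ ring! 5 (λ W P dW w N → W :* P :* (dW :* w) :+ W :* P :* (dW :* w) :+ W :* w :* ((N :+ N) :* dW :* P)
                 ≔ ((W :^ 0 :+ N) :+ (W :^ 0 :+ N)) :* dW :* (W :* w :* P)) ≡.refl W (P n) (d W) (wr a) (nat n) ⟩
          (nat (suc n) + nat (suc n)) * d W * (W * wr a * P n) ∎
          where
          Wdw : W * d (wr a) ≈ d W * wr a
          Wdw = trans (*-congʳ W≈) (trans (ring! 3 (λ s w v → s :* w :* v ≔ s :* v :* w) ≡.refl s (wr a) (d (wr a))) (*-congʳ (sym dW)))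

      -- The two subtracted terms of `step` cancel the logarithmic derivatives of `P n` and of z^m,
      -- so that only the derivative along the quotient a/z survives.
      step-form : ∀ n m {G G′} → z * d G - nat m * d z * G ≈ wr a * G′ → step n m W (P n * G) ≈ P (suc n) * G′
      step-form n m {G} {G′} e = begin
        z * W * d (P n * G) - (nat n + nat n) * (z * d W * (P n * G)) - nat m * (d z * W * (P n * G))
          ≈⟨ +-congʳ (+-congʳ (*-congˡ (d-* _ _))) ⟩
        z * W * (d (P n) * G + P n * d G) - (nat n + nat n) * (z * d W * (P n * G)) - nat m * (d z * W * (P n * G))
          ≈⟨ ring! 10 (λ z W dP G P dG N dW M dz → z :* W :* (dP :* G :+ P :* dG) :- N :* (z :* dW :* (P :* G)) :- M :* (dz :* W :* (P :* G))
               ≔ z :* G :* (W :* dP :- N :* dW :* P) :+ W :* P :* (z :* dG :- M :* dz :* G)) ≡.refl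
               z W (d (P n)) G (P n) (d G) (nat n + nat n) (d W) (nat m) (d z) ⟩
        z * G * (W * d (P n) - (nat n + nat n) * d W * P n) + W * P n * (z * d G - nat m * d z * G)
          ≈⟨ +-cong (trans (*-congˡ (x≈y⇒x-y≈0 (P-d n))) (zeroʳ _)) (*-congˡ e) ⟩
        0# + W * P n * (wr a * G′)
          ≈⟨ trans (+-identityˡ _) (ring! 4 (λ W P w G → W :* P :* (w :* G) ≔ W :* w :* P :* G) ≡.refl W (P n) (wr a) G′) ⟩
        P (suc n) * G′ ∎

      -- Each step lowers the degree of the form by one, from 4 to 0; the fifth meets a form of
      -- degree 0, a constant, and returns 0.
      ode-form : ∀ c f → (∀ k → d (c k) ≈ 0#) → f ≈ form 4 c a z → ode W f ≈ 0#
      ode-form c₀ f dc₀ e = begin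
        ode W f
          ≈⟨ ode-cong refl (trans e (sym (*-identityˡ _))) ⟩
        ode W (P 0 * form 4 c₀ a z)
          ≈⟨ step-cong 4 0 refl (step-cong 3 1 refl (step-cong 2 2 refl (step-cong 1 3 refl (step-form 0 4 (form-wr 3 c₀ a dc₀))))) ⟩
        step 4 0 W (step 3 1 W (step 2 2 W (step 1 3 W (P 1 * form 3 c₁ a z))))
          ≈⟨ step-cong 4 0 refl (step-cong 3 1 refl (step-cong 2 2 refl (step-form 1 3 (form-wr 2 c₁ a dc₁)))) ⟩
        step 4 0 W (step 3 1 W (step 2 2 W (P 2 * form 2 c₂ a z)))
          ≈⟨ step-cong 4 0 refl (step-cong 3 1 refl (step-form 2 2 (form-wr 1 c₂ a dc₂))) ⟩
        step 4 0 W (step 3 1 W (P 3 * form 1 c₃ a z))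
          ≈⟨ step-cong 4 0 refl (step-form 3 1 (form-wr 0 c₃ a dc₃)) ⟩
        step 4 0 W (P 4 * form 0 c₄ a z)
          ≈⟨ step-form 4 0 (trans (form-const c₄ a (dc₄ 0)) (sym (zeroʳ _))) ⟩
        P 5 * 0#
          ≈⟨ zeroʳ _ ⟩
        0# ∎
        where
        c₁ c₂ c₃ c₄ : ℕ → Carrier
        c₁ = shifted c₀
        c₂ = shifted c₁
        c₃ = shifted c₂
        c₄ = shifted c₃
        d-nat : ∀ n → d (nat n) ≈ 0#
        d-nat zero    = d-0
        d-nat (suc n) = d-+₀ d-1 (d-nat n)
        dc₁ : ∀ k → d (c₁ k) ≈ 0#
        dc₁ k = d-*₀ (d-nat (suc k)) (dc₀ (suc k))
        dc₂ : ∀ k → d (c₂ k) ≈ 0#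
        dc₂ k = d-*₀ (d-nat (suc k)) (dc₁ (suc k))
        dc₃ : ∀ k → d (c₃ k) ≈ 0#
        dc₃ k = d-*₀ (d-nat (suc k)) (dc₂ (suc k))
        dc₄ : ∀ k → d (c₄ k) ≈ 0#
        dc₄ k = d-*₀ (d-nat (suc k)) (dc₃ (suc k))

≡ᵇ-refl : ∀ n → (n ℕ.≡ᵇ n) ≡ true
≡ᵇ-refl zero    = ≡.refl
≡ᵇ-refl (suc n) = ≡ᵇ-refl n

-- Restriction to a coordinate axis, divisibility and discriminants.

module Invariants (A : ℚ-Algebra) where
  open ℚ-Algebra A
  open Derivations A
  open Forms A
  open SetoidReasoning setoid

  -- σ is the restriction to v = 0.
  record Coordinate : Set where
    field
      v      : Carrier
      δ σ τ  : Carrier → Carrier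
      ∂-der  : Derivation δ
      ∂-v    : δ v ≈ 1#
      σ-cong : ∀ {F G} → F ≈ G → σ F ≈ σ G
      σ-+    : ∀ F G → σ (F + G) ≈ σ F + σ G
      σ-*    : ∀ F G → σ (F * G) ≈ σ F * σ G
      σ-v    : σ v ≈ 0#
      split  : ∀ F → F ≈ σ F + v * τ F
      cancel : ∀ F → v * F ≈ 0# → F ≈ 0#
      ∂-σ    : ∀ F → δ (σ F) ≈ 0#
      ∂≈0⇒σ  : ∀ F → δ F ≈ 0# → F ≈ σ F
    open Derivation ∂-der public

    σ-1 : σ 1# ≈ 1#
    σ-1 = sym (∂≈0⇒σ 1# d-1)

    σ-0 : σ 0# ≈ 0#
    σ-0 = sym (∂≈0⇒σ 0# d-0)

    σ-σ : ∀ F → σ (σ F) ≈ σ F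
    σ-σ F = sym (∂≈0⇒σ (σ F) (∂-σ F))

    σ-neg : ∀ F → σ (- F) ≈ - σ F
    σ-neg F = x-y≈0⇒x≈y (begin
      σ (- F) - - σ F ≈⟨ ring! 2 (λ a b → a :- (:- b) ≔ a :+ b) ≡.refl (σ (- F)) (σ F) ⟩
      σ (- F) + σ F   ≈⟨ σ-+ (- F) F ⟨
      σ (- F + F)     ≈⟨ trans (σ-cong (-‿inverseˡ F)) σ-0 ⟩
      0#              ∎)

    σ-^ : ∀ F n → σ (F ^ n) ≈ σ F ^ n
    σ-^ F zero    = σ-1
    σ-^ F (suc n) = trans (σ-* F (F ^ n)) (*-congˡ (σ-^ F n))

    σ-v* : ∀ F → σ (v * F) ≈ 0#
    σ-v* F = trans (σ-* v F) (trans (*-congʳ σ-v) (zeroˡ _))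

    divisible : ∀ {F} → σ F ≈ 0# → F ≈ v * τ F
    divisible {F} p = trans (split F) (trans (+-congʳ p) (+-identityˡ _))

    cancel-^ : ∀ n {F} → v ^ n * F ≈ 0# → F ≈ 0#
    cancel-^ zero    p = trans (sym (*-identityˡ _)) p
    cancel-^ (suc n) p = cancel-^ n (cancel _ (trans (sym (*-assoc _ _ _)) p))

    Regular : Carrier → Set
    Regular K = ∀ M → σ K * M ≈ 0# → M ≈ 0#

    -- Restricting to v = 0 kills the left side, and the restriction of `K` is not a zero divisor;
    -- so `M` vanishes there, and a factor v can be cancelled on both sides.
    quotient : ∀ {K N M} → Regular K → v * N ≈ K * M → M ≈ v * τ M × N ≈ K * τ M
    quotient {K} {N} {M} reg e = M≈ , x-y≈0⇒x≈y (cancel _ (begin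
      v * (N - K * τ M)     ≈⟨ ring! 4 (λ v n k m → v :* (n :- k :* m) ≔ v :* n :- k :* (v :* m)) ≡.refl v N K (τ M) ⟩
      v * N - K * (v * τ M) ≈⟨ x≈y⇒x-y≈0 (trans e (*-congˡ M≈)) ⟩
      0#                    ∎))
      where
      M≈ : M ≈ v * τ M
      M≈ = divisible (reg _ (trans (sym (σ-* K M)) (trans (σ-cong (sym e)) (σ-v* N))))

    quotient-^ : ∀ {K} n {N M} → Regular K → v ^ n * N ≈ K * M → Σ Carrier λ M′ → N ≈ K * M′
    quotient-^ zero    {M = M} reg e = M , trans (sym (*-identityˡ _)) e
    quotient-^ (suc n) reg e = quotient-^ n reg (proj₂ (quotient reg (trans (sym (*-assoc _ _ _)) e)))

  record Bivariate : Set where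
    field
      X Y : Coordinate
    module X = Coordinate X
    module Y = Coordinate Y
    field
      ∂x-y : X.δ Y.v ≈ 0#
      ∂y-x : Y.δ X.v ≈ 0#
      ∂x∂y : ∀ F → X.δ (Y.δ F) ≈ Y.δ (X.δ F)
      ∂x-σ : ∀ F → X.δ (Y.σ F) ≈ Y.σ (X.δ F)
      ∂y-σ : ∀ F → Y.δ (X.σ F) ≈ X.σ (Y.δ F)

  swap : Bivariate → Bivariate
  swap B = record
    { X = Y ; Y = X ; ∂x-y = ∂y-x ; ∂y-x = ∂x-y ; ∂x∂y = λ F → sym (∂x∂y F) ; ∂x-σ = ∂y-σ ; ∂y-σ = ∂x-σ }
    where open Bivariate B

  -- The product of τ^k for k from 1 to n. It accumulates the factors that replace divisions by
  -- powers of the non-unit τ when a pole of order n is removed.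
  triangular : Carrier → ℕ → Carrier
  triangular τ zero    = 1#
  triangular τ (suc n) = triangular τ n * τ ^ suc n

  override : ℕ → Carrier → (ℕ → Carrier) → ℕ → Carrier
  override n a c k = if k ℕ.≡ᵇ n then a else c k

  override-∀ : ∀ (P : Carrier → Set) n a c k → P a → P (c k) → P (override n a c k)
  override-∀ P n a c k pa pc with k ℕ.≡ᵇ n
  ... | true  = pa
  ... | false = pc

  form-override : ∀ m n top c a z → m ℕ.≤ n → form m (override (suc n) top c) a z ≈ form m c a z
  form-override zero    n top c a z _ = refl
  form-override (suc m) n top c a z m<n with m ℕ.≡ᵇ n in eq
  ... | false = +-congˡ (*-congˡ (form-override m n top c a z (ℕ.<⇒≤ m<n)))
  ... | true with ≡.refl ← ≡ᵇ-sound m n eq with () ← ℕ.<-irrefl ≡.refl m<n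

  form-override-top : ∀ n top c a z → form (suc n) (override (suc n) top c) a z ≈ top * a ^ suc n + z * form n c a z
  form-override-top n top c a z with n ℕ.≡ᵇ n in eq
  ... | true  = +-congˡ (*-congˡ (form-override n n top c a z ℕ.≤-refl))
  ... | false with () ← ≡.trans (≡.sym eq) (≡ᵇ-refl n)

  -- Isolates the coefficient of degree 0, the only one whose independence of the first coordinate
  -- is still open after `kill-poles`.
  form-split : ∀ n c a z → form n c a z ≈ form n (override 0 0# c) a z + z ^ n * c 0
  form-split zero    c a z = trans (sym (*-identityˡ _)) (sym (+-identityˡ _))
  form-split (suc n) c a z = trans (+-congˡ (*-congˡ (form-split n c a z)))
    (ring! 5 (λ p z f q b → p :+ z :* (f :+ q :* b) ≔ p :+ z :* f :+ z :* q :* b) ≡.refl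
      (c (suc n) * a ^ suc n) z (form n (override 0 0# c) a z) (z ^ n) (c 0))

  -- If K = a v² + b v + c, then ∂K = 2 a v + b and this is b² - 4 a c.
  disc : (Carrier → Carrier) → Carrier → Carrier
  disc ∂ K = ∂ K * ∂ K - (∂ (∂ K) + ∂ (∂ K)) * K

  module _ (B : Bivariate) where
    open Bivariate B
    private
      module WX = Wronskian X.∂-der
      module WY = Wronskian Y.∂-der

    -- The two products of first and second derivatives cancel, and the remaining term carries the
    -- third derivative, which is 0 for a quadratic.
    disc-const : ∀ K → X.δ (X.δ (X.δ K)) ≈ 0# → X.δ (disc X.δ K) ≈ 0#
    disc-const K p = begin
      X.δ (k₁ * k₁ - (k₂ + k₂) * K)
        ≈⟨ trans (X.d-sub _ _) (+-cong (X.d-* _ _) (-‿cong (trans (X.d-* _ _) (+-congʳ (*-congʳ (trans (X.d-+ _ _) (trans (+-cong p p) (+-identityˡ 0#)))))))) ⟩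
      (k₂ * k₁ + k₁ * k₂) - (0# * K + (k₂ + k₂) * k₁)
        ≈⟨ ring! 3 (λ k₁ k₂ k → (k₂ :* k₁ :+ k₁ :* k₂) :- (con 0ℤ :* k :+ (k₂ :+ k₂) :* k₁) ≔ con 0ℤ) ≡.refl k₁ k₂ K ⟩
      0# ∎
      where
      k₁ k₂ : Carrier
      k₁ = X.δ K
      k₂ = X.δ (X.δ K)

    -- The summand `ζx * β` divided by `ζx` is constant in the first coordinate, so the Wronskian
    -- with `ζx` kills it, while the constant `ζy` factors out.
    wr-x : ∀ {α β ζx ζy} → X.δ β ≈ 0# → X.δ ζy ≈ 0# → WX.wr ζx (ζy * α - ζx * β) ≈ ζy * WX.wr ζx α
    wr-x {α} {β} {ζx} {ζy} β₀ ζ₀ = begin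
      ζx * X.δ (ζy * α - ζx * β) - X.δ ζx * (ζy * α - ζx * β)
        ≈⟨ +-congʳ (*-congˡ (trans (X.d-sub _ _) (+-cong (trans (X.d-* _ _) (+-congʳ (*-congʳ ζ₀)))
             (-‿cong (trans (X.d-* _ _) (+-congˡ (*-congˡ β₀))))))) ⟩
      ζx * ((0# * α + ζy * X.δ α) - (X.δ ζx * β + ζx * 0#)) - X.δ ζx * (ζy * α - ζx * β)
        ≈⟨ ring! 6 (λ ζx ζy α β dα dζ → ζx :* ((con 0ℤ :* α :+ ζy :* dα) :- (dζ :* β :+ ζx :* con 0ℤ)) :- dζ :* (ζy :* α :- ζx :* β)
             ≔ ζy :* (ζx :* dα :- dζ :* α)) ≡.refl ζx ζy α β (X.δ α) (X.δ ζx) ⟩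
      ζy * (ζx * X.δ α - X.δ ζx * α) ∎

    wr-x-const : ∀ {α ζx} → Y.δ α ≈ 0# → Y.δ ζx ≈ 0# → Y.δ (WX.wr ζx α) ≈ 0#
    wr-x-const {α} {ζx} α₀ ζ₀ = Y.d-sub₀ (Y.d-*₀ ζ₀ (∂y∂x₀ α₀)) (Y.d-*₀ (∂y∂x₀ ζ₀) α₀)
      where
      ∂y∂x₀ : ∀ {F} → Y.δ F ≈ 0# → Y.δ (X.δ F) ≈ 0#
      ∂y∂x₀ {F} p = trans (sym (∂x∂y F)) (trans (X.d-cong p) X.d-0)

    wr-x-K : ∀ K h ζx → WX.wr ζx (K * h) ≈ ζx * X.δ K * h + K * WX.wr ζx h
    wr-x-K K h ζx = trans (+-congʳ (*-congˡ (X.d-* K h)))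
      (ring! 6 (λ K h ζ k h₁ z → ζ :* (k :* h :+ K :* h₁) :- z :* (K :* h) ≔ ζ :* k :* h :+ K :* (ζ :* h₁ :- z :* h)) ≡.refl
        K h ζx (X.δ K) (X.δ h) (X.δ ζx))

  -- Tutte's method: the equation shared by a pair of invariants.

  module Tutte (B : Bivariate) where
    open Bivariate B

    -- The invariants are I = α/ζx and J = β/ζy, and `invariants` says I - J = K h/(ζx ζy) with
    -- denominators cleared.
    module Pair
      (K h α β ζx ζy : Carrier)
      (∂x³K : X.δ (X.δ (X.δ K)) ≈ 0#) (∂y³K : Y.δ (Y.δ (Y.δ K)) ≈ 0#)
      (α₀ : Y.δ α ≈ 0#) (ζx₀ : Y.δ ζx ≈ 0#) (β₀ : X.δ β ≈ 0#) (ζy₀ : X.δ ζy ≈ 0#)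
      (invariants : K * h ≈ ζy * α - ζx * β)
      where
      module WX = Wronskian X.∂-der ζx
      module WY = Wronskian Y.∂-der ζy

      a b : Carrier
      a = WX.wr α
      b = WY.wr β

      x-side : WX.wr (K * h) ≈ ζy * a
      x-side = trans (+-cong (*-congˡ (X.d-cong invariants)) (-‿cong (*-congˡ invariants))) (wr-x B β₀ ζy₀)

      y-side : WY.wr (K * h) ≈ - ζx * b
      y-side = begin
        ζy * Y.δ (K * h) - Y.δ ζy * (K * h)
          ≈⟨ +-cong (*-congˡ (Y.d-cong neg)) (-‿cong (*-congˡ neg)) ⟩
        ζy * Y.δ (- (ζx * β - ζy * α)) - Y.δ ζy * - (ζx * β - ζy * α)
          ≈⟨ +-congʳ (*-congˡ (Y.d-neg _)) ⟩
        ζy * - Y.δ (ζx * β - ζy * α) - Y.δ ζy * - (ζx * β - ζy * α)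
          ≈⟨ ring! 4 (λ z w dz u → z :* (:- w) :- dz :* (:- u) ≔ :- (z :* w :- dz :* u)) ≡.refl
               ζy (Y.δ (ζx * β - ζy * α)) (Y.δ ζy) (ζx * β - ζy * α) ⟩
        - WY.wr (ζx * β - ζy * α)
          ≈⟨ -‿cong (wr-x (swap B) α₀ ζx₀) ⟩
        - (ζx * b)
          ≈⟨ -‿distribˡ-* ζx b ⟩
        - ζx * b ∎
        where
        neg : K * h ≈ - (ζx * β - ζy * α)
        neg = trans invariants (ring! 2 (λ u w → u :- w ≔ :- (w :- u)) ≡.refl (ζy * α) (ζx * β))

      Lx Ly : Carrier
      Lx = disc Y.δ K * (a * a)
      Ly = disc X.δ K * (b * b)

      -- (Lx / ζx⁴ , Ly / ζy⁴) is again a pair of invariants: modulo K both discriminants are squares of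
      -- partial derivatives of K, and both sides become (∂x K ∂y K h)² up to the same factor.
      L-diff : Σ Carrier λ m → ζy ^ 4 * Lx - ζx ^ 4 * Ly ≈ K * m
      L-diff = m , (begin
        ζy ^ 4 * Lx - ζx ^ 4 * Ly
          ≈⟨ ring! 6 (λ ζx ζy a b D E → ζy :^ 4 :* (D :* (a :* a)) :- ζx :^ 4 :* (E :* (b :* b))
               ≔ ζy :* ζy :* D :* ((ζy :* a) :* (ζy :* a)) :- ζx :* ζx :* E :* ((:- ζx :* b) :* (:- ζx :* b))) ≡.refl
               ζx ζy a b (disc Y.δ K) (disc X.δ K) ⟩
        ζy * ζy * disc Y.δ K * ((ζy * a) * (ζy * a)) - ζx * ζx * disc X.δ K * ((- ζx * b) * (- ζx * b))
          ≈⟨ +-cong (*-congˡ (*-cong ζya ζya)) (-‿cong (*-congˡ (*-cong ζxb ζxb))) ⟩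
        ζy * ζy * disc Y.δ K * ((ζx * Kx * h + K * p) * (ζx * Kx * h + K * p))
          - ζx * ζx * disc X.δ K * ((ζy * Ky * h + K * r) * (ζy * Ky * h + K * r))
          ≈⟨ ring! 10 (λ ζx ζy K Kx Ky Kxx Kyy h p r →
               ζy :* ζy :* (Ky :* Ky :- (Kyy :+ Kyy) :* K) :* ((ζx :* Kx :* h :+ K :* p) :* (ζx :* Kx :* h :+ K :* p))
               :- ζx :* ζx :* (Kx :* Kx :- (Kxx :+ Kxx) :* K) :* ((ζy :* Ky :* h :+ K :* r) :* (ζy :* Ky :* h :+ K :* r))
               ≔ K :* (ζy :* ζy :* (Ky :* Ky :* (ζx :* Kx :* h :* (p :+ p) :+ K :* p :* p)
                          :- (Kyy :+ Kyy) :* ((ζx :* Kx :* h :+ K :* p) :* (ζx :* Kx :* h :+ K :* p)))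
                 :- ζx :* ζx :* (Kx :* Kx :* (ζy :* Ky :* h :* (r :+ r) :+ K :* r :* r)
                          :- (Kxx :+ Kxx) :* ((ζy :* Ky :* h :+ K :* r) :* (ζy :* Ky :* h :+ K :* r))))) ≡.refl
               ζx ζy K Kx Ky (X.δ Kx) (Y.δ Ky) h p r ⟩
        K * m ∎)
        where
        Kx Ky p r m : Carrier
        Kx = X.δ K
        Ky = Y.δ K
        p = WX.wr h
        r = WY.wr h
        m = ζy * ζy * (Ky * Ky * (ζx * Kx * h * (p + p) + K * p * p)
                          - (Y.δ Ky + Y.δ Ky) * ((ζx * Kx * h + K * p) * (ζx * Kx * h + K * p)))
          - ζx * ζx * (Kx * Kx * (ζy * Ky * h * (r + r) + K * r * r)
                          - (X.δ Kx + X.δ Kx) * ((ζy * Ky * h + K * r) * (ζy * Ky * h + K * r)))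
        ζya : ζy * a ≈ ζx * Kx * h + K * p
        ζya = trans (sym x-side) (wr-x-K B K h ζx)
        ζxb : - ζx * b ≈ ζy * Ky * h + K * r
        ζxb = trans (sym y-side) (wr-x-K (swap B) K h ζy)

      module _ (η η̄ : Carrier) (ζx≈ : ζx ≈ X.v * η) (η-inv : η * η̄ ≈ 1#) (η̄₀ : Y.δ η̄ ≈ 0#) where
        -- The poles of a series in x alone are removed one order at a time by powers of the invariant α / ζx.
        kill-poles : ∀ n L → Y.δ L ≈ 0# → Σ (ℕ → Carrier) λ c →
          (∀ k → X.δ (c (suc k)) ≈ 0#) × (∀ k → Y.δ (c k) ≈ 0#) × triangular (X.σ α) n * L ≈ form n c α ζx
        kill-poles zero    L L₀ = (λ { zero → L ; (suc _) → 0# }) , (λ _ → X.d-0) , (λ { zero → L₀ ; (suc _) → Y.d-0 }) , *-identityˡ L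
        kill-poles (suc n) L L₀ = override (suc n) (T * X.σ L) c , cx′ , cy′ , (begin
          T * τ ^ suc n * L
            ≈⟨ ring! 4 (λ T t L s → T :* t :* L ≔ T :* s :+ T :* (t :* L :- s)) ≡.refl T (τ ^ suc n) L (X.σ L * α ^ suc n) ⟩
          T * (X.σ L * α ^ suc n) + T * F
            ≈⟨ +-congˡ (*-congˡ F≈) ⟩
          T * (X.σ L * α ^ suc n) + T * (ζx * (η̄ * X.τ F))
            ≈⟨ ring! 5 (λ T s p z l → T :* (s :* p) :+ T :* (z :* l) ≔ T :* s :* p :+ z :* (T :* l)) ≡.refl T (X.σ L) (α ^ suc n) ζx (η̄ * X.τ F) ⟩
          T * X.σ L * α ^ suc n + ζx * (T * (η̄ * X.τ F))
            ≈⟨ +-congˡ (*-congˡ c≈) ⟩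
          T * X.σ L * α ^ suc n + ζx * form n c α ζx
            ≈⟨ form-override-top n _ c α ζx ⟨
          form (suc n) (override (suc n) (T * X.σ L) c) α ζx ∎)
          where
          τ T F : Carrier
          τ = X.σ α
          T = triangular τ n
          -- At x = 0 both products take the value `τ ^ suc n * X.σ L`. The difference is thus
          -- divisible by the coordinate, hence by `ζx` up to the unit `η`, and the quotient has one
          -- order of pole less to remove.
          F = τ ^ suc n * L - X.σ L * α ^ suc n
          σL₀ : Y.δ (X.σ L) ≈ 0#
          σL₀ = trans (∂y-σ L) (trans (X.σ-cong L₀) X.σ-0)
          τ₀ : Y.δ τ ≈ 0#
          τ₀ = trans (∂y-σ α) (trans (X.σ-cong α₀) X.σ-0)
          xτF : F ≈ X.v * X.τ F
          xτF = X.divisible (begin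
            X.σ (τ ^ suc n * L - X.σ L * α ^ suc n)
              ≈⟨ trans (X.σ-+ _ _) (+-cong (X.σ-* _ _) (trans (X.σ-neg _) (-‿cong (X.σ-* _ _)))) ⟩
            X.σ (τ ^ suc n) * X.σ L - X.σ (X.σ L) * X.σ (α ^ suc n)
              ≈⟨ +-cong (*-congʳ (trans (X.σ-^ τ (suc n)) (^-congˡ (suc n) (X.σ-σ α)))) (-‿cong (*-cong (X.σ-σ L) (X.σ-^ α (suc n)))) ⟩
            τ ^ suc n * X.σ L - X.σ L * τ ^ suc n
              ≈⟨ x≈y⇒x-y≈0 (*-comm _ _) ⟩
            0# ∎)
          F≈ : F ≈ ζx * (η̄ * X.τ F)
          F≈ = begin
            F                          ≈⟨ xτF ⟩
            X.v * X.τ F                ≈⟨ trans (*-congʳ (*-congˡ η-inv)) (*-congʳ (*-identityʳ _)) ⟨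
            X.v * (η * η̄) * X.τ F      ≈⟨ ring! 4 (λ x e f t → x :* (e :* f) :* t ≔ x :* e :* (f :* t)) ≡.refl X.v η η̄ (X.τ F) ⟩
            X.v * η * (η̄ * X.τ F)      ≈⟨ *-congʳ ζx≈ ⟨
            ζx * (η̄ * X.τ F)           ∎
          τF₀ : Y.δ (X.τ F) ≈ 0#
          τF₀ = X.cancel _ (begin
            X.v * Y.δ (X.τ F)                           ≈⟨ +-identityˡ _ ⟨
            0# + X.v * Y.δ (X.τ F)                      ≈⟨ +-congʳ (trans (*-congʳ ∂y-x) (zeroˡ _)) ⟨
            Y.δ X.v * X.τ F + X.v * Y.δ (X.τ F)         ≈⟨ Y.d-* _ _ ⟨
            Y.δ (X.v * X.τ F)                           ≈⟨ Y.d-cong xτF ⟨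
            Y.δ F                                       ≈⟨ Y.d-sub₀ (Y.d-*₀ (Y.d-^₀ (suc n) τ₀) L₀) (Y.d-*₀ σL₀ (Y.d-^₀ (suc n) α₀)) ⟩
            0#                                          ∎)
          rec : Σ (ℕ → Carrier) λ c →
            (∀ k → X.δ (c (suc k)) ≈ 0#) × (∀ k → Y.δ (c k) ≈ 0#) × triangular (X.σ α) n * (η̄ * X.τ F) ≈ form n c α ζx
          rec = kill-poles n (η̄ * X.τ F) (Y.d-*₀ η̄₀ τF₀)
          c : ℕ → Carrier
          c = proj₁ rec
          c≈ : T * (η̄ * X.τ F) ≈ form n c α ζx
          c≈ = proj₂ (proj₂ (proj₂ rec))
          triangular₀ : ∀ {d} (dd : Derivation d) {t} → d t ≈ 0# → ∀ n → d (triangular t n) ≈ 0#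
          triangular₀ dd p zero    = Derivation.d-1 dd
          triangular₀ dd p (suc n) = Derivation.d-*₀ dd (triangular₀ dd p n) (Derivation.d-^₀ dd (suc n) p)
          cx′ : ∀ k → X.δ (override (suc n) (T * X.σ L) c (suc k)) ≈ 0#
          cx′ k = override-∀ (λ a → X.δ a ≈ 0#) (suc n) _ c (suc k)
            (X.d-*₀ (triangular₀ X.∂-der (X.∂-σ α) n) (X.∂-σ L)) (proj₁ (proj₂ rec) k)
          cy′ : ∀ k → Y.δ (override (suc n) (T * X.σ L) c k) ≈ 0#
          cy′ k = override-∀ (λ a → Y.δ a ≈ 0#) (suc n) _ c k
            (Y.d-*₀ (triangular₀ Y.∂-der τ₀ n) σL₀) (proj₁ (proj₂ (proj₂ rec)) k)

        module _ (κ κ̄ : Carrier) (q : ℕ) (ζy≈ : ζy ≈ Y.v ^ q * κ) (κ-inv : κ * κ̄ ≈ 1#) (κ̄₀ : X.δ κ̄ ≈ 0#)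
          (unique : ∀ P R M → Y.δ P ≈ 0# → X.δ R ≈ 0# → P - R ≈ K * M → M ≈ 0#)
          (regular-x : X.Regular K)
          (origin : q ≡ 0 ⊎ (Y.Regular K × X.σ (Y.σ K) ≈ 0#))
          where
          -- The lowest y-coefficient of R is - K(x,0) M(x,0): it is independent of x, and zero at x = 0 by K(0,0) = 0.
          unique-pole : Y.Regular K → X.σ (Y.σ K) ≈ 0# → ∀ n P R M → Y.δ P ≈ 0# → X.δ R ≈ 0# →
            Y.v ^ n * P - R ≈ K * M → M ≈ 0#
          unique-pole reg o zero    P R M P₀ R₀ e = unique P R M P₀ R₀ (trans (+-congʳ (sym (*-identityˡ P))) e)
          unique-pole reg o (suc n) P R M P₀ R₀ e = begin
            M           ≈⟨ proj₁ q′ ⟩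
            Y.v * Y.τ M ≈⟨ *-congˡ (unique-pole reg o n P (Y.τ R) (Y.τ M) P₀ τR₀ (proj₂ q′)) ⟩
            Y.v * 0#    ≈⟨ zeroʳ _ ⟩
            0#          ∎
            where
            σR₁ : X.δ (Y.σ R) ≈ 0#
            σR₁ = trans (∂x-σ R) (trans (Y.σ-cong R₀) Y.σ-0)
            σR≈ : - Y.σ R ≈ Y.σ K * Y.σ M
            σR≈ = begin
              - Y.σ R                                     ≈⟨ trans (sym (+-identityˡ _)) (+-congʳ (sym (Y.σ-v* _))) ⟩
              Y.σ (Y.v * (Y.v ^ n * P)) - Y.σ R           ≈⟨ +-congʳ (Y.σ-cong (sym (*-assoc _ _ _))) ⟩
              Y.σ (Y.v ^ suc n * P) - Y.σ R               ≈⟨ trans (Y.σ-+ _ _) (+-congˡ (Y.σ-neg R)) ⟨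
              Y.σ (Y.v ^ suc n * P - R)                   ≈⟨ Y.σ-cong e ⟩
              Y.σ (K * M)                                 ≈⟨ Y.σ-* K M ⟩
              Y.σ K * Y.σ M                               ∎
            σR₀ : Y.σ R ≈ 0#
            σR₀ = begin
              Y.σ R                               ≈⟨ X.∂≈0⇒σ (Y.σ R) σR₁ ⟩
              X.σ (Y.σ R)                         ≈⟨ X.σ-cong (ring! 1 (λ r → r ≔ :- (:- r)) ≡.refl (Y.σ R)) ⟩
              X.σ (- - Y.σ R)                     ≈⟨ trans (X.σ-neg _) (-‿cong (X.σ-cong σR≈)) ⟩
              - X.σ (Y.σ K * Y.σ M)               ≈⟨ -‿cong (trans (X.σ-* _ _) (trans (*-congʳ o) (zeroˡ _))) ⟩
              - 0#                                ≈⟨ -0#≈0# ⟩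
              0#                                  ∎
            R≈ : R ≈ Y.v * Y.τ R
            R≈ = Y.divisible σR₀
            τR₀ : X.δ (Y.τ R) ≈ 0#
            τR₀ = Y.cancel _ (begin
              Y.v * X.δ (Y.τ R)                           ≈⟨ +-identityˡ _ ⟨
              0# + Y.v * X.δ (Y.τ R)                      ≈⟨ +-congʳ (trans (*-congʳ ∂x-y) (zeroˡ _)) ⟨
              X.δ Y.v * Y.τ R + Y.v * X.δ (Y.τ R)         ≈⟨ X.d-* _ _ ⟨
              X.δ (Y.v * Y.τ R)                           ≈⟨ X.d-cong R≈ ⟨
              X.δ R                                       ≈⟨ R₀ ⟩
              0#                                          ∎)
            q′ : M ≈ Y.v * Y.τ M × Y.v ^ n * P - Y.τ R ≈ K * Y.τ M
            q′ = Y.quotient reg (begin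
              Y.v * (Y.v ^ n * P - Y.τ R)                 ≈⟨ ring! 4 (λ y p P t → y :* (p :* P :- t) ≔ y :* p :* P :- y :* t) ≡.refl Y.v (Y.v ^ n) P (Y.τ R) ⟩
              Y.v ^ suc n * P - Y.v * Y.τ R               ≈⟨ +-congˡ (-‿cong R≈) ⟨
              Y.v ^ suc n * P - R                         ≈⟨ e ⟩
              K * M                                       ∎)

          unique-ζ : ∀ P R M → Y.δ P ≈ 0# → X.δ R ≈ 0# → Y.v ^ (q ℕ.* 4) * P - R ≈ K * M → M ≈ 0#
          unique-ζ P R M P₀ R₀ = case origin of λ
            { (inj₁ q≡0)     → ≡.subst (λ q → Y.v ^ (q ℕ.* 4) * P - R ≈ K * M → M ≈ 0#) (≡.sym q≡0)
                (λ e → unique P R M P₀ R₀ (trans (+-congʳ (sym (*-identityˡ P))) e))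
            ; (inj₂ (reg , o)) → unique-pole reg o (q ℕ.* 4) P R M P₀ R₀ }

          private
            inverse-^ : ∀ {s s̄} → s * s̄ ≈ 1# → ∀ n → s ^ n * s̄ ^ n ≈ 1#
            inverse-^ {s} {s̄} p n = trans (sym (*-^ s s̄ n)) (trans (^-congˡ n p) (1^ n))
              where
              1^ : ∀ n → 1# ^ n ≈ 1#
              1^ zero    = refl
              1^ (suc n) = trans (*-identityˡ _) (1^ n)

            ζy-κ̄ : ∀ P → κ̄ ^ 4 * (ζy ^ 4 * P) ≈ Y.v ^ (q ℕ.* 4) * P
            ζy-κ̄ P = begin
              κ̄ ^ 4 * (ζy ^ 4 * P)                      ≈⟨ *-congˡ (*-congʳ (trans (^-congˡ 4 ζy≈) (*-^ (Y.v ^ q) κ 4))) ⟩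
              κ̄ ^ 4 * ((Y.v ^ q) ^ 4 * κ ^ 4 * P)       ≈⟨ ring! 4 (λ k y l P → k :* (y :* l :* P) ≔ l :* k :* (y :* P)) ≡.refl (κ̄ ^ 4) ((Y.v ^ q) ^ 4) (κ ^ 4) P ⟩
              κ ^ 4 * κ̄ ^ 4 * ((Y.v ^ q) ^ 4 * P)       ≈⟨ *-cong (inverse-^ κ-inv 4) (*-congʳ (^-assocʳ Y.v q 4)) ⟩
              1# * (Y.v ^ (q ℕ.* 4) * P)                ≈⟨ *-identityˡ _ ⟩
              Y.v ^ (q ℕ.* 4) * P                       ∎

          -- `kill-poles` expresses `Lx` through `α`, with `c 0` possibly a series in the first
          -- coordinate. Inserting the same coefficients on the side of `β` leaves `ζy ^ 4 * c 0`
          -- against a series in the second coordinate, equal modulo `K`. Uniqueness makes them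
          -- equal, which shows at once that `c 0` is constant and that `Ly` satisfies the same
          -- equation.
          invariant-equation : Σ (ℕ → Carrier) λ c → (∀ k → X.δ (c k) ≈ 0#) × (∀ k → Y.δ (c k) ≈ 0#) ×
            triangular (X.σ α) 4 * Lx ≈ form 4 c α ζx × triangular (X.σ α) 4 * Ly ≈ form 4 c β ζy
          invariant-equation = c , cx , cy , Lx≈ , Ly≈
            where
            T : Carrier
            T = triangular (X.σ α) 4
            poles : Σ (ℕ → Carrier) λ c →
              (∀ k → X.δ (c (suc k)) ≈ 0#) × (∀ k → Y.δ (c k) ≈ 0#) × T * Lx ≈ form 4 c α ζx
            poles = kill-poles 4 Lx (Y.d-*₀ (disc-const (swap B) K ∂y³K) (Y.d-*₀ a₀ a₀))
              where
              a₀ : Y.δ a ≈ 0#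
              a₀ = wr-x-const B α₀ ζx₀
            c : ℕ → Carrier
            c = proj₁ poles
            cx₊ : ∀ k → X.δ (c (suc k)) ≈ 0#
            cx₊ = proj₁ (proj₂ poles)
            cy : ∀ k → Y.δ (c k) ≈ 0#
            cy = proj₁ (proj₂ (proj₂ poles))
            Lx≈ : T * Lx ≈ form 4 c α ζx
            Lx≈ = proj₂ (proj₂ (proj₂ poles))
            c⁰ : ℕ → Carrier
            c⁰ = override 0 0# c
            cx⁰ : ∀ k → X.δ (c⁰ k) ≈ 0#
            cx⁰ zero    = X.d-0
            cx⁰ (suc k) = cx₊ k
            -- The term of degree 0 is left out of the form because `c 0` is so far known only to be
            -- independent of the second coordinate; without it `R` depends on the second coordinate
            -- alone.
            R : Carrier
            R = T * Ly - form 4 c⁰ β ζy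
            R₀ : X.δ R ≈ 0#
            R₀ = X.d-sub₀ (X.d-*₀ T₀ (X.d-*₀ (disc-const B K ∂x³K) (X.d-*₀ b₀ b₀)))
              (WX′.form-d₀ 4 c⁰ cx⁰ β₀ ζy₀)
              where
              module WX′ = Wronskian X.∂-der ζy
              b₀ : X.δ b ≈ 0#
              b₀ = wr-x-const (swap B) β₀ ζy₀
              T₀ : X.δ T ≈ 0#
              T₀ = X.d-*₀ (X.d-*₀ (X.d-*₀ (X.d-*₀ X.d-1 (X.d-^₀ 1 (X.∂-σ α))) (X.d-^₀ 2 (X.∂-σ α))) (X.d-^₀ 3 (X.∂-σ α))) (X.d-^₀ 4 (X.∂-σ α))
            fd : Σ Carrier λ m → ζy ^ 4 * form 4 c α ζx - ζx ^ 4 * form 4 c β ζy ≈ K * m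
            fd = form-diff 4 c α β ζx ζy (sym invariants)
            -- Clearing denominators leaves the whole identity multiplied by `ζx ^ 4`. The unit
            -- `η ^ 4` is inverted, and the remaining fourth power of the coordinate is divided out
            -- by regularity of `K`.
            divided : Σ Carrier λ m → ζy ^ 4 * c 0 - R ≈ K * m
            divided = X.quotient-^ 4 regular-x (begin
              X.v ^ 4 * (ζy ^ 4 * c 0 - R)
                ≈⟨ trans (*-congʳ (inverse-^ η-inv 4)) (*-identityˡ _) ⟨
              η ^ 4 * η̄ ^ 4 * (X.v ^ 4 * (ζy ^ 4 * c 0 - R))
                ≈⟨ ring! 4 (λ e f x N → e :* f :* (x :* N) ≔ f :* (x :* e :* N)) ≡.refl (η ^ 4) (η̄ ^ 4) (X.v ^ 4) (ζy ^ 4 * c 0 - R) ⟩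
              η̄ ^ 4 * (X.v ^ 4 * η ^ 4 * (ζy ^ 4 * c 0 - R))
                ≈⟨ *-congˡ (*-congʳ (trans (^-congˡ 4 ζx≈) (*-^ X.v η 4))) ⟨
              η̄ ^ 4 * (ζx ^ 4 * (ζy ^ 4 * c 0 - (T * Ly - form 4 c⁰ β ζy)))
                ≈⟨ *-congˡ (ring! 6 (λ z w m T L f → z :* (w :* m :- (T :* L :- f)) ≔ z :* (f :+ w :* m) :- z :* (T :* L)) ≡.refl
                     (ζx ^ 4) (ζy ^ 4) (c 0) T Ly (form 4 c⁰ β ζy)) ⟩
              η̄ ^ 4 * (ζx ^ 4 * (form 4 c⁰ β ζy + ζy ^ 4 * c 0) - ζx ^ 4 * (T * Ly))
                ≈⟨ *-congˡ (+-congʳ (*-congˡ (form-split 4 c β ζy))) ⟨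
              η̄ ^ 4 * (ζx ^ 4 * form 4 c β ζy - ζx ^ 4 * (T * Ly))
                ≈⟨ *-congˡ (ring! 6 (λ z w f g T L → z :* f :- z :* (T :* L) ≔ w :* g :- z :* (T :* L) :- (w :* g :- z :* f)) ≡.refl
                     (ζx ^ 4) (ζy ^ 4) (form 4 c β ζy) (form 4 c α ζx) T Ly) ⟩
              η̄ ^ 4 * (ζy ^ 4 * form 4 c α ζx - ζx ^ 4 * (T * Ly) - (ζy ^ 4 * form 4 c α ζx - ζx ^ 4 * form 4 c β ζy))
                ≈⟨ *-congˡ (+-cong (+-congʳ (*-congˡ (sym Lx≈))) (-‿cong (proj₂ fd))) ⟩
              η̄ ^ 4 * (ζy ^ 4 * (T * Lx) - ζx ^ 4 * (T * Ly) - K * proj₁ fd)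
                ≈⟨ *-congˡ (+-congʳ (ring! 5 (λ z w T L M → w :* (T :* L) :- z :* (T :* M) ≔ T :* (w :* L :- z :* M)) ≡.refl (ζx ^ 4) (ζy ^ 4) T Lx Ly)) ⟩
              η̄ ^ 4 * (T * (ζy ^ 4 * Lx - ζx ^ 4 * Ly) - K * proj₁ fd)
                ≈⟨ *-congˡ (+-congʳ (*-congˡ (proj₂ L-diff))) ⟩
              η̄ ^ 4 * (T * (K * proj₁ L-diff) - K * proj₁ fd)
                ≈⟨ ring! 5 (λ e T K m n → e :* (T :* (K :* m) :- K :* n) ≔ K :* (e :* (T :* m :- n))) ≡.refl (η̄ ^ 4) T K (proj₁ L-diff) (proj₁ fd) ⟩
              K * (η̄ ^ 4 * (T * proj₁ L-diff - proj₁ fd)) ∎)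
            M : Carrier
            M = proj₁ divided
            κ̄M : κ̄ ^ 4 * M ≈ 0#
            -- `unique-ζ` expects the pure power of y. Multiplication by `κ̄ ^ 4` strips the unit
            -- from `ζy ^ 4`, and `κ̄ ^ 4 * R` still depends on the second coordinate alone.
            κ̄M = unique-ζ (c 0) (κ̄ ^ 4 * R) (κ̄ ^ 4 * M) (cy 0) (X.d-*₀ (X.d-^₀ 4 κ̄₀) R₀) (begin
              Y.v ^ (q ℕ.* 4) * c 0 - κ̄ ^ 4 * R       ≈⟨ +-congʳ (ζy-κ̄ (c 0)) ⟨
              κ̄ ^ 4 * (ζy ^ 4 * c 0) - κ̄ ^ 4 * R      ≈⟨ ring! 3 (λ k p r → k :* p :- k :* r ≔ k :* (p :- r)) ≡.refl (κ̄ ^ 4) (ζy ^ 4 * c 0) R ⟩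
              κ̄ ^ 4 * (ζy ^ 4 * c 0 - R)              ≈⟨ *-congˡ (proj₂ divided) ⟩
              κ̄ ^ 4 * (K * M)                         ≈⟨ ring! 3 (λ k K m → k :* (K :* m) ≔ K :* (k :* m)) ≡.refl (κ̄ ^ 4) K M ⟩
              K * (κ̄ ^ 4 * M)                         ∎)
            M≈0 : M ≈ 0#
            M≈0 = begin
              M                       ≈⟨ trans (*-congʳ (inverse-^ κ-inv 4)) (*-identityˡ M) ⟨
              κ ^ 4 * κ̄ ^ 4 * M       ≈⟨ trans (*-assoc _ _ _) (trans (*-congˡ κ̄M) (zeroʳ _)) ⟩
              0#                      ∎
            R≈ : ζy ^ 4 * c 0 ≈ R
            R≈ = x-y≈0⇒x≈y (trans (proj₂ divided) (trans (*-congˡ M≈0) (zeroʳ K)))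
            Ly≈ : T * Ly ≈ form 4 c β ζy
            Ly≈ = begin
              T * Ly                               ≈⟨ ring! 3 (λ T L f → T :* L ≔ f :+ (T :* L :- f)) ≡.refl T Ly (form 4 c⁰ β ζy) ⟩
              form 4 c⁰ β ζy + R                   ≈⟨ +-congˡ R≈ ⟨
              form 4 c⁰ β ζy + ζy ^ 4 * c 0        ≈⟨ form-split 4 c β ζy ⟨
              form 4 c β ζy                        ∎
            cx : ∀ k → X.δ (c k) ≈ 0#
            cx (suc k) = cx₊ k
            -- `R≈` equates `ζy ^ 4 * c 0` with a series constant in the first coordinate, and `ζy`
            -- is constant there too; so the derivative of `c 0` is killed by a power of y times a
            -- unit.
            cx zero    = Y.cancel-^ (q ℕ.* 4) (begin
              Y.v ^ (q ℕ.* 4) * X.δ (c 0)          ≈⟨ ζy-κ̄ (X.δ (c 0)) ⟨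
              κ̄ ^ 4 * (ζy ^ 4 * X.δ (c 0))         ≈⟨ *-congˡ (trans (X.d-* _ _) (trans (+-congʳ (trans (*-congʳ (X.d-^₀ 4 ζy₀)) (zeroˡ _))) (+-identityˡ _))) ⟨
              κ̄ ^ 4 * X.δ (ζy ^ 4 * c 0)           ≈⟨ *-congˡ (trans (X.d-cong R≈) R₀) ⟩
              κ̄ ^ 4 * 0#                           ≈⟨ zeroʳ _ ⟩
              0#                                   ∎)

-- Power series in x, y, t as a threefold series ring over the rationals.

module FormalSeries where
  ℚ-algebra : ℚ-Algebra
  ℚ-algebra = record
    { commRing = ℚ.+-*-commutativeRing
    ; ι = λ q → q ; ι-+ = λ _ _ → ≡.refl ; ι-* = λ _ _ → ≡.refl ; ι-- = λ _ → ≡.refl ; ι-0 = ≡.refl ; ι-1 = ≡.refl }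

  seriesAlgebra : ℚ-Algebra → ℚ-Algebra
  seriesAlgebra A = record
    { commRing = seriesRing
    ; ι   = λ q → const (ι q)
    ; ι-+ = λ p q n → trans (const-cong (ι-+ p q) n) (const-+ (ι p) (ι q) n)
    ; ι-* = λ p q n → trans (const-cong (ι-* p q) n) (const-* (ι p) (ι q) n)
    ; ι-- = λ p n → trans (const-cong (ι-- p) n) (const-neg (ι p) n)
    ; ι-0 = λ n → trans (const-cong ι-0 n) (const-0 n)
    ; ι-1 = const-cong ι-1 }
    where
    open ℚ-Algebra A
    open Series commRing

  module Torsion (A : ℚ-Algebra) where
    open ℚ-Algebra A
    open SemiringMult semiring using () renaming (_×_ to _·_)

    ·-ι : ∀ n a → n · a ≈ ι (fromℤ (+ n)) * a
    ·-ι zero    a = sym (trans (*-congʳ ι-0) (zeroˡ a))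
    ·-ι (suc n) a = begin
      a + n · a                                  ≈⟨ +-cong (sym (*-identityˡ a)) (·-ι n a) ⟩
      1# * a + ι (fromℤ (+ n)) * a               ≈⟨ distribʳ a _ _ ⟨
      (1# + ι (fromℤ (+ n))) * a                 ≈⟨ *-congʳ (+-congʳ ι-1) ⟨
      (ι 1ℚ + ι (fromℤ (+ n))) * a               ≈⟨ *-congʳ (ι-+ _ _) ⟨
      ι (1ℚ ℚ.+ fromℤ (+ n)) * a                 ≡⟨ ≡.cong (λ q → ι q * a) (≡.sym (fromℤ-+ (+ 1) (+ n))) ⟩
      ι (fromℤ (+ suc n)) * a                    ∎
      where open SetoidReasoning setoid

    -- Characteristic 0 enters here: it turns a vanishing derivative into vanishing coefficients of
    -- positive degree.
    torsion-free : ∀ n {a} → suc n · a ≈ 0# → a ≈ 0#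
    torsion-free n {a} p = begin
      a                              ≈⟨ *-identityˡ a ⟨
      1# * a                         ≈⟨ *-congʳ ι-1 ⟨
      ι 1ℚ * a                       ≡⟨ ≡.cong (λ r → ι r * a) (≡.sym (ℚ.*-inverseˡ q)) ⟩
      ι (ℚ.1/ q ℚ.* q) * a           ≈⟨ *-congʳ (ι-* _ _) ⟩
      ι (ℚ.1/ q) * ι q * a           ≈⟨ trans (*-assoc _ _ _) (*-congˡ (trans (sym (·-ι (suc n) a)) p)) ⟩
      ι (ℚ.1/ q) * 0#                ≈⟨ zeroʳ _ ⟩
      0#                             ∎
      where
      open SetoidReasoning setoid
      q : ℚ
      q = fromℤ (+ suc n)
      instance
        q≢0 : ℚ.NonZero q
        q≢0 = ℚ.pos⇒nonZero q {{ℚ.normalize-pos (suc n) 1}}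

  module _ (A : ℚ-Algebra) where
    private
      module A = ℚ-Algebra A
      module S = ℚ-Algebra (seriesAlgebra A)
    open A
    open Series commRing
    open Torsion A
    open SemiringMult semiring using (×-congʳ)

    outer : Invariants.Coordinate (seriesAlgebra A)
    outer = record
      { v      = X
      ; δ      = D
      ; σ      = λ F → const (F 0)
      ; τ      = λ F n → F (suc n)
      ; ∂-der  = record
        { d-cong = λ p n → ×-congʳ (suc n) (p (suc n))
        ; d-+    = λ F G n → trans (·-ι (suc n) _) (trans (distribˡ _ _ _) (sym (+-cong (·-ι (suc n) _) (·-ι (suc n) _))))
        ; d-*    = D-leibniz
        ; d-ι    = λ q n → trans (·-ι (suc n) 0#) (zeroʳ _) }
      ; ∂-v    = λ { zero → +-identityʳ 1# ; (suc n) → trans (·-ι (suc (suc n)) 0#) (zeroʳ _) }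
      ; σ-cong = λ p → const-cong (p 0)
      ; σ-+    = λ F G → const-+ (F 0) (G 0)
      ; σ-*    = λ F G → const-* (F 0) (G 0)
      ; σ-v    = const-0
      ; split  = λ F → λ { zero → sym (trans (+-congˡ (zeroˡ _)) (+-identityʳ _))
                         ; (suc n) → sym (trans (+-congˡ (X-conv (F ∘ suc) n)) (+-identityˡ _)) }
      ; cancel = λ F p n → trans (sym (X-conv F n)) (p (suc n))
      ; ∂-σ    = λ F n → trans (·-ι (suc n) 0#) (zeroʳ _)
      ; ∂≈0⇒σ  = λ F p → λ { zero → refl ; (suc n) → torsion-free n (p n) } }

    module _ (C : Invariants.Coordinate A) where
      open Invariants.Coordinate C

      inner : Invariants.Coordinate (seriesAlgebra A)
      inner = record
        { v      = const v
        ; δ      = λ F n → δ (F n)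
        ; σ      = λ F n → σ (F n)
        ; τ      = λ F n → τ (F n)
        ; ∂-der  = record
          { d-cong = λ p n → d-cong (p n)
          ; d-+    = λ F G n → d-+ (F n) (G n)
          ; d-*    = lift-leibniz δ d-+ d-*
          ; d-ι    = λ q → λ { zero → d-ι q ; (suc n) → d-0 } }
        ; ∂-v    = λ { zero → ∂-v ; (suc n) → d-0 }
        ; σ-cong = λ p n → σ-cong (p n)
        ; σ-+    = λ F G n → σ-+ (F n) (G n)
        ; σ-*    = lift-* σ σ-+ σ-*
        ; σ-v    = λ { zero → σ-v ; (suc n) → σ-0 }
        ; split  = λ F n → trans (split (F n)) (+-congˡ (sym (const-conv v (τ ∘ F) n)))
        ; cancel = λ F p n → cancel (F n) (trans (sym (const-conv v F n)) (p n))
        ; ∂-σ    = λ F n → ∂-σ (F n)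
        ; ∂≈0⇒σ  = λ F p n → ∂≈0⇒σ (F n) (p n) }

      series-bivariate : Invariants.Bivariate (seriesAlgebra A)
      series-bivariate = record
        { X = outer
        ; Y = inner
        ; ∂x-y = λ n → trans (·-ι (suc n) 0#) (zeroʳ _)
        ; ∂y-x = λ { zero → d-0 ; (suc zero) → d-1 ; (suc (suc n)) → d-0 }
        ; ∂x∂y = λ F n → trans (·-ι (suc n) _) (sym (trans (d-cong (·-ι (suc n) _))
            (trans (d-* _ _) (trans (+-congʳ (trans (*-congʳ (d-ι _)) (zeroˡ _))) (+-identityˡ _)))))
        ; ∂x-σ = λ F n → trans (·-ι (suc n) _) (sym (trans (σ-cong (·-ι (suc n) _))
            (trans (σ-* _ _) (*-congʳ (sym (∂≈0⇒σ _ (d-ι _)))))))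
        ; ∂y-σ = λ F → λ { zero → refl ; (suc n) → d-0 } }

  module _ (A : ℚ-Algebra) where
    open ℚ-Algebra A
    open Invariants A

    -- The series construction differentiates by repeated addition, whereas `∂` multiplies by a
    -- rational number. Exchanging one for the other makes the iterated derivatives of the theorem
    -- the literal ones of the coordinate.
    replace-∂ : (C : Coordinate) (d : Carrier → Carrier) → (∀ F → d F ≈ Coordinate.δ C F) → Coordinate
    replace-∂ C d e = record
      { v = v ; δ = d ; σ = σ ; τ = τ
      ; ∂-der  = record
        { d-cong = λ p → trans (e _) (trans (d-cong p) (sym (e _)))
        ; d-+    = λ F G → trans (e _) (trans (d-+ F G) (+-cong (sym (e F)) (sym (e G))))
        ; d-*    = λ F G → trans (e _) (trans (d-* F G) (+-cong (*-congʳ (sym (e F))) (*-congˡ (sym (e G)))))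
        ; d-ι    = λ q → trans (e _) (d-ι q) }
      ; ∂-v    = trans (e v) ∂-v
      ; σ-cong = σ-cong ; σ-+ = σ-+ ; σ-* = σ-* ; σ-v = σ-v ; split = split ; cancel = cancel
      ; ∂-σ    = λ F → trans (e _) (∂-σ F)
      ; ∂≈0⇒σ  = λ F p → ∂≈0⇒σ F (trans (sym (e F)) p) }
      where open Coordinate C

    replace-bivariate : (B : Bivariate) (dx dy : Carrier → Carrier) →
      (∀ F → dx F ≈ Coordinate.δ (Bivariate.X B) F) → (∀ F → dy F ≈ Coordinate.δ (Bivariate.Y B) F) → Bivariate
    replace-bivariate B dx dy ex ey = record
      { X = replace-∂ X dx ex
      ; Y = replace-∂ Y dy ey
      ; ∂x-y = trans (ex _) ∂x-y
      ; ∂y-x = trans (ey _) ∂y-x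
      ; ∂x∂y = λ F → trans (ex _) (trans (X.d-cong (ey F)) (trans (∂x∂y F) (sym (trans (ey _) (Y.d-cong (ex F))))))
      ; ∂x-σ = λ F → trans (ex _) (trans (∂x-σ F) (Y.σ-cong (sym (ex F))))
      ; ∂y-σ = λ F → trans (ey _) (trans (∂y-σ F) (X.σ-cong (sym (ey F)))) }
      where open Bivariate B

  T-algebra YT-algebra XYT-algebra : ℚ-Algebra
  T-algebra   = seriesAlgebra ℚ-algebra
  YT-algebra  = seriesAlgebra T-algebra
  XYT-algebra = seriesAlgebra YT-algebra

  sum-at : (A : ℚ-Algebra) → ∀ n f j →
    Series.sum (ℚ-Algebra.commRing (seriesAlgebra A)) n f j ≡ Series.sum (ℚ-Algebra.commRing A) n (λ a → f a j)
  sum-at A zero    f j = ≡.refl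
  sum-at A (suc n) f j = ≡.cong (λ s → ℚ-Algebra._+_ A s (f (suc n) j)) (sum-at A n f j)

  module T-series = Series (ℚ-Algebra.commRing ℚ-algebra)
  module YT-series = Series (ℚ-Algebra.commRing T-algebra)
  module XYT-series = Series (ℚ-Algebra.commRing YT-algebra)

  private
    module XYT = ℚ-Algebra XYT-algebra
    open XYT using (_≈_; _+_; -_; 0#; 1#; ι)

    ∂x-D : ∀ F → ∂ varX F ≈ XYT-series.D F
    ∂x-D F i j k = ≡.sym (≡.trans (Torsion.·-ι YT-algebra (suc i) (F (suc i)) j k)
      (≡.trans (YT-series.const-conv _ (F (suc i)) j k) (T-series.const-conv _ (F (suc i) j) k)))

    ∂y-D : ∀ F → ∂ varY F ≈ (λ i → YT-series.D (F i))
    ∂y-D F i j k = ≡.sym (≡.trans (Torsion.·-ι T-algebra (suc j) (F i (suc j)) k) (T-series.const-conv _ (F i (suc j)) k))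

    XYT-bivariate : Invariants.Bivariate XYT-algebra
    XYT-bivariate = replace-bivariate XYT-algebra (series-bivariate YT-algebra (outer T-algebra)) (∂ varX) (∂ varY) ∂x-D ∂y-D

    module B = Invariants.Bivariate XYT-bivariate

  𝕩 𝕪 𝕥 : FPS
  𝕩 = B.X.v
  𝕪 = B.Y.v
  𝕥 = XYT-series.const (YT-series.const T-series.X)

  infixl 7 _✶_
  opaque
    -- Opaque, so that products are compared by their factors and not unfolded into triple
    -- convolutions.
    _✶_ : FPS → FPS → FPS
    _✶_ = XYT._*_

    ✶-isCommutativeRing : IsCommutativeRing _≈_ _+_ _✶_ -_ 0# 1#
    ✶-isCommutativeRing = XYT.isCommutativeRing

    ι-✶ : ∀ p q → ι (p ℚ.* q) ≈ ι p ✶ ι q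
    ι-✶ = XYT.ι-*

    ∂x-✶ : ∀ F G → ∂ varX (F ✶ G) ≈ ∂ varX F ✶ G + F ✶ ∂ varX G
    ∂x-✶ = B.X.d-*

    ∂y-✶ : ∀ F G → ∂ varY (F ✶ G) ≈ ∂ varY F ✶ G + F ✶ ∂ varY G
    ∂y-✶ = B.Y.d-*

    σx-✶ : ∀ F G → B.X.σ (F ✶ G) ≈ B.X.σ F ✶ B.X.σ G
    σx-✶ = B.X.σ-*

    σy-✶ : ∀ F G → B.Y.σ (F ✶ G) ≈ B.Y.σ F ✶ B.Y.σ G
    σy-✶ = B.Y.σ-*

    split-x : ∀ F → F ≈ B.X.σ F + 𝕩 ✶ B.X.τ F
    split-x = B.X.split

    split-y : ∀ F → F ≈ B.Y.σ F + 𝕪 ✶ B.Y.τ F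
    split-y = B.Y.split

    cancel-x : ∀ F → 𝕩 ✶ F ≈ 0# → F ≈ 0#
    cancel-x = B.X.cancel

    cancel-y : ∀ F → 𝕪 ✶ F ≈ 0# → F ≈ 0#
    cancel-y = B.Y.cancel

  FPS-algebra : ℚ-Algebra
  FPS-algebra = record
    { commRing = record { isCommutativeRing = ✶-isCommutativeRing }
    ; ι = ι ; ι-+ = XYT.ι-+ ; ι-* = ι-✶ ; ι-- = XYT.ι-- ; ι-0 = XYT.ι-0 ; ι-1 = XYT.ι-1 }

  bivariate : Invariants.Bivariate FPS-algebra
  bivariate = record
    { X = record
      { v = 𝕩 ; δ = ∂ varX ; σ = B.X.σ ; τ = B.X.τ
      ; ∂-der = record { d-cong = B.X.d-cong ; d-+ = B.X.d-+ ; d-* = ∂x-✶ ; d-ι = B.X.d-ι }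
      ; ∂-v = B.X.∂-v ; σ-cong = B.X.σ-cong ; σ-+ = B.X.σ-+ ; σ-* = σx-✶ ; σ-v = B.X.σ-v
      ; split = split-x ; cancel = cancel-x ; ∂-σ = B.X.∂-σ ; ∂≈0⇒σ = B.X.∂≈0⇒σ }
    ; Y = record
      { v = 𝕪 ; δ = ∂ varY ; σ = B.Y.σ ; τ = B.Y.τ
      ; ∂-der = record { d-cong = B.Y.d-cong ; d-+ = B.Y.d-+ ; d-* = ∂y-✶ ; d-ι = B.Y.d-ι }
      ; ∂-v = B.Y.∂-v ; σ-cong = B.Y.σ-cong ; σ-+ = B.Y.σ-+ ; σ-* = σy-✶ ; σ-v = B.Y.σ-v
      ; split = split-y ; cancel = cancel-y ; ∂-σ = B.Y.∂-σ ; ∂≈0⇒σ = B.Y.∂≈0⇒σ }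
    ; ∂x-y = B.∂x-y ; ∂y-x = B.∂y-x ; ∂x∂y = B.∂x∂y ; ∂x-σ = B.∂x-σ ; ∂y-σ = B.∂y-σ }

  private
    module YT = ℚ-Algebra YT-algebra
    module T = ℚ-Algebra T-algebra

  opaque
    unfolding _✶_

    ⊛≈✶ : ∀ F G → F ⊛ G ≈ F ✶ G
    ⊛≈✶ F G i j k = ≡.sym (begin
      (F ✶ G) i j k
        ≡⟨ XYT-series.conv-sum F G i j k ⟩
      XYT-series.sum i (λ a → YT-series.conv (F a) (G (i ℕ.∸ a))) j k
        ≡⟨ ≡.trans (≡.cong-app (sum-at T-algebra i _ j) k) (sum-at₁ i _ k) ⟩
      sumTo i (λ a → YT-series.conv (F a) (G (i ℕ.∸ a)) j k)
        ≡⟨ sumTo-cong i (λ a → ≡.trans (YT-series.conv-sum (F a) (G (i ℕ.∸ a)) j k) (sum-at₁ j _ k)) ⟩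
      sumTo i (λ a → sumTo j (λ b → T-series.conv (F a b) (G (i ℕ.∸ a) (j ℕ.∸ b)) k))
        ≡⟨ sumTo-cong i (λ a → sumTo-cong j (λ b → ≡.trans (T-series.conv-sum (F a b) (G (i ℕ.∸ a) (j ℕ.∸ b)) k) (sum-at₀ k _))) ⟩
      (F ⊛ G) i j k ∎)
      where
      open ≡.≡-Reasoning
      sumTo-cong : ∀ n {f g} → (∀ a → f a ≡ g a) → sumTo n f ≡ sumTo n g
      sumTo-cong zero    p = p 0
      sumTo-cong (suc n) p = ≡.cong₂ ℚ._+_ (sumTo-cong n p) (p (suc n))
      sum-at₀ : ∀ n f → T-series.sum n f ≡ sumTo n f
      sum-at₀ zero    f = ≡.refl
      sum-at₀ (suc n) f = ≡.cong (ℚ._+ f (suc n)) (sum-at₀ n f)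
      sum-at₁ : ∀ n f k → YT-series.sum n f k ≡ sumTo n (λ a → f a k)
      sum-at₁ n f k = ≡.trans (sum-at ℚ-algebra n f k) (sum-at₀ n (λ a → f a k))

    𝕩*-zero : ∀ F j k → (𝕩 ✶ F) 0 j k ≡ 0ℚ
    𝕩*-zero F j k = YT-series.conv-zeroˡ (F 0) (λ _ _ → ≡.refl) j k

    𝕩*-suc : ∀ F i j k → (𝕩 ✶ F) (suc i) j k ≡ F i j k
    𝕩*-suc F i j k = XYT-series.X-conv F i j k

    private
      𝕪*-at : ∀ F i → YT._≈_ ((𝕪 ✶ F) i) (YT._*_ YT-series.X (F i))
      𝕪*-at F i = XYT-series.const-conv YT-series.X F i

      𝕥*-at : ∀ F i → YT._≈_ ((𝕥 ✶ F) i) (YT._*_ (YT-series.const T-series.X) (F i))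
      𝕥*-at F i = XYT-series.const-conv (YT-series.const T-series.X) F i

      t*-at : ∀ (F : ℕ → ℕ → ℚ) j → T._≈_ (YT._*_ (YT-series.const T-series.X) F j) (T._*_ T-series.X (F j))
      t*-at F j = YT-series.const-conv T-series.X F j

      y*-zero : ∀ (F : ℕ → ℕ → ℚ) → T._≈_ (YT._*_ YT-series.X F 0) T.0#
      y*-zero F = T.zeroˡ (F 0)

      y*-suc : ∀ (F : ℕ → ℕ → ℚ) j → T._≈_ (YT._*_ YT-series.X F (suc j)) (F j)
      y*-suc F j = YT-series.X-conv F j

    𝕪*-zero : ∀ F i k → (𝕪 ✶ F) i 0 k ≡ 0ℚ
    𝕪*-zero F i k = ≡.trans (𝕪*-at F i 0 k) (y*-zero (F i) k)

    𝕪*-suc : ∀ F i j k → (𝕪 ✶ F) i (suc j) k ≡ F i j k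
    𝕪*-suc F i j k = ≡.trans (𝕪*-at F i (suc j) k) (y*-suc (F i) j k)

    𝕥*-zero : ∀ F i j → (𝕥 ✶ F) i j 0 ≡ 0ℚ
    𝕥*-zero F i j = ≡.trans (𝕥*-at F i j 0) (≡.trans (t*-at (F i) j 0) (ℚ.*-zeroˡ (F i j 0)))

    𝕥*-suc : ∀ F i j k → (𝕥 ✶ F) i j (suc k) ≡ F i j k
    𝕥*-suc F i j k = ≡.trans (𝕥*-at F i j (suc k)) (≡.trans (t*-at (F i) j (suc k)) (T-series.X-conv (F i j) k))

open FormalSeries

-- Quarter-plane walks decomposed by their last step.

module WalkCounting where
  open ≡ using (refl; sym; trans; cong; cong₂)

  sumOver : ∀ {A : Set} → List A → (A → ℕ) → ℕ
  sumOver []       f = 0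
  sumOver (x ∷ xs) f = f x ℕ.+ sumOver xs f

  sumOver-cong : ∀ {A : Set} (xs : List A) {f g : A → ℕ} → (∀ x → f x ≡ g x) → sumOver xs f ≡ sumOver xs g
  sumOver-cong []       p = refl
  sumOver-cong (x ∷ xs) p = cong₂ ℕ._+_ (p x) (sumOver-cong xs p)

  sumOver-0 : ∀ {A : Set} (xs : List A) → sumOver xs (λ _ → 0) ≡ 0
  sumOver-0 []       = refl
  sumOver-0 (x ∷ xs) = sumOver-0 xs

  sumOver-+ : ∀ {A : Set} (xs : List A) (f g : A → ℕ) → sumOver xs (λ x → f x ℕ.+ g x) ≡ sumOver xs f ℕ.+ sumOver xs g
  sumOver-+ []       f g = refl
  sumOver-+ (x ∷ xs) f g = trans (cong (f x ℕ.+ g x ℕ.+_) (sumOver-+ xs f g))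
    (interchange (f x) (g x) (sumOver xs f) (sumOver xs g))

  sumOver-swap : ∀ {A B : Set} (xs : List A) (ys : List B) (f : A → B → ℕ) →
    sumOver xs (λ x → sumOver ys (f x)) ≡ sumOver ys (λ y → sumOver xs (λ x → f x y))
  sumOver-swap []       ys f = sym (sumOver-0 ys)
  sumOver-swap (x ∷ xs) ys f = trans (cong (sumOver ys (f x) ℕ.+_) (sumOver-swap xs ys f))
    (sym (sumOver-+ ys (f x) (λ y → sumOver xs (λ x → f x y))))

  if-sumOver : ∀ {A : Set} b (xs : List A) (f : A → ℕ) → (if b then sumOver xs f else 0) ≡ sumOver xs (λ x → if b then f x else 0)
  if-sumOver true  xs f = refl
  if-sumOver false xs f = sym (sumOver-0 xs)

  bool-ext : ∀ {x y} → (IsTrue x → IsTrue y) → (IsTrue y → IsTrue x) → x ≡ y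
  bool-ext {true}  {true}  f g = refl
  bool-ext {true}  {false} f g = ⊥-elim (f _)
  bool-ext {false} {true}  f g = ⊥-elim (g _)
  bool-ext {false} {false} f g = refl

  module Walks (D : StepSet) where
    count : ℤ → ℤ → ℤ → ℤ → ℕ → ℕ
    count a b p q k = length (filterᵇ (goodFrom a b p q) (words D k))

    inside : ℤ → ℤ → Step → Bool
    inside a b (u , v) = (0ℤ ℤ.≤ᵇ a ℤ.+ u) ∧ (0ℤ ℤ.≤ᵇ b ℤ.+ v)

    private
      good : ℤ → ℤ → ℤ → ℤ → Bool
      good a b p q = goodFrom a b p q []

      length-filter-map : ∀ (P : List Step → Bool) s W → length (filterᵇ P (map (s ∷_) W)) ≡ length (filterᵇ (P ∘ (s ∷_)) W)
      length-filter-map P s []      = refl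
      length-filter-map P s (w ∷ W) with P (s ∷ w)
      ... | true  = cong suc (length-filter-map P s W)
      ... | false = length-filter-map P s W

      length-filter-++ : ∀ (P : List Step → Bool) V W → length (filterᵇ P (V ++ W)) ≡ length (filterᵇ P V) ℕ.+ length (filterᵇ P W)
      length-filter-++ P []      W = refl
      length-filter-++ P (v ∷ V) W with P v
      ... | true  = cong suc (length-filter-++ P V W)
      ... | false = length-filter-++ P V W

      length-filter-∧ : ∀ x (P : List Step → Bool) W →
        length (filterᵇ (λ w → x ∧ P w) W) ≡ (if x then length (filterᵇ P W) else 0)
      length-filter-∧ true  P W       = refl
      length-filter-∧ false P []      = refl
      length-filter-∧ false P (w ∷ W) = length-filter-∧ false P W

      filter-cong : ∀ {P P′ : List Step → Bool} → (∀ w → P w ≡ P′ w) → ∀ W → length (filterᵇ P W) ≡ length (filterᵇ P′ W)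
      filter-cong e [] = refl
      filter-cong {P} {P′} e (w ∷ W) with P w | P′ w | e w
      ... | true  | true  | _ = cong suc (filter-cong e W)
      ... | false | false | _ = filter-cong e W

    count-suc : ∀ a b p q k → count a b p q (suc k) ≡
      sumOver D (λ s → if inside a b s then count (a ℤ.+ proj₁ s) (b ℤ.+ proj₂ s) p q k else 0)
    count-suc a b p q k = go D
      where
      go : ∀ E → length (filterᵇ (goodFrom a b p q) (concatMap (λ s → map (s ∷_) (words D k)) E)) ≡
        sumOver E (λ s → if inside a b s then count (a ℤ.+ proj₁ s) (b ℤ.+ proj₂ s) p q k else 0)
      go []      = refl
      go (s@(u , v) ∷ E) = trans (length-filter-++ (goodFrom a b p q) (map (s ∷_) (words D k)) _) (cong₂ ℕ._+_
        (trans (length-filter-map (goodFrom a b p q) s (words D k))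
          (trans (filter-cong (λ w → sym (Bool.∧-assoc (0ℤ ℤ.≤ᵇ a ℤ.+ u) (0ℤ ℤ.≤ᵇ b ℤ.+ v) _)) (words D k))
            (length-filter-∧ (inside a b s) (goodFrom (a ℤ.+ u) (b ℤ.+ v) p q) (words D k))))
        (go E))

    private
      T-∧ : ∀ {x y} → IsTrue x → IsTrue y → IsTrue (x ∧ y)
      T-∧ {true} {true} _ _ = _

      cancel-shift : ∀ a u → a ℤ.+ u ℤ.- u ≡ a
      cancel-shift a u = trans (ℤ.+-assoc a u (ℤ.- u)) (trans (cong (λ z → a ℤ.+ z) (ℤ.+-inverseʳ u)) (ℤ.+-identityʳ a))

      shift-cancel : ∀ p u → p ℤ.- u ℤ.+ u ≡ p
      shift-cancel p u = trans (ℤ.+-assoc p (ℤ.- u) u) (trans (cong (λ z → p ℤ.+ z) (ℤ.+-inverseˡ u)) (ℤ.+-identityʳ p))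

      shift-≤ˡ : ∀ a u p → (a ℤ.+ u ℤ.≤ᵇ p) ≡ (a ℤ.≤ᵇ p ℤ.- u)
      shift-≤ˡ a u p = bool-ext
        (λ t → ℤ.≤⇒≤ᵇ (≡.subst (ℤ._≤ p ℤ.- u) (cancel-shift a u) (ℤ.+-monoˡ-≤ (ℤ.- u) (ℤ.≤ᵇ⇒≤ {a ℤ.+ u} {p} t))))
        (λ t → ℤ.≤⇒≤ᵇ (≡.subst (a ℤ.+ u ℤ.≤_) (shift-cancel p u) (ℤ.+-monoˡ-≤ u (ℤ.≤ᵇ⇒≤ {a} {p ℤ.- u} t))))

      shift-≤ʳ : ∀ a u p → (p ℤ.≤ᵇ a ℤ.+ u) ≡ (p ℤ.- u ℤ.≤ᵇ a)
      shift-≤ʳ a u p = bool-ext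
        (λ t → ℤ.≤⇒≤ᵇ (≡.subst (p ℤ.- u ℤ.≤_) (cancel-shift a u) (ℤ.+-monoˡ-≤ (ℤ.- u) (ℤ.≤ᵇ⇒≤ {p} {a ℤ.+ u} t))))
        (λ t → ℤ.≤⇒≤ᵇ (≡.subst (ℤ._≤ a ℤ.+ u) (shift-cancel p u) (ℤ.+-monoˡ-≤ u (ℤ.≤ᵇ⇒≤ {p ℤ.- u} {a} t))))

      good-shift : ∀ a b p q u v → good (a ℤ.+ u) (b ℤ.+ v) p q ≡ good a b (p ℤ.- u) (q ℤ.- v)
      good-shift a b p q u v = cong₂ _∧_ (shift-≤ˡ a u p) (cong₂ _∧_ (shift-≤ʳ a u p) (cong₂ _∧_ (shift-≤ˡ b v q) (shift-≤ʳ b v q)))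

      good-target : ∀ a b p q → good a b p q ≡ true → IsTrue (p ℤ.≤ᵇ a) × IsTrue (q ℤ.≤ᵇ b)
      good-target a b p q g = ≡.subst IsTrue (sym (proj₁ g₂)) _ , ≡.subst IsTrue (sym (proj₂ (∧-true (b ℤ.≤ᵇ q) _ (proj₂ g₂)))) _
        where
        g₂ : (p ℤ.≤ᵇ a) ≡ true × ((b ℤ.≤ᵇ q) ∧ (q ℤ.≤ᵇ b)) ≡ true
        g₂ = ∧-true _ _ (proj₂ (∧-true (a ℤ.≤ᵇ p) _ g))

      -- If a single step ends at a target with nonnegative coordinates, its end point passes the
      -- quadrant test; a failed test therefore contributes nothing.
      good-inside : ∀ a b p q s → IsTrue (0ℤ ℤ.≤ᵇ p) → IsTrue (0ℤ ℤ.≤ᵇ q) → inside a b s ≡ false → good (a ℤ.+ proj₁ s) (b ℤ.+ proj₂ s) p q ≡ false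
      good-inside a b p q (u , v) p≥0 q≥0 out with good (a ℤ.+ u) (b ℤ.+ v) p q in g
      ... | false = refl
      ... | true  = ⊥-elim (≡.subst IsTrue out (T-∧
        (ℤ.≤⇒≤ᵇ (ℤ.≤-trans (ℤ.≤ᵇ⇒≤ {0ℤ} {p} p≥0) (ℤ.≤ᵇ⇒≤ {p} {a ℤ.+ u} (proj₁ (good-target (a ℤ.+ u) (b ℤ.+ v) p q g)))))
        (ℤ.≤⇒≤ᵇ (ℤ.≤-trans (ℤ.≤ᵇ⇒≤ {0ℤ} {q} q≥0) (ℤ.≤ᵇ⇒≤ {q} {b ℤ.+ v} (proj₂ (good-target (a ℤ.+ u) (b ℤ.+ v) p q g)))))))

      count-0 : ∀ a b p q → count a b p q 0 ≡ (if good a b p q then 1 else 0)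
      count-0 a b p q with good a b p q
      ... | true  = refl
      ... | false = refl

    -- `words` splits off the first step, but the functional equation needs the last. The induction
    -- leaves the starting point free: expand by the first step, then by the last, and exchange the
    -- two sums. In the base case the quadrant test follows from the nonnegative target.
    count-last : ∀ k a b p q → IsTrue (0ℤ ℤ.≤ᵇ p) → IsTrue (0ℤ ℤ.≤ᵇ q) →
      count a b p q (suc k) ≡ sumOver D (λ s → count a b (p ℤ.- proj₁ s) (q ℤ.- proj₂ s) k)
    count-last zero a b p q p≥0 q≥0 = trans (count-suc a b p q 0) (sumOver-cong D summand)
      where
      summand : ∀ s → (if inside a b s then count (a ℤ.+ proj₁ s) (b ℤ.+ proj₂ s) p q 0 else 0) ≡ count a b (p ℤ.- proj₁ s) (q ℤ.- proj₂ s) 0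
      summand s@(u , v) = trans (guard (inside a b s) refl) (trans (cong (λ g → if g then 1 else 0) (good-shift a b p q u v))
        (sym (count-0 a b (p ℤ.- u) (q ℤ.- v))))
        where
        guard : ∀ x → inside a b s ≡ x → (if x then count (a ℤ.+ u) (b ℤ.+ v) p q 0 else 0) ≡ (if good (a ℤ.+ u) (b ℤ.+ v) p q then 1 else 0)
        guard true  _   = count-0 (a ℤ.+ u) (b ℤ.+ v) p q
        guard false out = sym (cong (λ g → if g then 1 else 0) (good-inside a b p q s p≥0 q≥0 out))
    count-last (suc k) a b p q p≥0 q≥0 = begin
      count a b p q (suc (suc k))
        ≡⟨ count-suc a b p q (suc k) ⟩
      sumOver D (λ s → if inside a b s then count (a ℤ.+ proj₁ s) (b ℤ.+ proj₂ s) p q (suc k) else 0)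
        ≡⟨ sumOver-cong D (λ s → trans (cong (λ c → if inside a b s then c else 0) (count-last k (a ℤ.+ proj₁ s) (b ℤ.+ proj₂ s) p q p≥0 q≥0))
             (if-sumOver (inside a b s) D _)) ⟩
      sumOver D (λ s → sumOver D (λ s′ → if inside a b s then count (a ℤ.+ proj₁ s) (b ℤ.+ proj₂ s) (p ℤ.- proj₁ s′) (q ℤ.- proj₂ s′) k else 0))
        ≡⟨ sumOver-swap D D _ ⟩
      sumOver D (λ s′ → sumOver D (λ s → if inside a b s then count (a ℤ.+ proj₁ s) (b ℤ.+ proj₂ s) (p ℤ.- proj₁ s′) (q ℤ.- proj₂ s′) k else 0))
        ≡⟨ sumOver-cong D (λ s′ → sym (count-suc a b (p ℤ.- proj₁ s′) (q ℤ.- proj₂ s′) k)) ⟩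
      sumOver D (λ s′ → count a b (p ℤ.- proj₁ s′) (q ℤ.- proj₂ s′) (suc k)) ∎
      where open ≡.≡-Reasoning

    private
      if-false : ∀ x {c} → (x ≡ true → c ≡ 0) → (if x then c else 0) ≡ 0
      if-false true  p = p refl
      if-false false p = refl

      nonneg : ∀ a → IsTrue (0ℤ ℤ.≤ᵇ a) → Σ ℕ λ n → a ≡ + n
      nonneg (+ n) _ = n , refl

    -- The quadrant test after each step keeps the first coordinate nonnegative. Counts at negative
    -- targets are thus 0, as the coefficients of a power series at negative exponents should be.
    count-outsideˡ : ∀ k m b n q → count (+ m) b -[1+ n ] q k ≡ 0
    count-outsideˡ zero    m b n q = refl
    count-outsideˡ (suc k) m b n q = trans (count-suc (+ m) b -[1+ n ] q k) (trans (sumOver-cong D summand) (sumOver-0 D))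
      where
      summand : ∀ s → (if inside (+ m) b s then count (+ m ℤ.+ proj₁ s) (b ℤ.+ proj₂ s) -[1+ n ] q k else 0) ≡ 0
      summand s = if-false (inside (+ m) b s) (λ e → from (nonneg _ (≡.subst IsTrue (sym (proj₁ (∧-true _ _ e))) _)))
        where
        from : (Σ ℕ λ m′ → + m ℤ.+ proj₁ s ≡ + m′) → count (+ m ℤ.+ proj₁ s) (b ℤ.+ proj₂ s) -[1+ n ] q k ≡ 0
        from (m′ , e) = trans (cong (λ a → count a (b ℤ.+ proj₂ s) -[1+ n ] q k) e) (count-outsideˡ k m′ (b ℤ.+ proj₂ s) n q)

    count-outsideʳ : ∀ k a m p n → count a (+ m) p -[1+ n ] k ≡ 0
    count-outsideʳ zero    a m p n = trans (count-0 a (+ m) p -[1+ n ])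
      (cong (λ g → if g then 1 else 0) (trans (cong (λ z → (a ℤ.≤ᵇ p) ∧ z) (Bool.∧-zeroʳ (p ℤ.≤ᵇ a))) (Bool.∧-zeroʳ (a ℤ.≤ᵇ p))))
    count-outsideʳ (suc k) a m p n = trans (count-suc a (+ m) p -[1+ n ] k) (trans (sumOver-cong D summand) (sumOver-0 D))
      where
      summand : ∀ s → (if inside a (+ m) s then count (a ℤ.+ proj₁ s) (+ m ℤ.+ proj₂ s) p -[1+ n ] k else 0) ≡ 0
      summand s = if-false (inside a (+ m) s) (λ e → from (nonneg _ (≡.subst IsTrue (sym (proj₂ (∧-true (0ℤ ℤ.≤ᵇ a ℤ.+ proj₁ s) _ e))) _)))
        where
        from : (Σ ℕ λ m′ → + m ℤ.+ proj₂ s ≡ + m′) → count (a ℤ.+ proj₁ s) (+ m ℤ.+ proj₂ s) p -[1+ n ] k ≡ 0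
        from (m′ , e) = trans (cong (λ b → count (a ℤ.+ proj₁ s) b p -[1+ n ] k) e) (count-outsideʳ k (a ℤ.+ proj₁ s) m′ p n)

open WalkCounting

-- The kernel, the functional equation and uniqueness modulo the kernel.

module KernelEquation where
  open ℚ-Algebra FPS-algebra
  open Invariants FPS-algebra using (Bivariate; module Coordinate)
  open Bivariate bivariate

  data Axis : Set where
    x y t : Axis

  axes : Axis → FPS
  axes x = 𝕩
  axes y = 𝕪
  axes t = 𝕥

  -- The step (u , v) is recorded as the exponents (u + 1 , v + 1) of x y x^u y^v.
  Offsets : Set
  Offsets = List (ℕ × ℕ)

  stepOf : ℕ × ℕ → Step
  stepOf (a , b) = a ℤ.⊖ 1 , b ℤ.⊖ 1

  stepSum : Offsets → Exp Axis
  stepSum []            = con 0ℤ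
  stepSum ((a , b) ∷ E) = var x :^ a :* var y :^ b :+ stepSum E

  kernel : Offsets → Exp Axis
  kernel E = var x :* var y :- var t :* stepSum E

  -- `G` extends the coefficients of `F` by 0 to negative exponents, so that multiplication by a
  -- monomial is a translation without case distinctions.
  shift-* : ∀ (G : ℤ → ℤ → ℕ → ℚ) → (∀ n q k → G -[1+ n ] q k ≡ 0ℚ) → (∀ p n k → G p -[1+ n ] k ≡ 0ℚ) → ∀ a b F →
    (∀ i j k → F i j k ≡ G (+ i) (+ j) k) → ∀ i j k → (⟦ var x :^ a :* var y :^ b ⟧ axes * F) i j k ≡ G (i ℤ.⊖ a) (j ℤ.⊖ b) k
  shift-* G G₁ G₂ a b F e i j k = ≡.trans (*-assoc (⟦ var x :^ a ⟧ axes) (⟦ var y :^ b ⟧ axes) F i j k) (shift-x a i j k)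
    where
    ⊖-suc : ∀ (g : ℤ → ℚ) m n → g (m ℤ.⊖ n) ≡ g (suc m ℤ.⊖ suc n)
    ⊖-suc g m n = ≡.sym (≡.cong g (ℤ.[1+m]⊖[1+n]≡m⊖n m n))
    shift-y : ∀ b i j k → (⟦ var y :^ b ⟧ axes * F) i j k ≡ G (+ i) (j ℤ.⊖ b) k
    shift-y zero    i j       k = ≡.trans (*-identityˡ F i j k) (e i j k)
    shift-y (suc b) i zero    k = ≡.trans (*-assoc 𝕪 (⟦ var y :^ b ⟧ axes) F i 0 k)
      (≡.trans (𝕪*-zero (⟦ var y :^ b ⟧ axes * F) i k) (≡.sym (G₂ (+ i) b k)))
    shift-y (suc b) i (suc j) k = ≡.trans (*-assoc 𝕪 (⟦ var y :^ b ⟧ axes) F i (suc j) k)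
      (≡.trans (𝕪*-suc (⟦ var y :^ b ⟧ axes * F) i j k)
        (≡.trans (shift-y b i j k) (⊖-suc (λ z → G (+ i) z k) j b)))
    Fy : FPS
    Fy = ⟦ var y :^ b ⟧ axes * F
    shift-x : ∀ a i j k → (⟦ var x :^ a ⟧ axes * Fy) i j k ≡ G (i ℤ.⊖ a) (j ℤ.⊖ b) k
    shift-x zero    i       j k = ≡.trans (*-identityˡ Fy i j k) (shift-y b i j k)
    shift-x (suc a) zero    j k = ≡.trans (*-assoc 𝕩 (⟦ var x :^ a ⟧ axes) Fy 0 j k)
      (≡.trans (𝕩*-zero (⟦ var x :^ a ⟧ axes * Fy) j k) (≡.sym (G₁ a (j ℤ.⊖ b) k)))
    shift-x (suc a) (suc i) j k = ≡.trans (*-assoc 𝕩 (⟦ var x :^ a ⟧ axes) Fy (suc i) j k)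
      (≡.trans (𝕩*-suc (⟦ var x :^ a ⟧ axes * Fy) i j k)
        (≡.trans (shift-x a i j k) (⊖-suc (λ z → G z (j ℤ.⊖ b) k) i a)))

  kernel-expand : ∀ E F → ⟦ kernel E ⟧ axes * F ≈ 𝕩 * (𝕪 * F) - 𝕥 * (⟦ stepSum E ⟧ axes * F)
  kernel-expand E F = ring! 5 (λ x y t s f → (x :* y :- t :* s) :* f ≔ x :* (y :* f) :- t :* (s :* f)) ≡.refl
    𝕩 𝕪 𝕥 (⟦ stepSum E ⟧ axes) F

  private
    𝕩𝕪*-suc : ∀ F i j k → (𝕩 * (𝕪 * F)) (suc i) (suc j) k ≡ F i j k
    𝕩𝕪*-suc F i j k = ≡.trans (𝕩*-suc (𝕪 * F) i (suc j) k) (𝕪*-suc F i j k)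

  kernel-coeff-0 : ∀ E F i j → (⟦ kernel E ⟧ axes * F) (suc i) (suc j) 0 ≡ F i j 0
  kernel-coeff-0 E F i j = ≡.trans (kernel-expand E F (suc i) (suc j) 0) (≡.trans
    (≡.cong₂ (λ a b → a ℚ.+ ℚ.- b) (𝕩𝕪*-suc F i j 0) (𝕥*-zero (⟦ stepSum E ⟧ axes * F) (suc i) (suc j)))
    (ℚ.+-identityʳ (F i j 0)))

  kernel-coeff-suc : ∀ E F i j k →
    (⟦ kernel E ⟧ axes * F) (suc i) (suc j) (suc k) ≡ F i j (suc k) ℚ.- (⟦ stepSum E ⟧ axes * F) (suc i) (suc j) k
  kernel-coeff-suc E F i j k = ≡.trans (kernel-expand E F (suc i) (suc j) (suc k))
    (≡.cong₂ (λ a b → a ℚ.+ ℚ.- b) (𝕩𝕪*-suc F i j (suc k)) (𝕥*-suc (⟦ stepSum E ⟧ axes * F) (suc i) (suc j) k))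

  total : Offsets → (ℕ × ℕ → ℚ) → ℚ
  total []      f = 0ℚ
  total (s ∷ E) f = f s ℚ.+ total E f

  fromℤ-sumOver : ∀ E f → fromℤ (+ sumOver E f) ≡ total E (λ s → fromℤ (+ f s))
  fromℤ-sumOver []      f = ≡.refl
  fromℤ-sumOver (s ∷ E) f = ≡.trans (fromℤ-+ (+ f s) (+ sumOver E f)) (≡.cong (fromℤ (+ f s) ℚ.+_) (fromℤ-sumOver E f))

  stepSum-coeff : ∀ (G : ℤ → ℤ → ℕ → ℚ) → (∀ n q k → G -[1+ n ] q k ≡ 0ℚ) → (∀ p n k → G p -[1+ n ] k ≡ 0ℚ) → ∀ E F →
    (∀ i j k → F i j k ≡ G (+ i) (+ j) k) → ∀ i j k →
    (⟦ stepSum E ⟧ axes * F) i j k ≡ total E (λ (a , b) → G (i ℤ.⊖ a) (j ℤ.⊖ b) k)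
  stepSum-coeff G G₁ G₂ []            F e i j k = zeroˡ F i j k
  stepSum-coeff G G₁ G₂ ((a , b) ∷ E) F e i j k = ≡.trans (distribʳ F (⟦ var x :^ a :* var y :^ b ⟧ axes) (⟦ stepSum E ⟧ axes) i j k)
    (≡.cong₂ ℚ._+_ (shift-* G G₁ G₂ a b F e i j k) (stepSum-coeff G G₁ G₂ E F e i j k))

  module _ (E : Offsets) where
    private
      K : FPS
      K = ⟦ kernel E ⟧ axes

    -- The coefficient of x^(i+1) y^(j+1) t^k in `K * M` is that of x^i y^j t^k in `M` minus
    -- coefficients of `M` at t^(k-1); induction on k removes the latter.
    mixed-zero : ∀ {M} → (∀ i j k → (K * M) (suc i) (suc j) k ≡ 0ℚ) → M ≈ 0#
    mixed-zero {M} p i j zero    = ≡.trans (≡.sym (kernel-coeff-0 E M i j)) (p i j 0)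
    mixed-zero {M} p i j (suc k) = begin
      M i j (suc k)                          ≡⟨ ℚ.+-identityʳ _ ⟨
      M i j (suc k) ℚ.- 0ℚ                   ≡⟨ ≡.cong (λ z → M i j (suc k) ℚ.- z) (step-zero E (suc i) (suc j)) ⟨
      M i j (suc k) ℚ.- (⟦ stepSum E ⟧ axes * M) (suc i) (suc j) k ≡⟨ kernel-coeff-suc E M i j k ⟨
      (K * M) (suc i) (suc j) (suc k)        ≡⟨ p i j (suc k) ⟩
      0ℚ                                     ∎
      where
      open ≡.≡-Reasoning
      mon-zero : ∀ a b i j → (⟦ var x :^ a :* var y :^ b ⟧ axes * M) i j k ≡ 0ℚ
      mon-zero a b i j = ≡.trans (*-assoc (⟦ var x :^ a ⟧ axes) (⟦ var y :^ b ⟧ axes) M i j k) (x-zero a i j)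
        where
        y-zero : ∀ b i j → (⟦ var y :^ b ⟧ axes * M) i j k ≡ 0ℚ
        y-zero zero    i j       = ≡.trans (*-identityˡ M i j k) (mixed-zero p i j k)
        y-zero (suc b) i zero    = ≡.trans (*-assoc 𝕪 (⟦ var y :^ b ⟧ axes) M i 0 k) (𝕪*-zero (⟦ var y :^ b ⟧ axes * M) i k)
        y-zero (suc b) i (suc j) = ≡.trans (*-assoc 𝕪 (⟦ var y :^ b ⟧ axes) M i (suc j) k)
          (≡.trans (𝕪*-suc (⟦ var y :^ b ⟧ axes * M) i j k) (y-zero b i j))
        My : FPS
        My = ⟦ var y :^ b ⟧ axes * M
        x-zero : ∀ a i j → (⟦ var x :^ a ⟧ axes * My) i j k ≡ 0ℚ
        x-zero zero    i       j = ≡.trans (*-identityˡ My i j k) (y-zero b i j)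
        x-zero (suc a) zero    j = ≡.trans (*-assoc 𝕩 (⟦ var x :^ a ⟧ axes) My 0 j k) (𝕩*-zero (⟦ var x :^ a ⟧ axes * My) j k)
        x-zero (suc a) (suc i) j = ≡.trans (*-assoc 𝕩 (⟦ var x :^ a ⟧ axes) My (suc i) j k)
          (≡.trans (𝕩*-suc (⟦ var x :^ a ⟧ axes * My) i j k) (x-zero a i j))
      step-zero : ∀ E i j → (⟦ stepSum E ⟧ axes * M) i j k ≡ 0ℚ
      step-zero []            i j = zeroˡ M i j k
      step-zero ((a , b) ∷ E) i j = ≡.trans (distribʳ M (⟦ var x :^ a :* var y :^ b ⟧ axes) (⟦ stepSum E ⟧ axes) i j k)
        (≡.cong₂ ℚ._+_ (mon-zero a b i j) (step-zero E i j))

    -- A series in x minus a series in y has no monomial divisible by x y, which is the hypothesis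
    -- of `mixed-zero`.
    kernel-unique : ∀ P R M → Y.δ P ≈ 0# → X.δ R ≈ 0# → P - R ≈ K * M → M ≈ 0#
    kernel-unique P R M P₀ R₀ e = mixed-zero {M} (λ i j k → ≡.trans (≡.sym (e (suc i) (suc j) k))
      (≡.cong₂ (λ a b → a ℚ.+ ℚ.- b) (Y.∂≈0⇒σ P P₀ (suc i) (suc j) k) (X.∂≈0⇒σ R R₀ (suc i) (suc j) k)))

    private
      D : StepSet
      D = map stepOf E
      open Walks D

      G : ℤ → ℤ → ℕ → ℚ
      G p q k = fromℤ (+ count 0ℤ 0ℤ p q k)

      count-offset : ∀ i j k → count 0ℤ 0ℤ (+ i) (+ j) (suc k) ≡ sumOver E (λ (a , b) → count 0ℤ 0ℤ (suc i ℤ.⊖ a) (suc j ℤ.⊖ b) k)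
      count-offset i j k = ≡.trans (count-last k 0ℤ 0ℤ (+ i) (+ j) _ _) (≡.trans (sumOver-map E _)
        (sumOver-cong E (λ (a , b) → ≡.cong₂ (λ p q → count 0ℤ 0ℤ p q k) (offset i a) (offset j b))))
        where
        sumOver-map : ∀ E f → sumOver (map stepOf E) f ≡ sumOver E (λ s → f (stepOf s))
        sumOver-map []      f = ≡.refl
        sumOver-map (s ∷ E) f = ≡.cong (f (stepOf s) ℕ.+_) (sumOver-map E f)
        offset : ∀ i a → + i ℤ.- (a ℤ.⊖ 1) ≡ suc i ℤ.⊖ a
        offset i a = begin
          + i ℤ.- (a ℤ.⊖ 1)                 ≡⟨ ≡.cong (λ z → + i ℤ.+ z) (ℤ.⊖-swap 1 a) ⟨
          + i ℤ.+ (1 ℤ.⊖ a)                 ≡⟨ ℤ.distribʳ-⊖-+-pos i 1 a ⟩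
          (i ℕ.+ 1) ℤ.⊖ a                   ≡⟨ ≡.cong (ℤ._⊖ a) (ℕ.+-comm i 1) ⟩
          suc i ℤ.⊖ a                       ∎
          where open ≡.≡-Reasoning

      G-suc : ∀ i j k → G (+ i) (+ j) (suc k) ≡ total E (λ (a , b) → G (suc i ℤ.⊖ a) (suc j ℤ.⊖ b) k)
      G-suc i j k = ≡.trans (≡.cong (λ n → fromℤ (+ n)) (count-offset i j k))
        (fromℤ-sumOver E (λ (a , b) → count 0ℤ 0ℤ (suc i ℤ.⊖ a) (suc j ℤ.⊖ b) k))

      initial : ∀ i j → Q D i j 0 ≡ 1# i j 0
      initial zero    zero    = ≡.refl
      initial zero    (suc j) = ≡.refl
      initial (suc i) zero    = ≡.refl
      initial (suc i) (suc j) = ≡.refl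

      1#-suc : ∀ i j k → 1# i j (suc k) ≡ 0ℚ
      1#-suc zero    zero    k = ≡.refl
      1#-suc zero    (suc j) k = ≡.refl
      1#-suc (suc i) j       k = ≡.refl

      -- At positive powers of t this is the last-step recursion. The shift by one in x and y is the
      -- factor x y of the kernel, and the empty walk supplies the monomial x y.
      mixed-coeff : ∀ i j k → (K * Q D) (suc i) (suc j) k ≡ (𝕩 * 𝕪) (suc i) (suc j) k
      mixed-coeff i j k = ≡.trans (lemma k) (≡.sym (≡.trans (*-congˡ {𝕩} (sym {𝕪 * 1#} {𝕪} (*-identityʳ 𝕪)) (suc i) (suc j) k) (𝕩𝕪*-suc 1# i j k)))
        where
        lemma : ∀ k → (K * Q D) (suc i) (suc j) k ≡ 1# i j k
        lemma zero    = ≡.trans (kernel-coeff-0 E (Q D) i j) (initial i j)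
        lemma (suc k) = begin
          (K * Q D) (suc i) (suc j) (suc k)
            ≡⟨ kernel-coeff-suc E (Q D) i j k ⟩
          Q D i j (suc k) ℚ.- (⟦ stepSum E ⟧ axes * Q D) (suc i) (suc j) k
            ≡⟨ ≡.cong (λ z → Q D i j (suc k) ℚ.- z) (stepSum-coeff G
                 (λ n q k → ≡.cong (λ n → fromℤ (+ n)) (count-outsideˡ k 0 0ℤ n q))
                 (λ p n k → ≡.cong (λ n → fromℤ (+ n)) (count-outsideʳ k 0ℤ 0 p n)) E (Q D) (λ i j k → ≡.refl) (suc i) (suc j) k) ⟩
          Q D i j (suc k) ℚ.- total E (λ (a , b) → G (suc i ℤ.⊖ a) (suc j ℤ.⊖ b) k)
            ≡⟨ ≡.cong (λ z → z ℚ.- total E (λ (a , b) → G (suc i ℤ.⊖ a) (suc j ℤ.⊖ b) k)) (G-suc i j k) ⟩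
          total E (λ (a , b) → G (suc i ℤ.⊖ a) (suc j ℤ.⊖ b) k)
            ℚ.- total E (λ (a , b) → G (suc i ℤ.⊖ a) (suc j ℤ.⊖ b) k)
            ≡⟨ ℚ.+-inverseʳ (total E (λ (a , b) → G (suc i ℤ.⊖ a) (suc j ℤ.⊖ b) k)) ⟩
          0ℚ
            ≡⟨ 1#-suc i j k ⟨
          1# i j (suc k) ∎
          where open ≡.≡-Reasoning

      rest : FPS
      rest = 𝕩 * 𝕪 - K * Q D

      rest-mixed : ∀ i j k → rest (suc i) (suc j) k ≡ 0ℚ
      rest-mixed i j k = ≡.trans (≡.cong (λ z → (𝕩 * 𝕪) (suc i) (suc j) k ℚ.- z) (mixed-coeff i j k)) (ℚ.+-inverseʳ ((𝕩 * 𝕪) (suc i) (suc j) k))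

      rest-x : ∀ i j k → (rest - Y.σ rest) (suc i) j k ≡ 0ℚ
      rest-x i zero    k = ℚ.+-inverseʳ (rest (suc i) 0 k)
      rest-x i (suc j) k = ≡.cong (λ z → z ℚ.- 0ℚ) (rest-mixed i j k)

    opaque
      -- By `rest-mixed` no monomial of `rest` is divisible by x y: setting y = 0 collects the part
      -- in x, and the remainder depends on y and t only.
      kernel-equation : Σ FPS λ r → Σ FPS λ s → Y.δ r ≈ 0# × X.δ s ≈ 0# × K * Q D ≈ 𝕩 * 𝕪 - r - s
      kernel-equation = Y.σ rest , rest - Y.σ rest , Y.∂-σ rest
        , (λ i j k → ≡.trans (≡.cong (λ z → fromℤ (+ suc i) ℚ.* z) (rest-x i j k)) (ℚ.*-zeroʳ (fromℤ (+ suc i))))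
        , ring! 3 (λ k p r → k ≔ p :- r :- ((p :- k) :- r)) ≡.refl (K * Q D) (𝕩 * 𝕪) (Y.σ rest)

open KernelEquation

-- From differential expressions to nonzero polynomial equations.

module DifferentialPolynomials where
  -- inj₂ i stands for the i-th derivative of the unknown series.
  DVar : Set
  DVar = Axis ⊎ ℕ

  order : Exp DVar → ℕ
  order (con c)        = 0
  order (var (inj₁ _)) = 0
  order (var (inj₂ i)) = i
  order (a :+ b)       = order a ℕ.⊔ order b
  order (a :* b)       = order a ℕ.⊔ order b
  order (:- a)         = order a

  -- A total map, so that variables can be indexed without a bound in their type; `flat-index` uses
  -- it only within the order, where it is faithful.
  clamp : ∀ n → ℕ → Fin (suc n)
  clamp n       zero    = fzero
  clamp zero    (suc i) = fzero
  clamp (suc n) (suc i) = fsuc (clamp n i)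

  toℕ-clamp : ∀ n i → i ℕ.≤ n → toℕ (clamp n i) ≡ i
  toℕ-clamp n       zero    _         = ≡.refl
  toℕ-clamp (suc n) (suc i) (s≤s i≤n) = ≡.cong suc (toℕ-clamp n i i≤n)

  index : ∀ n → DVar → Fin (suc (suc (suc (suc n))))
  index n (inj₁ x) = fzero
  index n (inj₁ y) = fsuc fzero
  index n (inj₁ t) = fsuc (fsuc fzero)
  index n (inj₂ i) = fsuc (fsuc (fsuc (clamp n i)))

  module Flatten (A : ℚ-Algebra) where
    open ℚ-Algebra A

    ⟦mapVar⟧ : ∀ {V W} (f : V → W) e ρ → ⟦ mapVar f e ⟧ ρ ≡ ⟦ e ⟧ (λ v → ρ (f v))
    ⟦mapVar⟧ f (con c)  ρ = ≡.refl
    ⟦mapVar⟧ f (var v)  ρ = ≡.refl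
    ⟦mapVar⟧ f (a :+ b) ρ = ≡.cong₂ _+_ (⟦mapVar⟧ f a ρ) (⟦mapVar⟧ f b ρ)
    ⟦mapVar⟧ f (a :* b) ρ = ≡.cong₂ _*_ (⟦mapVar⟧ f a ρ) (⟦mapVar⟧ f b ρ)
    ⟦mapVar⟧ f (:- a)   ρ = ≡.cong -_ (⟦mapVar⟧ f a ρ)

    flat : ∀ {n} → (DVar → Carrier) → Fin (suc (suc (suc (suc n)))) → Carrier
    flat ρ fzero                   = ρ (inj₁ x)
    flat ρ (fsuc fzero)            = ρ (inj₁ y)
    flat ρ (fsuc (fsuc fzero))     = ρ (inj₁ t)
    flat ρ (fsuc (fsuc (fsuc j)))  = ρ (inj₂ (toℕ j))

    flat-index : ∀ n ρ e → order e ℕ.≤ n → ⟦ e ⟧ (λ v → flat ρ (index n v)) ≡ ⟦ e ⟧ ρ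
    flat-index n ρ (con c)        le = ≡.refl
    flat-index n ρ (var (inj₁ x)) le = ≡.refl
    flat-index n ρ (var (inj₁ y)) le = ≡.refl
    flat-index n ρ (var (inj₁ t)) le = ≡.refl
    flat-index n ρ (var (inj₂ i)) le = ≡.cong (λ j → ρ (inj₂ j)) (toℕ-clamp n i le)
    flat-index n ρ (a :+ b)       le = ≡.cong₂ _+_ (flat-index n ρ a (ℕ.m⊔n≤o⇒m≤o _ _ le)) (flat-index n ρ b (ℕ.m⊔n≤o⇒n≤o _ _ le))
    flat-index n ρ (a :* b)       le = ≡.cong₂ _*_ (flat-index n ρ a (ℕ.m⊔n≤o⇒m≤o _ _ le)) (flat-index n ρ b (ℕ.m⊔n≤o⇒n≤o _ _ le))
    flat-index n ρ (:- a)         le = ≡.cong -_ (flat-index n ρ a le)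

    nf-flat : ∀ e ρ → evalNF (nf (mapVar (index (order e)) e)) (flat ρ) ≈ ⟦ e ⟧ ρ
    nf-flat e ρ = trans (nf-eval (flat ρ) (mapVar (index (order e)) e))
      (reflexive (≡.trans (⟦mapVar⟧ (index (order e)) e (flat ρ)) (flat-index (order e) ρ e ℕ.≤-refl)))

  open NormalForm

  toTerm : ∀ {n} → ℤ × Vec ℕ (suc (suc (suc (suc n)))) → Term n
  toTerm (c , a ∷ b ∷ d ∷ e) = term (fromℤ c) a b d e

  module Coefficients {m : ℕ} where
    coeff : NF {m} → Vec ℕ m → ℚ
    coeff []            l = 0ℚ
    coeff ((c , k) ∷ P) l = if eqVecᵇ l k then fromℤ c ℚ.+ coeff P l else coeff P l

    remove : Vec ℕ m → NF {m} → NF {m}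
    remove l []            = []
    remove l ((c , k) ∷ P) = if eqVecᵇ l k then remove l P else (c , k) ∷ remove l P

    length-remove : ∀ l P → length (remove l P) ℕ.≤ length P
    length-remove l []            = z≤n
    length-remove l ((c , k) ∷ P) with eqVecᵇ l k
    ... | true  = ℕ.m≤n⇒m≤1+n (length-remove l P)
    ... | false = s≤s (length-remove l P)

    eqVecᵇ-refl : ∀ {n} (l : Vec ℕ n) → eqVecᵇ l l ≡ true
    eqVecᵇ-refl []      = ≡.refl
    eqVecᵇ-refl (a ∷ l) = ≡.cong₂ _∧_ (≡ᵇ-refl a) (eqVecᵇ-refl l)

    coeff-remove : ∀ l P l′ → coeff (remove l P) l′ ≢ 0ℚ → coeff (remove l P) l′ ≡ coeff P l′
    coeff-remove l P l′ nz with eqVecᵇ l l′ in eq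
    ... | true with ≡.refl ← eqVecᵇ-sound l l′ eq = ⊥-elim (nz (removed P))
      where
      removed : ∀ P → coeff (remove l P) l ≡ 0ℚ
      removed []            = ≡.refl
      removed ((c , k) ∷ P) with eqVecᵇ l k in e
      ... | true  = removed P
      ... | false rewrite e = removed P
    ... | false = kept P
      where
      kept : ∀ P → coeff (remove l P) l′ ≡ coeff P l′
      kept []            = ≡.refl
      kept ((c , k) ∷ P) with eqVecᵇ l k in e
      ... | false with eqVecᵇ l′ k
      ...   | true  = ≡.cong (fromℤ c ℚ.+_) (kept P)
      ...   | false = kept P
      kept ((c , k) ∷ P) | true with eqVecᵇ l′ k in e′
      ...   | false = kept P
      ...   | true with ≡.refl ← eqVecᵇ-sound l k e with ≡.refl ← eqVecᵇ-sound l′ k e′ with () ← ≡.trans (≡.sym eq) (eqVecᵇ-refl l)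

    open ℚ-Algebra ℚ-algebra using (evalNF; monomial; ring!; _≔_)

    evalNF-remove : ∀ l P ρ → evalNF P ρ ≡ coeff P l ℚ.* monomial l ρ ℚ.+ evalNF (remove l P) ρ
    evalNF-remove l []            ρ = ≡.sym (≡.trans (ℚ.+-identityʳ _) (ℚ.*-zeroˡ (monomial l ρ)))
    evalNF-remove l ((c , k) ∷ P) ρ with eqVecᵇ l k in e
    ... | true with ≡.refl ← eqVecᵇ-sound l k e = ≡.trans (≡.cong (fromℤ c ℚ.* monomial l ρ ℚ.+_) (evalNF-remove l P ρ))
      (ring! 4 (λ c m a r → c :* m :+ (a :* m :+ r) ≔ (c :+ a) :* m :+ r) ≡.refl (fromℤ c) (monomial l ρ) (coeff P l) (evalNF (remove l P) ρ))
    ... | false = ≡.trans (≡.cong (fromℤ c ℚ.* monomial k ρ ℚ.+_) (evalNF-remove l P ρ))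
      (ring! 3 (λ s a r → s :+ (a :+ r) ≔ a :+ (s :+ r)) ≡.refl (fromℤ c ℚ.* monomial k ρ) (coeff P l ℚ.* monomial l ρ) (evalNF (remove l P) ρ))

    -- If the total coefficient of the first exponent vector is 0, all its occurrences can be
    -- deleted without changing the value, and the list gets shorter. The empty list has value 0, so
    -- the process stops at a nonzero coefficient.
    nonzero-coeff : ∀ n P ρ → length P ℕ.≤ n → evalNF P ρ ≢ 0ℚ → Σ (Vec ℕ m) λ l → coeff P l ≢ 0ℚ
    nonzero-coeff n       []            ρ le nz = ⊥-elim (nz ≡.refl)
    nonzero-coeff (suc n) P@((c , k) ∷ P′) ρ (s≤s le) nz with coeff P k ℚ.≟ 0ℚ
    ... | no  p = k , p
    ... | yes p = proj₁ rec , λ z → proj₂ rec (≡.trans (coeff-remove k P (proj₁ rec) (proj₂ rec)) z)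
      where
      shorter : length (remove k P) ℕ.≤ n
      shorter rewrite eqVecᵇ-refl k = ℕ.≤-trans (length-remove k P′) le
      same : evalNF P ρ ≡ evalNF (remove k P) ρ
      same = ≡.trans (evalNF-remove k P ρ) (≡.trans (≡.cong (λ q → q ℚ.* monomial k ρ ℚ.+ evalNF (remove k P) ρ) p)
        (≡.trans (≡.cong (ℚ._+ evalNF (remove k P) ρ) (ℚ.*-zeroˡ (monomial k ρ))) (ℚ.+-identityˡ _)))
      rec : Σ (Vec ℕ m) λ l → coeff (remove k P) l ≢ 0ℚ
      rec = nonzero-coeff n (remove k P) ρ shorter (λ z → nz (≡.trans same z))

  open Coefficients

  polyCoeff-toTerm : ∀ {n} (P : NF {suc (suc (suc (suc n)))}) a b d e → polyCoeff (map toTerm P) a b d e ≡ coeff P (a ∷ b ∷ d ∷ e)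
  polyCoeff-toTerm []                                  a b d e = ≡.refl
  polyCoeff-toTerm ((c , a′ ∷ b′ ∷ d′ ∷ e′) ∷ P) a b d e =
    ≡.cong (λ q → if (a ℕ.≡ᵇ a′) ∧ (b ℕ.≡ᵇ b′) ∧ (d ℕ.≡ᵇ d′) ∧ eqVecᵇ e e′ then fromℤ c ℚ.+ q else q) (polyCoeff-toTerm P a b d e)

  module _ where
    open ℚ-Algebra FPS-algebra
    open import Relation.Binary.Reasoning.Setoid setoid

    private
      mono-t : ∀ q c → mono q 0 0 c ≈ 𝕥 ^ c * ι q
      mono-t q zero    = λ i j k → ≡.trans (base i j k) (≡.sym (*-identityˡ (ι q) i j k))
        where
        base : ∀ i j k → mono q 0 0 0 i j k ≡ ι q i j k
        base zero    zero    zero    = ≡.refl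
        base zero    zero    (suc k) = ≡.refl
        base zero    (suc j) k       = ≡.refl
        base (suc i) j       k       = ≡.refl
      mono-t q (suc c) i j k = ≡.trans (step i j k) (≡.trans (*-congˡ {𝕥} (mono-t q c) i j k) (≡.sym (*-assoc 𝕥 (𝕥 ^ c) (ι q) i j k)))
        where
        step : ∀ i j k → mono q 0 0 (suc c) i j k ≡ (𝕥 * mono q 0 0 c) i j k
        step i j (suc k) = ≡.sym (𝕥*-suc (mono q 0 0 c) i j k)
        step i j zero    = ≡.trans (vanish i j) (≡.sym (𝕥*-zero (mono q 0 0 c) i j))
          where
          vanish : ∀ i j → mono q 0 0 (suc c) i j 0 ≡ 0ℚ
          vanish zero    zero    = ≡.refl
          vanish zero    (suc j) = ≡.refl
          vanish (suc i) j       = ≡.refl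

      mono-y : ∀ q b c → mono q 0 b c ≈ 𝕪 ^ b * (𝕥 ^ c * ι q)
      mono-y q zero    c i j k = ≡.trans (mono-t q c i j k) (≡.sym (*-identityˡ (𝕥 ^ c * ι q) i j k))
      mono-y q (suc b) c i j k = ≡.trans (step i j k) (≡.trans (*-congˡ {𝕪} (mono-y q b c) i j k) (≡.sym (*-assoc 𝕪 (𝕪 ^ b) (𝕥 ^ c * ι q) i j k)))
        where
        step : ∀ i j k → mono q 0 (suc b) c i j k ≡ (𝕪 * mono q 0 b c) i j k
        step i (suc j) k = ≡.sym (𝕪*-suc (mono q 0 b c) i j k)
        step i zero    k = ≡.trans (vanish i) (≡.sym (𝕪*-zero (mono q 0 b c) i k))
          where
          vanish : ∀ i → mono q 0 (suc b) c i 0 k ≡ 0ℚ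
          vanish zero    = ≡.refl
          vanish (suc i) = ≡.refl

      mono-x : ∀ q a b c → mono q a b c ≈ 𝕩 ^ a * (𝕪 ^ b * (𝕥 ^ c * ι q))
      mono-x q zero    b c i j k = ≡.trans (mono-y q b c i j k) (≡.sym (*-identityˡ (𝕪 ^ b * (𝕥 ^ c * ι q)) i j k))
      mono-x q (suc a) b c i j k = ≡.trans (step i j k)
        (≡.trans (*-congˡ {𝕩} (mono-x q a b c) i j k) (≡.sym (*-assoc 𝕩 (𝕩 ^ a) (𝕪 ^ b * (𝕥 ^ c * ι q)) i j k)))
        where
        step : ∀ i j k → mono q (suc a) b c i j k ≡ (𝕩 * mono q a b c) i j k
        step (suc i) j k = ≡.sym (𝕩*-suc (mono q a b c) i j k)
        step zero    j k = ≡.sym (𝕩*-zero (mono q a b c) j k)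

      mono-1 : mono 1ℚ 0 0 0 ≈ 1#
      mono-1 i j k = ≡.trans (mono-t 1ℚ 0 i j k) (*-identityˡ 1# i j k)

      pow-^ : ∀ F n → pow F n ≈ F ^ n
      pow-^ F zero    = mono-1
      pow-^ F (suc n) i j k = ≡.trans (⊛≈✶ F (pow F n) i j k) (*-congˡ {F} (pow-^ F n) i j k)

      zProd-monomial : ∀ v F {m} l (e : Vec ℕ m) (ρ : Fin m → FPS) → (∀ i → ρ i ≡ ∂^ v (l ℕ.+ toℕ i) F) →
        zProd v F l e ≈ monomial e ρ
      zProd-monomial v F l []      ρ p = mono-1
      zProd-monomial v F l (e ∷ es) ρ p i j k = ≡.trans (⊛≈✶ (pow (∂^ v l F) e) (zProd v F (suc l) es) i j k)
        (*-cong {pow (∂^ v l F) e} {ρ fzero ^ e} {zProd v F (suc l) es} {monomial es (λ i → ρ (fsuc i))}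
          (λ i j k → ≡.trans (pow-^ (∂^ v l F) e i j k) (≡.cong (λ G → (G ^ e) i j k) (≡.sym (≡.trans (p fzero) (≡.cong (λ n → ∂^ v n F) (ℕ.+-identityʳ l))))))
          (zProd-monomial v F (suc l) es (λ i → ρ (fsuc i)) (λ i → ≡.trans (p (fsuc i)) (≡.cong (λ n → ∂^ v n F) (ℕ.+-suc l (toℕ i)))))
          i j k)

    jet : Var → FPS → DVar → FPS
    jet v F (inj₁ a) = axes a
    jet v F (inj₂ i) = ∂^ v i F

    open Flatten FPS-algebra

    evalPoly-toTerm : ∀ v F {n} (P : NF {suc (suc (suc (suc n)))}) → evalPoly v (map toTerm P) F ≈ evalNF P (flat (jet v F))
    evalPoly-toTerm v F []                            i j k = ≡.refl
    evalPoly-toTerm v F ((c , a ∷ b ∷ d ∷ e) ∷ P) i j k = ≡.cong₂ ℚ._+_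
      (≡.trans (⊛≈✶ (mono (fromℤ c) a b d) (zProd v F 0 e) i j k) (≡.trans
        (*-cong {mono (fromℤ c) a b d} {𝕩 ^ a * (𝕪 ^ b * (𝕥 ^ d * ι (fromℤ c)))} {zProd v F 0 e} {M}
          (mono-x (fromℤ c) a b d) (zProd-monomial v F 0 e (λ i → ∂^ v (toℕ i) F) (λ i → ≡.refl)) i j k)
        (ring! 5 (λ x y t c m → x :* (y :* (t :* c)) :* m ≔ c :* (x :* (y :* (t :* m)))) ≡.refl (𝕩 ^ a) (𝕪 ^ b) (𝕥 ^ d) (ι (fromℤ c)) M i j k)))
      (evalPoly-toTerm v F P i j k)
      where
      M : FPS
      M = monomial e (λ i → ∂^ v (toℕ i) F)

    -- The two hypotheses live at different points: `e` vanishes at the jet of `F`, but not at the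
    -- rational point `ρ`, where the derivatives are independent numbers. The second makes the
    -- polynomial nonzero.
    hyperalgebraic : ∀ v F e (ρ : DVar → ℚ) → ⟦ e ⟧ (jet v F) ≈ 0# → ℚ-Algebra.⟦_⟧ ℚ-algebra e ρ ≢ 0ℚ → Hyperalgebraic v F
    hyperalgebraic v F e ρ e≈0 nz = order e , map toTerm P , exponents (proj₁ c) (proj₂ c)
      , λ i j k → ≡.trans (evalPoly-toTerm v F P i j k) (≡.trans (nf-flat e (jet v F) i j k) (e≈0 i j k))
      where
      module Fℚ = Flatten ℚ-algebra
      P : NF {suc (suc (suc (suc (order e))))}
      P = nf (mapVar (index (order e)) e)
      c : Σ (Vec ℕ (suc (suc (suc (suc (order e)))))) λ l → coeff P l ≢ 0ℚ
      c = nonzero-coeff (length P) P (Fℚ.flat ρ) ℕ.≤-refl (λ z → nz (≡.trans (≡.sym (Fℚ.nf-flat e ρ)) z))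
      exponents : ∀ l → coeff P l ≢ 0ℚ → NonZeroPoly (map toTerm P)
      exponents (a ∷ b ∷ d ∷ l) p = a , b , d , l , λ z → p (≡.trans (≡.sym (polyCoeff-toTerm P a b d l)) z)

open DifferentialPolynomials

-- Symbolic elimination and its nontriviality.

module LeadingCoefficient where
  derive : ∀ {V} → (V → Exp V) → Exp V → Exp V
  derive δ (con c)  = con 0ℤ
  derive δ (var v)  = δ v
  derive δ (a :+ b) = derive δ a :+ derive δ b
  derive δ (a :* b) = derive δ a :* b :+ a :* derive δ b
  derive δ (:- a)   = :- derive δ a

  sameᵇ : Axis → Axis → Bool
  sameᵇ x x = true
  sameᵇ y y = true
  sameᵇ t t = true
  sameᵇ _ _ = false

  δ-axis : ∀ {V : Set} → Axis → Axis → Exp V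
  δ-axis a b = con (if sameᵇ a b then 1ℤ else 0ℤ)

  partial : Axis → Exp Axis → Exp Axis
  partial a = derive (δ-axis a)

  total-δ : Axis → DVar → Exp DVar
  total-δ a (inj₁ b) = δ-axis a b
  total-δ a (inj₂ i) = var (inj₂ (suc i))

  𝔻 : Axis → Exp DVar → Exp DVar
  𝔻 a = derive (total-δ a)

  -- The partial derivative in the n-th derivative of the unknown, with all jets and axes treated as
  -- independent.
  jet-partial : ℕ → Exp DVar → Exp DVar
  jet-partial n = derive λ { (inj₁ _) → con 0ℤ ; (inj₂ i) → con (if i ℕ.≡ᵇ n then 1ℤ else 0ℤ) }

  numeral : ∀ {V : Set} → ℕ → Exp V
  numeral zero    = con 0ℤ
  numeral (suc n) = con 1ℤ :+ numeral n

  module _ (A : ℚ-Algebra) where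
    open ℚ-Algebra A
    open Derivations A

    derive-sound : ∀ {V : Set} {d} (dd : Derivation d) (ρ : V → Carrier) δ → (∀ v → d (ρ v) ≈ ⟦ δ v ⟧ ρ) →
      ∀ e → d (⟦ e ⟧ ρ) ≈ ⟦ derive δ e ⟧ ρ
    derive-sound dd ρ δ p (con c)  = trans (Derivation.d-cong dd (⟦⟧ℤ-ι c)) (Derivation.d-ι dd (fromℤ c))
    derive-sound dd ρ δ p (var v)  = p v
    derive-sound dd ρ δ p (a :+ b) = trans (Derivation.d-+ dd _ _) (+-cong (derive-sound dd ρ δ p a) (derive-sound dd ρ δ p b))
    derive-sound dd ρ δ p (a :* b) = trans (Derivation.d-* dd _ _)
      (+-cong (*-congʳ (derive-sound dd ρ δ p a)) (*-congˡ (derive-sound dd ρ δ p b)))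
    derive-sound dd ρ δ p (:- a)   = trans (Derivation.d-neg dd _) (-‿cong (derive-sound dd ρ δ p a))

    ⟦numeral⟧ : ∀ {V : Set} n (ρ : V → Carrier) → ⟦ numeral n ⟧ ρ ≡ nat n
    ⟦numeral⟧ zero    ρ = ≡.refl
    ⟦numeral⟧ (suc n) ρ = ≡.cong (λ z → 1# + z) (⟦numeral⟧ n ρ)

  Below : ℕ → Exp DVar → Set
  Below n (con c)        = ⊤
  Below n (var (inj₁ a)) = ⊤
  Below n (var (inj₂ i)) = i ℕ.< n
  Below n (a :+ b)       = Below n a × Below n b
  Below n (a :* b)       = Below n a × Below n b
  Below n (:- a)         = Below n a

  Below-mono : ∀ {m n} → m ℕ.≤ n → ∀ e → Below m e → Below n e
  Below-mono le (con c)        p       = tt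
  Below-mono le (var (inj₁ a)) p       = tt
  Below-mono le (var (inj₂ i)) p       = ℕ.≤-trans p le
  Below-mono le (a :+ b)       (p , q) = Below-mono le a p , Below-mono le b q
  Below-mono le (a :* b)       (p , q) = Below-mono le a p , Below-mono le b q
  Below-mono le (:- a)         p       = Below-mono le a p

  Below-derive : ∀ a {n} e → Below n e → Below (suc n) (derive (total-δ a) e)
  Below-derive a (con c)        p       = tt
  Below-derive a (var (inj₁ b)) p       = tt
  Below-derive a (var (inj₂ i)) p       = s≤s p
  Below-derive a (e :+ f)       (p , q) = Below-derive a e p , Below-derive a f q
  Below-derive a (e :* f)       (p , q) =
    (Below-derive a e p , Below-mono (ℕ.n≤1+n _) f q) , (Below-mono (ℕ.n≤1+n _) e p , Below-derive a f q)
  Below-derive a (:- e)         p       = Below-derive a e p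

  Below-numeral : ∀ {n} m → Below n (numeral m)
  Below-numeral zero    = tt
  Below-numeral (suc m) = tt , Below-numeral m

  embed : Exp Axis → Exp DVar
  embed = mapVar inj₁

  Below-embed : ∀ {n} e → Below n (embed e)
  Below-embed (con c)  = tt
  Below-embed (var v)  = tt
  Below-embed (a :+ b) = Below-embed a , Below-embed b
  Below-embed (a :* b) = Below-embed a , Below-embed b
  Below-embed (:- a)   = Below-embed a

  module ODE (a : Axis) (z W f₀ : Exp DVar) where
    middle last : ℕ → Exp DVar → Exp DVar
    middle n f = (numeral n :+ numeral n) :* (z :* 𝔻 a W :* f)
    last m f = numeral m :* (𝔻 a z :* W :* f)

    opaque
      -- Opaque because `f` occurs three times and the construction is nested five times; the proofs
      -- open one layer at a time.
      stepE : ℕ → ℕ → Exp DVar → Exp DVar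
      stepE n m f = z :* W :* 𝔻 a f :- middle n f :- last m f

    -- Each step raises the order by one and multiplies the derivative in the highest jet by
    -- `z :* W`. Starting from `f₀` of order 1, five steps reach order 6 with slope (z W)^5 times
    -- the partial derivative of `f₀` in the first-order jet.
    f₁ f₂ f₃ f₄ odeE leading : Exp DVar
    f₁ = stepE 0 4 f₀
    f₂ = stepE 1 3 f₁
    f₃ = stepE 2 2 f₂
    f₄ = stepE 3 1 f₃
    odeE = stepE 4 0 f₄
    leading = z :* W :* (z :* W :* (z :* W :* (z :* W :* (z :* W :* jet-partial 1 f₀))))

  module TopDerivative (A : ℚ-Algebra) (a : Axis) where
    open ℚ-Algebra A

    -- The equation odeE is affine in the derivative of order 6, with coefficient leading: if leading is nonzero
    -- at a point, then odeE is nonzero there or after adding 1 to that derivative.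
    bump : ℕ → (DVar → Carrier) → DVar → Carrier
    bump n ρ (inj₁ b) = ρ (inj₁ b)
    bump n ρ (inj₂ i) = if i ℕ.≡ᵇ n then ρ (inj₂ i) + 1# else ρ (inj₂ i)

    private
      <⇒≢ᵇ : ∀ {i n} → i ℕ.< n → (i ℕ.≡ᵇ n) ≡ false
      <⇒≢ᵇ {i} {n} i<n with i ℕ.≡ᵇ n in eq
      ... | false = ≡.refl
      ... | true  = ⊥-elim (ℕ.<-irrefl (≡ᵇ-sound i n eq) i<n)

    Below-bump : ∀ n ρ e → Below n e → ⟦ e ⟧ (bump n ρ) ≡ ⟦ e ⟧ ρ
    Below-bump n ρ (con c)        p       = ≡.refl
    Below-bump n ρ (var (inj₁ b)) p       = ≡.refl
    Below-bump n ρ (var (inj₂ i)) p       = ≡.cong (λ b → if b then ρ (inj₂ i) + 1# else ρ (inj₂ i)) (<⇒≢ᵇ p)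
    Below-bump n ρ (e :+ f)       (p , q) = ≡.cong₂ _+_ (Below-bump n ρ e p) (Below-bump n ρ f q)
    Below-bump n ρ (e :* f)       (p , q) = ≡.cong₂ _*_ (Below-bump n ρ e p) (Below-bump n ρ f q)
    Below-bump n ρ (:- e)         p       = ≡.cong -_ (Below-bump n ρ e p)

    -- A total derivative is affine in the newly created jet, whatever the degree of `e`, and its
    -- slope is the partial derivative of `e` in the jet one order lower.
    𝔻-bump : ∀ n ρ e → Below (suc n) e → ⟦ 𝔻 a e ⟧ (bump (suc n) ρ) ≈ ⟦ 𝔻 a e ⟧ ρ + ⟦ jet-partial n e ⟧ ρ
    𝔻-bump n ρ (con c)        p       = sym (+-identityʳ 0#)
    𝔻-bump n ρ (var (inj₁ b)) p       = sym (+-identityʳ _)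
    𝔻-bump n ρ (var (inj₂ i)) p with i ℕ.≡ᵇ n
    ... | true  = refl
    ... | false = sym (+-identityʳ _)
    𝔻-bump n ρ (e :+ f)       (p , q) = trans (+-cong (𝔻-bump n ρ e p) (𝔻-bump n ρ f q))
      (ring! 4 (λ a b c d → (a :+ b) :+ (c :+ d) ≔ (a :+ c) :+ (b :+ d)) ≡.refl
        (⟦ 𝔻 a e ⟧ ρ) (⟦ jet-partial n e ⟧ ρ) (⟦ 𝔻 a f ⟧ ρ) (⟦ jet-partial n f ⟧ ρ))
    𝔻-bump n ρ (e :* f)       (p , q) = trans
      (+-cong (*-cong (𝔻-bump n ρ e p) (reflexive (Below-bump (suc n) ρ f q))) (*-cong (reflexive (Below-bump (suc n) ρ e p)) (𝔻-bump n ρ f q)))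
      (ring! 6 (λ e f a b c d → (a :+ b) :* f :+ e :* (c :+ d) ≔ (a :* f :+ e :* c) :+ (b :* f :+ e :* d)) ≡.refl
        (⟦ e ⟧ ρ) (⟦ f ⟧ ρ) (⟦ 𝔻 a e ⟧ ρ) (⟦ jet-partial n e ⟧ ρ) (⟦ 𝔻 a f ⟧ ρ) (⟦ jet-partial n f ⟧ ρ))
    𝔻-bump n ρ (:- e)         p       = trans (-‿cong (𝔻-bump n ρ e p))
      (ring! 2 (λ a b → :- (a :+ b) ≔ :- a :+ :- b) ≡.refl (⟦ 𝔻 a e ⟧ ρ) (⟦ jet-partial n e ⟧ ρ))

    module _ (ρ : DVar → Carrier) where
      jet-partial-Below : ∀ n e → Below n e → ⟦ jet-partial n e ⟧ ρ ≈ 0#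
      jet-partial-Below n (con c)        p       = refl
      jet-partial-Below n (var (inj₁ b)) p       = refl
      jet-partial-Below n (var (inj₂ i)) p       = reflexive (≡.cong (λ b → ⟦ if b then 1ℤ else 0ℤ ⟧ℤ) (<⇒≢ᵇ p))
      jet-partial-Below n (e :+ f)       (p , q) = trans (+-cong (jet-partial-Below n e p) (jet-partial-Below n f q)) (+-identityˡ 0#)
      jet-partial-Below n (e :* f)       (p , q) = trans (+-cong (trans (*-congʳ (jet-partial-Below n e p)) (zeroˡ _))
        (trans (*-congˡ (jet-partial-Below n f q)) (zeroʳ _))) (+-identityˡ 0#)
      jet-partial-Below n (:- e)         p       = trans (-‿cong (jet-partial-Below n e p)) -0#≈0#

      -- The commutator of the partial derivative in jet n+1 with the total derivative is the
      -- partial derivative in jet n; the other term vanishes because `e` has order at most n.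
      jet-partial-𝔻 : ∀ n e → Below (suc n) e → ⟦ jet-partial (suc n) (𝔻 a e) ⟧ ρ ≈ ⟦ jet-partial n e ⟧ ρ
      jet-partial-𝔻 n (con c)        p       = refl
      jet-partial-𝔻 n (var (inj₁ b)) p       = refl
      jet-partial-𝔻 n (var (inj₂ i)) p       = refl
      jet-partial-𝔻 n (e :+ f)       (p , q) = +-cong (jet-partial-𝔻 n e p) (jet-partial-𝔻 n f q)
      jet-partial-𝔻 n (e :* f)       (p , q) = trans
        (+-cong (+-cong (*-congʳ (jet-partial-𝔻 n e p)) (*-congˡ (jet-partial-Below (suc n) f q)))
                (+-cong (*-congʳ (jet-partial-Below (suc n) e p)) (*-congˡ (jet-partial-𝔻 n f q))))
        (ring! 6 (λ pe f de df e pf → (pe :* f :+ de :* con 0ℤ) :+ (con 0ℤ :* df :+ e :* pf) ≔ pe :* f :+ e :* pf) ≡.refl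
          (⟦ jet-partial n e ⟧ ρ) (⟦ f ⟧ ρ) (⟦ 𝔻 a e ⟧ ρ) (⟦ 𝔻 a f ⟧ ρ) (⟦ e ⟧ ρ) (⟦ jet-partial n f ⟧ ρ))
      jet-partial-𝔻 n (:- e)         p       = -‿cong (jet-partial-𝔻 n e p)

    module Bumped (z W f₀ : Exp DVar) where
      open ODE a z W f₀

      module _ (zB : Below 0 z) (WB : Below 2 W) where
        private
          zBn : ∀ n → Below n z
          zBn n = Below-mono z≤n z zB

          WBn : ∀ {n} → 2 ℕ.≤ n → Below n W
          WBn le = Below-mono le W WB

          𝔻WBn : ∀ {n} → 3 ℕ.≤ n → Below n (𝔻 a W)
          𝔻WBn le = Below-mono le (𝔻 a W) (Below-derive a W WB)

          𝔻zBn : ∀ {n} → 1 ℕ.≤ n → Below n (𝔻 a z)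
          𝔻zBn le = Below-mono le (𝔻 a z) (Below-derive a z zB)

          middle-Below : ∀ {k} n f → 3 ℕ.≤ k → Below k f → Below k (middle n f)
          middle-Below n f le p = (Below-numeral n , Below-numeral n) , ((zBn _ , 𝔻WBn le) , p)

          last-Below : ∀ {k} m f → 2 ℕ.≤ k → Below k f → Below k (last m f)
          last-Below m f le p = Below-numeral m , ((𝔻zBn (ℕ.≤-trans (s≤s z≤n) le) , WBn le) , p)

        opaque
          unfolding stepE

          step-Below : ∀ k n m f → 2 ℕ.≤ k → Below k f → Below (suc k) (stepE n m f)
          step-Below k n m f le p =
            (((zBn _ , WBn (ℕ.m≤n⇒m≤1+n le)) , Below-derive a f p)
              , middle-Below n f (s≤s le) (Below-mono (ℕ.n≤1+n k) f p))
              , last-Below m f (ℕ.m≤n⇒m≤1+n le) (Below-mono (ℕ.n≤1+n k) f p)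

          step-partial : ∀ ρ k n m f → 1 ℕ.≤ k → Below (suc k) f → ⟦ jet-partial (suc k) (middle n f) ⟧ ρ ≈ 0# →
            ⟦ jet-partial (suc k) (stepE n m f) ⟧ ρ ≈ ⟦ z :* W ⟧ ρ * ⟦ jet-partial k f ⟧ ρ
          step-partial ρ k n m f le p mid = trans
            (+-cong (+-cong (+-cong (*-congʳ (jet-partial-Below ρ (suc k) (z :* W) (zBn _ , WBn (s≤s le))))
                                    (*-congˡ (jet-partial-𝔻 ρ k f p)))
                            (-‿cong mid))
                    (-‿cong (jet-partial-Below ρ (suc k) (last m f) (last-Below m f (s≤s le) p))))
            (ring! 3 (λ w d q → con 0ℤ :* d :+ w :* q :+ :- con 0ℤ :+ :- con 0ℤ ≔ w :* q) ≡.refl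
              (⟦ z :* W ⟧ ρ) (⟦ 𝔻 a f ⟧ ρ) (⟦ jet-partial k f ⟧ ρ))

          step-bump : ∀ ρ k n m f → 2 ℕ.≤ k → Below (suc k) f →
            ⟦ stepE n m f ⟧ (bump (suc k) ρ) ≈ ⟦ stepE n m f ⟧ ρ + ⟦ z :* W ⟧ ρ * ⟦ jet-partial k f ⟧ ρ
          step-bump ρ k n m f le p = trans
            (+-cong (+-cong (*-cong (reflexive (Below-bump (suc k) ρ (z :* W) (zBn _ , WBn (ℕ.m≤n⇒m≤1+n le)))) (𝔻-bump k ρ f p))
                            (-‿cong (reflexive (Below-bump (suc k) ρ (middle n f) (middle-Below n f (s≤s le) p)))))
                    (-‿cong (reflexive (Below-bump (suc k) ρ (last m f) (last-Below m f (ℕ.m≤n⇒m≤1+n le) p)))))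
            (ring! 5 (λ w d q m l → w :* (d :+ q) :+ :- m :+ :- l ≔ w :* d :+ :- m :+ :- l :+ w :* q) ≡.refl
              (⟦ z :* W ⟧ ρ) (⟦ 𝔻 a f ⟧ ρ) (⟦ jet-partial k f ⟧ ρ) (⟦ middle n f ⟧ ρ) (⟦ last m f ⟧ ρ))

        private
          -- `W` has order 1, so `𝔻 a W` has order 2, as high as the derivative of `f₀`, and could
          -- alter the slope of the first step. Its multiplicity there is 0. In the later steps `f`
          -- has higher order and `mid₊` suffices.
          mid₀ : ∀ ρ f → ⟦ jet-partial 2 (middle 0 f) ⟧ ρ ≈ 0#
          mid₀ ρ f = ring! 2 (λ u v → (con 0ℤ :+ con 0ℤ) :* u :+ (con 0ℤ :+ con 0ℤ) :* v ≔ con 0ℤ) ≡.refl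
            (⟦ z :* 𝔻 a W :* f ⟧ ρ) (⟦ jet-partial 2 (z :* 𝔻 a W :* f) ⟧ ρ)

          mid₊ : ∀ ρ k n f → 2 ℕ.≤ k → Below (suc k) f → ⟦ jet-partial (suc k) (middle n f) ⟧ ρ ≈ 0#
          mid₊ ρ k n f le p = jet-partial-Below ρ (suc k) (middle n f) (middle-Below n f (s≤s le) p)

        module _ (fB : Below 2 f₀) where
          private
            B₁ : Below 3 f₁
            B₁ = step-Below 2 0 4 f₀ ℕ.≤-refl fB
            B₂ : Below 4 f₂
            B₂ = step-Below 3 1 3 f₁ (s≤s (s≤s z≤n)) B₁
            B₃ : Below 5 f₃
            B₃ = step-Below 4 2 2 f₂ (s≤s (s≤s z≤n)) B₂
            B₄ : Below 6 f₄
            B₄ = step-Below 5 3 1 f₃ (s≤s (s≤s z≤n)) B₃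

          -- Only the outermost step feels the change of the sixth jet; its slope is then traced
          -- down through the inner steps to `f₀`, one factor `z :* W` at a time.
          ode-bump : ∀ ρ → ⟦ odeE ⟧ (bump 6 ρ) ≈ ⟦ odeE ⟧ ρ + ⟦ leading ⟧ ρ
          ode-bump ρ = trans (step-bump ρ 5 4 0 f₄ (s≤s (s≤s z≤n)) B₄)
            (+-congˡ (*-congˡ (trans (step-partial ρ 4 3 1 f₃ (s≤s z≤n) B₃ (mid₊ ρ 4 3 f₃ (s≤s (s≤s z≤n)) B₃))
              (*-congˡ (trans (step-partial ρ 3 2 2 f₂ (s≤s z≤n) B₂ (mid₊ ρ 3 2 f₂ (s≤s (s≤s z≤n)) B₂))
                (*-congˡ (trans (step-partial ρ 2 1 3 f₁ (s≤s z≤n) B₁ (mid₊ ρ 2 1 f₁ (s≤s (s≤s z≤n)) B₁))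
                  (*-congˡ (step-partial ρ 1 0 4 f₀ (s≤s z≤n) fB (mid₀ ρ f₀))))))))))

  module _ where
    open ℚ-Algebra ℚ-algebra

    -- Integer arithmetic on closed values reduces without normalising fractions, so that a nonzero
    -- value is certified by an absurd pattern.
    evalℤ : ∀ {V : Set} → Exp V → (V → ℤ) → ℤ
    evalℤ (con c)  ρ = c
    evalℤ (var v)  ρ = ρ v
    evalℤ (a :+ b) ρ = evalℤ a ρ ℤ.+ evalℤ b ρ
    evalℤ (a :* b) ρ = evalℤ a ρ ℤ.* evalℤ b ρ
    evalℤ (:- a)   ρ = ℤ.- evalℤ a ρ

    evalℤ-sound : ∀ {V : Set} (e : Exp V) ρ → ⟦ e ⟧ (λ v → fromℤ (ρ v)) ≡ fromℤ (evalℤ e ρ)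
    evalℤ-sound (con c)  ρ = ⟦⟧ℤ-ι c
    evalℤ-sound (var v)  ρ = ≡.refl
    evalℤ-sound (a :+ b) ρ = ≡.trans (≡.cong₂ _+_ (evalℤ-sound a ρ) (evalℤ-sound b ρ)) (≡.sym (fromℤ-+ (evalℤ a ρ) (evalℤ b ρ)))
    evalℤ-sound (a :* b) ρ = ≡.trans (≡.cong₂ _*_ (evalℤ-sound a ρ) (evalℤ-sound b ρ)) (≡.sym (fromℤ-* (evalℤ a ρ) (evalℤ b ρ)))
    evalℤ-sound (:- a)   ρ = ≡.trans (≡.cong -_ (evalℤ-sound a ρ)) (≡.sym (fromℤ-neg (evalℤ a ρ)))

  axisOf : Var → Axis
  axisOf varX = x
  axisOf varY = y

  module _ where
    open ℚ-Algebra FPS-algebra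
    open Derivations FPS-algebra
    open Forms FPS-algebra
    open Invariants FPS-algebra using (Bivariate)
    open Bivariate bivariate

    ∂-derivation : ∀ v → Derivation (∂ v)
    ∂-derivation varX = X.∂-der
    ∂-derivation varY = Y.∂-der

    ∂-axes : ∀ v {W : Set} (ρ : W → FPS) a → ∂ v (axes a) ≈ ⟦ δ-axis (axisOf v) a ⟧ ρ
    ∂-axes varX ρ x = X.∂-v
    ∂-axes varX ρ y = ∂x-y
    ∂-axes varX ρ t i j k = ℚ.*-zeroʳ (fromℤ (+ suc i))
    ∂-axes varY ρ x = ∂y-x
    ∂-axes varY ρ y = Y.∂-v
    ∂-axes varY ρ t zero    j k = ℚ.*-zeroʳ (fromℤ (+ suc j))
    ∂-axes varY ρ t (suc i) j k = ℚ.*-zeroʳ (fromℤ (+ suc j))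

    partial-sound : ∀ v e → ∂ v (⟦ e ⟧ axes) ≈ ⟦ partial (axisOf v) e ⟧ axes
    partial-sound v = derive-sound FPS-algebra (∂-derivation v) axes (δ-axis (axisOf v)) (∂-axes v axes)

    module _ (v : Var) (F : FPS) where
      𝔻-sound : ∀ e → ∂ v (⟦ e ⟧ (jet v F)) ≈ ⟦ 𝔻 (axisOf v) e ⟧ (jet v F)
      𝔻-sound = derive-sound FPS-algebra (∂-derivation v) (jet v F) (total-δ (axisOf v)) λ
        { (inj₁ a) → ∂-axes v (jet v F) a ; (inj₂ i) → refl {∂ v (∂^ v i F)} }

      module _ (z W f₀ : Exp DVar) where
        open ODE (axisOf v) z W f₀
        open Wronskian (∂-derivation v) (⟦ z ⟧ (jet v F)) using (step; step-cong; ode)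

        private
          w : FPS
          w = ⟦ W ⟧ (jet v F)

          opaque
            unfolding stepE

            stepE-eval : ∀ n m f ρ → ⟦ stepE n m f ⟧ ρ ≡ ⟦ z :* W :* 𝔻 (axisOf v) f :- (numeral n :+ numeral n) :* (z :* 𝔻 (axisOf v) W :* f) :- numeral m :* (𝔻 (axisOf v) z :* W :* f) ⟧ ρ
            stepE-eval n m f ρ = ≡.refl

          step-sound : ∀ n m f {G} → ⟦ f ⟧ (jet v F) ≈ G → ⟦ stepE n m f ⟧ (jet v F) ≈ step n m w G
          step-sound n m f {G} p = trans {⟦ stepE n m f ⟧ (jet v F)} {step n m w (⟦ f ⟧ (jet v F))} {step n m w G}
            (trans {⟦ stepE n m f ⟧ (jet v F)} {R} {step n m w (⟦ f ⟧ (jet v F))} (reflexive (stepE-eval n m f (jet v F))) (+-cong (+-cong (*-congˡ (sym (𝔻-sound f)))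
                            (-‿cong (*-cong (reflexive (≡.cong₂ _+_ (⟦numeral⟧ FPS-algebra n (jet v F)) (⟦numeral⟧ FPS-algebra n (jet v F))))
                                            (*-congʳ (*-congˡ (sym (𝔻-sound W)))))))
                    (-‿cong (*-cong (reflexive (⟦numeral⟧ FPS-algebra m (jet v F))) (*-congʳ (*-congʳ (sym (𝔻-sound z))))))))
            (step-cong n m (refl {w}) p)
            where
            R : FPS
            R = ⟦ z :* W :* 𝔻 (axisOf v) f :- (numeral n :+ numeral n) :* (z :* 𝔻 (axisOf v) W :* f) :- numeral m :* (𝔻 (axisOf v) z :* W :* f) ⟧ (jet v F)

        ode-sound : ⟦ odeE ⟧ (jet v F) ≈ ode w (⟦ f₀ ⟧ (jet v F))
        ode-sound = step-sound 4 0 f₄ (step-sound 3 1 f₃ (step-sound 2 2 f₂ (step-sound 1 3 f₁ (step-sound 0 4 f₀ (refl {⟦ f₀ ⟧ (jet v F)})))))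

        ode-hyperalgebraic : Below 0 z → Below 2 W → Below 2 f₀ → ode w (⟦ f₀ ⟧ (jet v F)) ≈ 0# →
          (ρ : DVar → ℤ) → evalℤ leading ρ ≢ 0ℤ → Hyperalgebraic v F
        ode-hyperalgebraic zB WB fB zero-ode ρ nz = conclude (ℚA.⟦ odeE ⟧ ρℚ ℚ.≟ 0ℚ)
          where
          module Tℚ = TopDerivative ℚ-algebra (axisOf v)
          module ℚA = ℚ-Algebra ℚ-algebra
          ρℚ : DVar → ℚ
          ρℚ a = fromℤ (ρ a)
          vanishes : ⟦ odeE ⟧ (jet v F) ≈ 0#
          vanishes = trans {⟦ odeE ⟧ (jet v F)} {ode w (⟦ f₀ ⟧ (jet v F))} {0#} ode-sound zero-ode
          fromℤ-injective : ∀ i → fromℤ i ≡ 0ℚ → i ≡ 0ℤ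
          fromℤ-injective i p = ≡.trans (≡.sym (ℤ.*-identityʳ i)) (unwrap (ℚᵘ.≃-trans (ℚᵘ.≃-sym (ℚ.toℚᵘ-fromℚᵘ (ℚᵘ.mkℚᵘ i 0))) (ℚ.toℚᵘ-cong p)))
            where
            unwrap : ℚᵘ.mkℚᵘ i 0 ℚᵘ.≃ ℚᵘ.0ℚᵘ → i ℤ.* 1ℤ ≡ 0ℤ
            unwrap (ℚᵘ.*≡* e) = e
          bumped : ℚA.⟦ odeE ⟧ (Tℚ.bump 6 ρℚ) ≡ ℚA.⟦ odeE ⟧ ρℚ ℚ.+ ℚA.⟦ leading ⟧ ρℚ
          bumped = Tℚ.Bumped.ode-bump z W f₀ zB WB fB ρℚ
          -- The value of `odeE` itself is never computed. If it is 0 at the point, then raising the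
          -- sixth jet by 1 changes it to the value of `leading`, which is nonzero.
          conclude : Dec (ℚA.⟦ odeE ⟧ ρℚ ≡ 0ℚ) → Hyperalgebraic v F
          conclude (no  p) = hyperalgebraic v F odeE ρℚ vanishes p
          conclude (yes p) = hyperalgebraic v F odeE (Tℚ.bump 6 ρℚ) vanishes
            (λ q → nz (fromℤ-injective _ (≡.trans (≡.sym (evalℤ-sound leading ρ))
              (≡.trans (≡.sym (ℚ.+-identityˡ _)) (≡.trans (≡.cong (ℚ._+ ℚA.⟦ leading ⟧ ρℚ) (≡.sym p)) (≡.trans (≡.sym bumped) q))))))

open LeadingCoefficient

-- Hypotheses reduced to polynomial identities, for either choice of the coordinate with the simple
-- pole.

module Orientation where
  zeroAt : Axis → Exp Axis → Exp Axis
  zeroAt a (con c)  = con c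
  zeroAt a (var b)  = if sameᵇ a b then con 0ℤ else var b
  zeroAt a (e :+ f) = zeroAt a e :+ zeroAt a f
  zeroAt a (e :* f) = zeroAt a e :* zeroAt a f
  zeroAt a (:- e)   = :- zeroAt a e

  axisIndex : Axis → Fin 3
  axisIndex x = fzero
  axisIndex y = fsuc fzero
  axisIndex t = fsuc (fsuc fzero)

  infix 4 _≐_
  -- Equality of polynomials in x, y, t as a computation, so that each concrete identity is proved
  -- by `refl`.
  _≐_ : Exp Axis → Exp Axis → Set
  a ≐ b = nf (mapVar axisIndex (a :- b)) ≡ []

  triangularE : Exp Axis → ℕ → Exp Axis
  triangularE τ zero    = con 1ℤ
  triangularE τ (suc n) = triangularE τ n :* τ :^ suc n

  discE : Axis → Exp Axis → Exp Axis
  discE a K = partial a K :* partial a K :- (partial a (partial a K) :+ partial a (partial a K)) :* K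

  power : Axis → ℕ → ℕ → Exp Axis
  power a p i = var a :^ p :* (con 1ℤ :+ var a) :^ i

  module DifferentialEquation (v : Axis) (K e m ζ T Δ : Exp Axis) where
    -- At the jet of Q, `u` is K h, which equals ζy α - ζx β. Taking the Wronskian with `ζ` removes
    -- the invariant in the other coordinate, so `W` is the Wronskian of the wanted invariant times
    -- a constant, and `f₀` is the side to be eliminated, written in Q alone.
    u W f₀ : Exp DVar
    u = embed K :* (embed e :+ embed m :* var (inj₂ 0))
    W = embed ζ :* derive (total-δ v) u :- derive (total-δ v) (embed ζ) :* u
    f₀ = embed T :* (embed Δ :* (W :* W))

    u-Below : Below 1 u
    u-Below = Below-embed K , (Below-embed e , (Below-embed m , s≤s z≤n))

    W-Below : Below 2 W
    W-Below = (Below-embed ζ , Below-derive v u u-Below)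
      , (Below-mono (s≤s z≤n) (derive (total-δ v) (embed ζ)) (Below-derive v {0} (embed ζ) (Below-embed ζ)) , Below-mono (s≤s z≤n) u u-Below)

    f₀-Below : Below 2 f₀
    f₀-Below = Below-embed T , (Below-embed Δ , (W-Below , W-Below))

    leading : Exp DVar
    leading = ODE.leading v (embed ζ) W f₀

  private
    sign : ℕ → ℚ
    sign zero    = 1ℚ
    sign (suc n) = ℚ.- sign n

  -- The geometric series for 1/(1 + x) and 1/(1 + y): powers of 1 + x and 1 + y occur in the
  -- denominators of the decouplings and in the restrictions of the kernel.
  inverse-x inverse-y : FPS
  inverse-x i zero    zero    = sign i
  inverse-x i zero    (suc k) = 0ℚ
  inverse-x i (suc j) k       = 0ℚ
  inverse-y zero    j zero    = sign j
  inverse-y zero    j (suc k) = 0ℚ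
  inverse-y (suc i) j k       = 0ℚ

  module A = ℚ-Algebra FPS-algebra
  open A hiding (refl; sym; trans)
  open Derivations FPS-algebra
  open Forms FPS-algebra
  open Invariants FPS-algebra

  private
    infixr 5 _▹_
    _▹_ : ∀ {F G H : FPS} → F ≈ G → G ≈ H → F ≈ H
    (p ▹ q) i j k = ≡.trans (p i j k) (q i j k)

  inverse-x-law : (1# + 𝕩) * inverse-x ≈ 1#
  inverse-x-law i j k = ≡.trans (ring! 2 (λ x g → (con 1ℤ :+ x) :* g ≔ g :+ x :* g) ≡.refl 𝕩 inverse-x i j k) (law i j k)
    where
    law : ∀ i j k → inverse-x i j k ℚ.+ (𝕩 * inverse-x) i j k ≡ 1# i j k
    law zero    zero    zero    = ≡.cong (1ℚ ℚ.+_) (𝕩*-zero inverse-x 0 0)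
    law zero    zero    (suc k) = ≡.cong (0ℚ ℚ.+_) (𝕩*-zero inverse-x 0 (suc k))
    law zero    (suc j) k       = ≡.cong (0ℚ ℚ.+_) (𝕩*-zero inverse-x (suc j) k)
    law (suc i) zero    zero    = ≡.trans (≡.cong (ℚ.- sign i ℚ.+_) (𝕩*-suc inverse-x i 0 0)) (ℚ.+-inverseˡ (sign i))
    law (suc i) zero    (suc k) = ≡.cong (0ℚ ℚ.+_) (𝕩*-suc inverse-x i 0 (suc k))
    law (suc i) (suc j) k       = ≡.cong (0ℚ ℚ.+_) (𝕩*-suc inverse-x i (suc j) k)

  inverse-y-law : (1# + 𝕪) * inverse-y ≈ 1#
  inverse-y-law i j k = ≡.trans (ring! 2 (λ y g → (con 1ℤ :+ y) :* g ≔ g :+ y :* g) ≡.refl 𝕪 inverse-y i j k) (law i j k)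
    where
    law : ∀ i j k → inverse-y i j k ℚ.+ (𝕪 * inverse-y) i j k ≡ 1# i j k
    law zero    zero    zero    = ≡.cong (1ℚ ℚ.+_) (𝕪*-zero inverse-y 0 0)
    law zero    zero    (suc k) = ≡.cong (0ℚ ℚ.+_) (𝕪*-zero inverse-y 0 (suc k))
    law zero    (suc j) zero    = ≡.trans (≡.cong (ℚ.- sign j ℚ.+_) (𝕪*-suc inverse-y 0 j 0)) (ℚ.+-inverseˡ (sign j))
    law zero    (suc j) (suc k) = ≡.cong (0ℚ ℚ.+_) (𝕪*-suc inverse-y 0 j (suc k))
    law (suc i) zero    k       = ≡.cong (0ℚ ℚ.+_) (𝕪*-zero inverse-y (suc i) k)
    law (suc i) (suc j) k       = ≡.cong (0ℚ ℚ.+_) (𝕪*-suc inverse-y (suc i) j k)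

  cancel-𝕥 : ∀ F → 𝕥 * F ≈ 0# → F ≈ 0#
  cancel-𝕥 F p i j k = ≡.trans (≡.sym (𝕥*-suc F i j k)) (p i j (suc k))

  ⟦⟧-ext : ∀ {V : Set} {ρ ρ′ : V → FPS} → (∀ v → ρ v ≡ ρ′ v) → ∀ e → ⟦ e ⟧ ρ ≡ ⟦ e ⟧ ρ′
  ⟦⟧-ext p (con c)  = ≡.refl
  ⟦⟧-ext p (var v)  = p v
  ⟦⟧-ext p (a :+ b) = ≡.cong₂ _+_ (⟦⟧-ext p a) (⟦⟧-ext p b)
  ⟦⟧-ext p (a :* b) = ≡.cong₂ _*_ (⟦⟧-ext p a) (⟦⟧-ext p b)
  ⟦⟧-ext p (:- a)   = ≡.cong -_ (⟦⟧-ext p a)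

  ≐-sound : ∀ a b → a ≐ b → ⟦ a ⟧ axes ≈ ⟦ b ⟧ axes
  ≐-sound a b p = A.reflexive (≡.sym (index-sound a)) ▹ nf-sound ρ (mapVar axisIndex a) (mapVar axisIndex b) p ▹ A.reflexive (index-sound b)
    where
    ρ : Fin 3 → FPS
    ρ = lookup (𝕩 ∷ 𝕪 ∷ 𝕥 ∷ [])
    index-sound : ∀ e → ⟦ mapVar axisIndex e ⟧ ρ ≡ ⟦ e ⟧ axes
    index-sound e = ≡.trans (Flatten.⟦mapVar⟧ FPS-algebra axisIndex e ρ) (⟦⟧-ext (λ { x → ≡.refl ; y → ≡.refl ; t → ≡.refl }) e)

  ⟦embed⟧ : ∀ v F e → ⟦ embed e ⟧ (jet v F) ≡ ⟦ e ⟧ axes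
  ⟦embed⟧ v F e = Flatten.⟦mapVar⟧ FPS-algebra inj₁ e (jet v F)

  ⟦⟧ℤ-const : ∀ {d} → Derivation d → ∀ c → d ⟦ c ⟧ℤ ≈ 0#
  ⟦⟧ℤ-const dd c = Derivation.d-cong dd (⟦⟧ℤ-ι c) ▹ Derivation.d-ι dd (fromℤ c)

  -- The two coordinates enter symmetrically except that the invariant in the first one has a simple pole.
  module Oriented (B : Bivariate) where
    open Bivariate B

    module Axes (ax ay : Axis)
      (axis-x : axes ax ≡ X.v) (axis-y : axes ay ≡ Y.v)
      (∂x-sound : ∀ e → X.δ (⟦ e ⟧ axes) ≈ ⟦ partial ax e ⟧ axes) (∂y-sound : ∀ e → Y.δ (⟦ e ⟧ axes) ≈ ⟦ partial ay e ⟧ axes)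
      (σx-axes : ∀ b → X.σ (axes b) ≈ ⟦ zeroAt ax (var b) ⟧ axes) (σy-axes : ∀ b → Y.σ (axes b) ≈ ⟦ zeroAt ay (var b) ⟧ axes)
      (ηx ηy : FPS) (ηx-law : (1# + X.v) * ηx ≈ 1#) (ηy-law : (1# + Y.v) * ηy ≈ 1#)
      where

      σ-sound : (C : Coordinate) (a : Axis) → (∀ b → Coordinate.σ C (axes b) ≈ ⟦ zeroAt a (var b) ⟧ axes) →
        ∀ e → Coordinate.σ C (⟦ e ⟧ axes) ≈ ⟦ zeroAt a e ⟧ axes
      σ-sound C a p (con c)  = A.sym (∂≈0⇒σ _ (⟦⟧ℤ-const ∂-der c))
        where open Coordinate C
      σ-sound C a p (var b)  = p b
      σ-sound C a p (e :+ f) = Coordinate.σ-+ C _ _ ▹ +-cong (σ-sound C a p e) (σ-sound C a p f)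
      σ-sound C a p (e :* f) = Coordinate.σ-* C _ _ ▹ *-cong (σ-sound C a p e) (σ-sound C a p f)
      σ-sound C a p (:- e)   = Coordinate.σ-neg C _ ▹ -‿cong (σ-sound C a p e)

      inverse-power : ∀ {u ū} n → u * ū ≈ 1# → u ^ n * ū ^ n ≈ 1#
      inverse-power zero    p = *-identityˡ 1#
      inverse-power {u} {ū} (suc n) p = ring! 4 (λ u v a b → u :* a :* (v :* b) ≔ u :* v :* (a :* b)) ≡.refl u ū (u ^ n) (ū ^ n)
        ▹ *-cong p (inverse-power n p) ▹ *-identityˡ 1#

      inverse-const : ∀ {d u ū} → Derivation d → d u ≈ 0# → u * ū ≈ 1# → d ū ≈ 0#
      inverse-const {d} {u} {ū} dd du p =
        A.sym (*-identityˡ (d ū)) ▹ *-congʳ (A.sym p)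
        ▹ ring! 3 (λ u v w → u :* v :* w ≔ v :* (con 0ℤ :* v :+ u :* w)) ≡.refl u ū (d ū)
        ▹ *-congˡ (+-congʳ (*-congʳ (A.sym du)) ▹ A.sym (Derivation.d-* dd u ū) ▹ Derivation.d-cong dd p ▹ Derivation.d-1 dd)
        ▹ zeroʳ ū

      -- Multiplication by t and by w is injective, and 1 + w is a unit. Every restriction of a
      -- kernel to an axis that is needed below has this shape.
      monomial-regular : (w η M : FPS) → (∀ n {F} → w ^ n * F ≈ 0# → F ≈ 0#) → (1# + w) * η ≈ 1# →
        ∀ b c {k} → k ≈ - (𝕥 * (w ^ b * (1# + w) ^ c)) → k * M ≈ 0# → M ≈ 0#
      monomial-regular w η M cancel law b c {k} k≈ p =
        A.sym (*-identityˡ M) ▹ *-congʳ (A.sym (inverse-power c law))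
        ▹ ring! 3 (λ u v m → u :* v :* m ≔ v :* (u :* m)) ≡.refl ((1# + w) ^ c) (η ^ c) M
        ▹ *-congˡ (cancel b (cancel-𝕥 _ (ring! 4 (λ t w u m → t :* (w :* (u :* m)) ≔ :- (:- (t :* (w :* u)) :* m)) ≡.refl 𝕥 (w ^ b) ((1# + w) ^ c) M
            ▹ -‿cong (*-congʳ (A.sym k≈) ▹ p) ▹ -0#≈0#)))
        ▹ zeroʳ (η ^ c)

      module _ (K : Exp Axis) (f : Exp Axis) (p i q j b c : ℕ) (h α β G : FPS) (p≡1 : p ≡ 1)
        (∂x³K : partial ax (partial ax (partial ax K)) ≐ con 0ℤ) (∂y³K : partial ay (partial ay (partial ay K)) ≐ con 0ℤ)
        (K-x : zeroAt ax K ≐ :- (var t :* (var ay :^ b :* (con 1ℤ :+ var ay) :^ c)))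
        (origin : q ≡ 0 ⊎ (Σ (ℕ × ℕ) λ (b′ , c′) → zeroAt ay K ≐ :- (var t :* (var ax :^ b′ :* (con 1ℤ :+ var ax) :^ c′)))
                           × zeroAt ax (zeroAt ay K) ≐ con 0ℤ)
        (unique : ∀ P R M → Y.δ P ≈ 0# → X.δ R ≈ 0# → P - R ≈ ⟦ K ⟧ axes * M → M ≈ 0#)
        (α₀ : Y.δ α ≈ 0#) (β₀ : X.δ β ≈ 0#) (α≈ : α ≈ ⟦ f ⟧ axes + X.v * G)
        (invariants : ⟦ K ⟧ axes * h ≈ ⟦ power ay q j ⟧ axes * α - ⟦ power ax p i ⟧ axes * β)
        where
        private
          Kf ζx ζy : FPS
          Kf = ⟦ K ⟧ axes
          ζx = ⟦ power ax p i ⟧ axes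
          ζy = ⟦ power ay q j ⟧ axes

          third : ∀ {d} → Derivation d → (a : Axis) → (∀ e → d (⟦ e ⟧ axes) ≈ ⟦ partial a e ⟧ axes) →
            partial a (partial a (partial a K)) ≐ con 0ℤ → d (d (d Kf)) ≈ 0#
          third dd a sound p = d-cong (d-cong (sound K) ▹ sound (partial a K)) ▹ sound (partial a (partial a K))
            ▹ ≐-sound (partial a (partial a (partial a K))) (con 0ℤ) p
            where open Derivation dd

          unit-pow : ∀ w n → ⟦ (con 1ℤ :+ var w) :^ n ⟧ axes ≡ (1# + axes w) ^ n
          unit-pow w zero    = ≡.refl
          unit-pow w (suc n) = ≡.cong ((1# + axes w) *_) (unit-pow w n)

          var-pow : ∀ w n → ⟦ var w :^ n ⟧ axes ≡ axes w ^ n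
          var-pow w zero    = ≡.refl
          var-pow w (suc n) = ≡.cong (axes w *_) (var-pow w n)

          ζx≈ : ζx ≈ X.v * (1# + X.v) ^ i
          ζx≈ = A.reflexive (≡.cong (λ p → ⟦ power ax p i ⟧ axes) p≡1) ▹ A.reflexive (≡.cong₂ (λ a b → a * 1# * b) axis-x (≡.trans (unit-pow ax i) (≡.cong (λ a → (1# + a) ^ i) axis-x)))
            ▹ *-congʳ (*-identityʳ X.v)

          ζy≈ : ζy ≈ Y.v ^ q * (1# + Y.v) ^ j
          ζy≈ = A.reflexive (≡.cong₂ _*_ (≡.trans (var-pow ay q) (≡.cong (_^ q) axis-y)) (≡.trans (unit-pow ay j) (≡.cong (λ a → (1# + a) ^ j) axis-y)))

          restricted : ∀ a w b c → zeroAt a K ≐ :- (var t :* (var w :^ b :* (con 1ℤ :+ var w) :^ c)) →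
            ⟦ zeroAt a K ⟧ axes ≈ - (𝕥 * (axes w ^ b * (1# + axes w) ^ c))
          restricted a w b c p = ≐-sound (zeroAt a K) (:- (var t :* (var w :^ b :* (con 1ℤ :+ var w) :^ c))) p
            ▹ A.reflexive (≡.cong₂ (λ u v → - (𝕥 * (u * v))) (var-pow w b) (unit-pow w c))

          regular-x : X.Regular Kf
          regular-x M p = monomial-regular Y.v ηy M Y.cancel-^ ηy-law b c
            (σ-sound X ax σx-axes K ▹ restricted ax ay b c K-x ▹ A.reflexive (≡.cong (λ w → - (𝕥 * (w ^ b * (1# + w) ^ c))) axis-y)) p

          origin′ : q ≡ 0 ⊎ (Y.Regular Kf × X.σ (Y.σ Kf) ≈ 0#)
          origin′ = Sum.map (λ p → p) (λ { (((b′ , c′) , p) , o) →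
              (λ M p′ → monomial-regular X.v ηx M X.cancel-^ ηx-law b′ c′
                (σ-sound Y ay σy-axes K ▹ restricted ay ax b′ c′ p ▹ A.reflexive (≡.cong (λ w → - (𝕥 * (w ^ b′ * (1# + w) ^ c′))) axis-x)) p′)
            , (X.σ-cong (σ-sound Y ay σy-axes K) ▹ σ-sound X ax σx-axes (zeroAt ay K) ▹ ≐-sound (zeroAt ax (zeroAt ay K)) (con 0ℤ) o) }) origin

          1+v₀ : ∀ {d v} (dd : Derivation d) → d v ≈ 0# → d (1# + v) ≈ 0#
          1+v₀ dd p = Derivation.d-+₀ dd (Derivation.d-1 dd) p

          ηx₀ : Y.δ ηx ≈ 0#
          ηx₀ = inverse-const Y.∂-der (1+v₀ Y.∂-der ∂y-x) ηx-law

          ηy₀ : X.δ ηy ≈ 0#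
          ηy₀ = inverse-const X.∂-der (1+v₀ X.∂-der ∂x-y) ηy-law

          ζx₀ : Y.δ ζx ≈ 0#
          ζx₀ = Y.d-cong ζx≈ ▹ Y.d-*₀ ∂y-x (Y.d-^₀ i (1+v₀ Y.∂-der ∂y-x))

          ζy₀ : X.δ ζy ≈ 0#
          ζy₀ = X.d-cong ζy≈ ▹ X.d-*₀ (X.d-^₀ q ∂x-y) (X.d-^₀ j (1+v₀ X.∂-der ∂x-y))

          module TI = Tutte.Pair B Kf h α β ζx ζy (third X.∂-der ax ∂x-sound ∂x³K) (third Y.∂-der ay ∂y-sound ∂y³K) α₀ ζx₀ β₀ ζy₀ invariants

          -- The unknown series enters `α` with a factor x, so the value of `α` at x = 0 is that of
          -- the explicit polynomial `f`. Hence the factor of the equation is a polynomial too, as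
          -- coefficients over the polynomial ring require.
          T≈ : triangular (X.σ α) 4 ≈ ⟦ triangularE (zeroAt ax f) 4 ⟧ axes
          T≈ = *-cong (*-cong (*-cong (*-congˡ {1#} (^-congˡ 1 τ≈)) (^-congˡ 2 τ≈)) (^-congˡ 3 τ≈)) (^-congˡ 4 τ≈)
            where
            τ≈ : X.σ α ≈ ⟦ zeroAt ax f ⟧ axes
            τ≈ = X.σ-cong α≈ ▹ X.σ-+ _ _ ▹ +-cong (σ-sound X ax σx-axes f) (X.σ-v* G) ▹ +-identityʳ _

        equations : Σ (ℕ → FPS) λ c → (∀ k → X.δ (c k) ≈ 0#) × (∀ k → Y.δ (c k) ≈ 0#) ×
          ⟦ triangularE (zeroAt ax f) 4 ⟧ axes * TI.Lx ≈ form 4 c α ζx × ⟦ triangularE (zeroAt ax f) 4 ⟧ axes * TI.Ly ≈ form 4 c β ζy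
        equations = proj₁ eqs , proj₁ (proj₂ eqs) , proj₁ (proj₂ (proj₂ eqs))
          , (*-congʳ (A.sym T≈) ▹ proj₁ (proj₂ (proj₂ (proj₂ eqs)))) , (*-congʳ (A.sym T≈) ▹ proj₂ (proj₂ (proj₂ (proj₂ eqs))))
          where
          eqs : Σ (ℕ → FPS) λ c → (∀ k → X.δ (c k) ≈ 0#) × (∀ k → Y.δ (c k) ≈ 0#) ×
            triangular (X.σ α) 4 * TI.Lx ≈ form 4 c α ζx × triangular (X.σ α) 4 * TI.Ly ≈ form 4 c β ζy
          eqs = TI.invariant-equation ((1# + X.v) ^ i) (ηx ^ i) ζx≈ (inverse-power i ηx-law) (Y.d-^₀ i ηx₀)
            ((1# + Y.v) ^ j) (ηy ^ j) q ζy≈ (inverse-power j ηy-law) (X.d-^₀ j ηy₀) unique regular-x origin′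

open Orientation

-- From a decoupling of x y to differential equations for Q.

module Decoupling where
  open A hiding (refl; sym; trans)
  open Derivations FPS-algebra
  open Forms FPS-algebra
  open Invariants FPS-algebra
  open Bivariate bivariate

  private
    infixr 5 _▹_
    _▹_ : ∀ {F G H : FPS} → F ≈ G → G ≈ H → F ≈ H
    (p ▹ q) i j k = ≡.trans (p i j k) (q i j k)

  opaque
    -- Opaque, so that passing `Nonvanishing` evidence around does not evaluate the large
    -- expression; it is evaluated only where the evidence is created.
    leadingValue : (v : Axis) (K e m ζ T Δ : Exp Axis) → (DVar → ℤ) → ℤ
    leadingValue v K e m ζ T Δ = evalℤ (DifferentialEquation.leading v K e m ζ T Δ)

    leadingValue-≡ : ∀ v K e m ζ T Δ ρ → leadingValue v K e m ζ T Δ ρ ≡ evalℤ (DifferentialEquation.leading v K e m ζ T Δ) ρ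
    leadingValue-≡ v K e m ζ T Δ ρ = ≡.refl

  record Nonvanishing (v : Axis) (K e m ζ T Δ : Exp Axis) : Set where
    constructor at
    field
      point   : DVar → ℤ
      value≢0 : leadingValue v K e m ζ T Δ point ≢ 0ℤ

  nonvanishing : ∀ v K e m ζ T Δ ρ → evalℤ (DifferentialEquation.leading v K e m ζ T Δ) ρ ≢ 0ℤ → Nonvanishing v K e m ζ T Δ
  nonvanishing v K e m ζ T Δ ρ nz = at ρ (λ p → nz (≡.trans (≡.sym (leadingValue-≡ v K e m ζ T Δ ρ)) p))

  module _ (v : Var) (F : FPS) (K e m ζ T Δ : Exp Axis) where
    open DifferentialEquation (axisOf v) K e m ζ T Δ
    open Wronskian (∂-derivation v) (⟦ ζ ⟧ axes)
    open Derivation (∂-derivation v)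

    -- `a` enters only through `U`, which is explicit in `F`. The constant `s` relating their
    -- Wronskians turns up squared and is absorbed into the coefficients of the form.
    invariant-hyperalgebraic : ∀ U a s (c : ℕ → FPS) → ⟦ K ⟧ axes * (⟦ e ⟧ axes + ⟦ m ⟧ axes * F) ≈ U → wr U ≈ s * wr a →
      ∂ v s ≈ 0# → (∀ k → ∂ v (c k) ≈ 0#) → ⟦ T ⟧ axes * (⟦ Δ ⟧ axes * (wr a * wr a)) ≈ form 4 c a (⟦ ζ ⟧ axes) →
      Nonvanishing (axisOf v) K e m ζ T Δ → Hyperalgebraic v F
    invariant-hyperalgebraic U a s c U≈ wr≈ s₀ c₀ eq (at ρ nz) =
      ode-hyperalgebraic v F (embed ζ) W f₀ (Below-embed ζ) W-Below f₀-Below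
        (≡.subst (λ z → Wronskian.ode (∂-derivation v) z w (⟦ f₀ ⟧ (jet v F)) ≈ 0#) (≡.sym (⟦embed⟧ v F ζ))
          (ode-form a s w s₀ w≈ (λ k → s * s * c k) (⟦ f₀ ⟧ (jet v F)) (λ k → d-*₀ (d-*₀ s₀ s₀) (c₀ k)) f₀≈)) ρ (λ p → nz (≡.trans (leadingValue-≡ (axisOf v) K e m ζ T Δ ρ) p))
      where
      w : FPS
      w = ⟦ W ⟧ (jet v F)
      u≈ : ⟦ u ⟧ (jet v F) ≈ U
      u≈ = A.reflexive (≡.cong₂ _*_ (⟦embed⟧ v F K) (≡.cong₂ (λ a b → a + b * F) (⟦embed⟧ v F e) (⟦embed⟧ v F m))) ▹ U≈
      w≈ : w ≈ s * wr a
      w≈ = +-cong (*-cong (A.reflexive (⟦embed⟧ v F ζ)) (A.sym (𝔻-sound v F u) ▹ d-cong u≈))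
                  (-‿cong (*-cong (A.sym (𝔻-sound v F (embed ζ)) ▹ d-cong (A.reflexive (⟦embed⟧ v F ζ))) u≈)) ▹ wr≈
      f₀≈ : ⟦ f₀ ⟧ (jet v F) ≈ form 4 (λ k → s * s * c k) a (⟦ ζ ⟧ axes)
      f₀≈ = *-cong (A.reflexive (⟦embed⟧ v F T)) (*-cong (A.reflexive (⟦embed⟧ v F Δ)) (*-cong w≈ w≈))
        ▹ ring! 4 (λ T D s w → T :* (D :* (s :* w :* (s :* w))) ≔ s :* s :* (T :* (D :* (w :* w)))) ≡.refl (⟦ T ⟧ axes) (⟦ Δ ⟧ axes) s (wr a)
        ▹ *-congˡ eq ▹ form-scale (s * s) 4 c a (⟦ ζ ⟧ axes)

  private
    σx-axes : ∀ b → X.σ (axes b) ≈ ⟦ zeroAt x (var b) ⟧ axes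
    σx-axes x = X.σ-v
    σx-axes y = A.sym (X.∂≈0⇒σ 𝕪 ∂x-y)
    σx-axes t = A.sym (X.∂≈0⇒σ 𝕥 (∂-axes varX axes t))

    σy-axes : ∀ b → Y.σ (axes b) ≈ ⟦ zeroAt y (var b) ⟧ axes
    σy-axes x = A.sym (Y.∂≈0⇒σ 𝕩 ∂y-x)
    σy-axes y = Y.σ-v
    σy-axes t = A.sym (Y.∂≈0⇒σ 𝕥 (∂-axes varY axes t))

    module OX = Oriented.Axes bivariate x y ≡.refl ≡.refl (partial-sound varX) (partial-sound varY) σx-axes σy-axes
      inverse-x inverse-y inverse-x-law inverse-y-law
    module OY = Oriented.Axes (swap bivariate) y x ≡.refl ≡.refl (partial-sound varY) (partial-sound varX) σy-axes σx-axes
      inverse-y inverse-x inverse-y-law inverse-x-law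

  -- With F = f / ζx, G = - g / ζy and m = t^s ζx ζy, the hypothesis decoupled says
  -- t^s x y = F + G modulo K.
  module Decoupled (E : Offsets) (s p i q j : ℕ) (e f g : Exp Axis) where
    K ζx ζy m : Exp Axis
    K  = kernel E
    ζx = power x p i
    ζy = power y q j
    m  = var t :^ s :* (ζx :* ζy)

    module Checked
      (decoupled : K :* e :+ m :* (var x :* var y) ≐ ζy :* f :- ζx :* g)
      (f-x : partial y f ≐ con 0ℤ) (g-y : partial x g ≐ con 0ℤ)
      (ζx-x : partial y (var t :^ s :* ζx) ≐ con 0ℤ) (ζy-y : partial x (var t :^ s :* ζy) ≐ con 0ℤ)
      (∂x³K : partial x (partial x (partial x K)) ≐ con 0ℤ) (∂y³K : partial y (partial y (partial y K)) ≐ con 0ℤ)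
      where

      Series : FPS
      Series = Q (map stepOf E)

      Nonvanishing-x Nonvanishing-y : Exp Axis → Set
      Nonvanishing-x τ = Nonvanishing x K e m ζx (triangularE τ 4) (discE y K)
      Nonvanishing-y τ = Nonvanishing y K e m ζy (triangularE τ 4) (discE x K)

      private
        ⟪_⟫ : Exp Axis → FPS
        ⟪ a ⟫ = ⟦ a ⟧ axes

        eqn : Σ FPS λ r → Σ FPS λ s → Y.δ r ≈ 0# × X.δ s ≈ 0# × ⟪ K ⟫ * Series ≈ 𝕩 * 𝕪 - r - s
        eqn = kernel-equation E

        r r′ α β h ts : FPS
        r = proj₁ eqn
        r′ = proj₁ (proj₂ eqn)
        ts = ⟪ var t :^ s ⟫
        α = ⟪ f ⟫ - ts * ⟪ ζx ⟫ * r
        β = ⟪ g ⟫ + ts * ⟪ ζy ⟫ * r′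
        h = ⟪ e ⟫ + ⟪ m ⟫ * Series

        constant : ∀ v e → partial (axisOf v) e ≐ con 0ℤ → ∂ v ⟪ e ⟫ ≈ 0#
        constant v e p = partial-sound v e ▹ ≐-sound (partial (axisOf v) e) (con 0ℤ) p

        α₀ : Y.δ α ≈ 0#
        α₀ = Y.d-sub₀ {⟪ f ⟫} {ts * ⟪ ζx ⟫ * r} (constant varY f f-x) (Y.d-*₀ {ts * ⟪ ζx ⟫} {r} (constant varY (var t :^ s :* ζx) ζx-x) (proj₁ (proj₂ (proj₂ eqn))))

        β₀ : X.δ β ≈ 0#
        β₀ = X.d-+₀ {⟪ g ⟫} {ts * ⟪ ζy ⟫ * r′} (constant varX g g-y) (X.d-*₀ {ts * ⟪ ζy ⟫} {r′} (constant varX (var t :^ s :* ζy) ζy-y) (proj₁ (proj₂ (proj₂ (proj₂ eqn)))))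

        -- Multiply the kernel equation by `m`, add `K e` and replace `K e + m x y` by the
        -- decoupling. Since `m` is t^s ζx ζy, the terms `m r` and `m r′` join the x-part and the
        -- y-part.
        invariants : ⟪ K ⟫ * h ≈ ⟪ ζy ⟫ * α - ⟪ ζx ⟫ * β
        invariants =
          ring! 6 (λ K e t a b q → K :* (e :+ t :* (a :* b) :* q) ≔ K :* e :+ t :* (a :* b) :* (K :* q)) ≡.refl ⟪ K ⟫ ⟪ e ⟫ ts ⟪ ζx ⟫ ⟪ ζy ⟫ Series
          ▹ +-congˡ {⟪ K ⟫ * ⟪ e ⟫} (*-congˡ {⟪ m ⟫} (proj₂ (proj₂ (proj₂ (proj₂ eqn)))))
          ▹ ring! 5 (λ d m p r s → d :+ m :* (p :- r :- s) ≔ d :+ m :* p :- (m :* r :+ m :* s)) ≡.refl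
              (⟪ K ⟫ * ⟪ e ⟫) ⟪ m ⟫ (𝕩 * 𝕪) r r′
          ▹ +-congʳ { - (⟪ m ⟫ * r + ⟪ m ⟫ * r′)} (≐-sound (K :* e :+ m :* (var x :* var y)) (ζy :* f :- ζx :* g) decoupled)
          ▹ ring! 7 (λ f g t a b r s → b :* f :- a :* g :- (t :* (a :* b) :* r :+ t :* (a :* b) :* s)
               ≔ b :* (f :- t :* a :* r) :- a :* (g :+ t :* b :* s)) ≡.refl ⟪ f ⟫ ⟪ g ⟫ ts ⟪ ζx ⟫ ⟪ ζy ⟫ r r′

        third : ∀ v → partial (axisOf v) (partial (axisOf v) (partial (axisOf v) K)) ≐ con 0ℤ → ∂ v (∂ v (∂ v ⟪ K ⟫)) ≈ 0#
        third v p = d-cong (d-cong (partial-sound v K) ▹ partial-sound v (partial (axisOf v) K))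
            ▹ constant v (partial (axisOf v) (partial (axisOf v) K)) p
          where open Derivation (∂-derivation v)

        power₀ : ∀ v a n k → ∂ v (axes a) ≈ 0# → ∂ v ⟪ power a n k ⟫ ≈ 0#
        power₀ v a n k p = d-*₀ (vars₀ n) (units₀ k)
          where
          open Derivation (∂-derivation v)
          vars₀ : ∀ n → ∂ v ⟪ var a :^ n ⟫ ≈ 0#
          vars₀ zero    = d-1
          vars₀ (suc n) = d-*₀ p (vars₀ n)
          units₀ : ∀ n → ∂ v ⟪ (con 1ℤ :+ var a) :^ n ⟫ ≈ 0#
          units₀ zero    = d-1
          units₀ (suc n) = d-*₀ (d-+₀ d-1 p) (units₀ n)

        ζx₀ : Y.δ ⟪ ζx ⟫ ≈ 0#
        ζx₀ = power₀ varY x p i ∂y-x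

        ζy₀ : X.δ ⟪ ζy ⟫ ≈ 0#
        ζy₀ = power₀ varX y q j ∂x-y

        module TI = Tutte.Pair bivariate ⟪ K ⟫ h α β ⟪ ζx ⟫ ⟪ ζy ⟫ (third varX ∂x³K) (third varY ∂y³K) α₀ ζx₀ β₀ ζy₀ invariants

        Result : Set
        Result = Hyperalgebraic varX Series × Hyperalgebraic varY Series

        disc-sound : ∀ v → ⟪ discE (axisOf v) K ⟫ ≈ disc (∂ v) ⟪ K ⟫
        disc-sound v = A.sym (+-cong (*-cong (partial-sound v K) (partial-sound v K)) (-‿cong (*-congʳ (+-cong second second))))
          where
          second : ∂ v (∂ v ⟪ K ⟫) ≈ ⟪ partial (axisOf v) (partial (axisOf v) K) ⟫
          second = Derivation.d-cong (∂-derivation v) (partial-sound v K) ▹ partial-sound v (partial (axisOf v) K)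

        conclude : ∀ τ (c : ℕ → FPS) → (∀ k → X.δ (c k) ≈ 0#) → (∀ k → Y.δ (c k) ≈ 0#) →
          ⟪ triangularE τ 4 ⟫ * TI.Lx ≈ form 4 c α ⟪ ζx ⟫ → ⟪ triangularE τ 4 ⟫ * TI.Ly ≈ form 4 c β ⟪ ζy ⟫ →
          Nonvanishing-x τ → Nonvanishing-y τ → Result
        conclude τ c cx cy ex ey nx ny =
          invariant-hyperalgebraic varX Series K e m ζx (triangularE τ 4) (discE y K) (⟪ K ⟫ * h) α ⟪ ζy ⟫ c (A.refl {⟪ K ⟫ * h})
            TI.x-side ζy₀ cx eqx nx ,
          invariant-hyperalgebraic varY Series K e m ζy (triangularE τ 4) (discE x K) (⟪ K ⟫ * h) β (- ⟪ ζx ⟫) c (A.refl {⟪ K ⟫ * h})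
            TI.y-side (Y.d-neg ⟪ ζx ⟫ ▹ -‿cong ζx₀ ▹ -0#≈0#) cy eqy ny
          where
          eqx : ⟪ triangularE τ 4 ⟫ * (⟪ discE y K ⟫ * (TI.a * TI.a)) ≈ form 4 c α ⟪ ζx ⟫
          eqx = *-congˡ {⟪ triangularE τ 4 ⟫} (*-congʳ {TI.a * TI.a} (disc-sound varY)) ▹ ex
          eqy : ⟪ triangularE τ 4 ⟫ * (⟪ discE x K ⟫ * (TI.b * TI.b)) ≈ form 4 c β ⟪ ζy ⟫
          eqy = *-congˡ {⟪ triangularE τ 4 ⟫} (*-congʳ {TI.b * TI.b} (disc-sound varX)) ▹ ey

        split-power : ∀ a n k → n ≡ 1 → ⟪ power a n k ⟫ ≈ axes a * ⟪ (con 1ℤ :+ var a) :^ k ⟫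
        split-power a n k n≡1 = A.reflexive (≡.cong (λ n → ⟪ power a n k ⟫) n≡1) ▹ *-congʳ (*-identityʳ (axes a))

      Restricts : Axis → Axis → ℕ × ℕ → Set
      Restricts a w (b , c) = zeroAt a K ≐ :- (var t :* (var w :^ b :* (con 1ℤ :+ var w) :^ c))

      -- The alternative concerns the other invariant: either it has no pole at y = 0, or K(x,0) is
      -- regular and K(0,0) = 0, which is what removing its poles takes.
      x-pole : p ≡ 1 → ∀ b → Restricts x y b → (q ≡ 0 ⊎ (Σ (ℕ × ℕ) (Restricts y x)) × zeroAt x (zeroAt y K) ≐ con 0ℤ) →
        Nonvanishing-x (zeroAt x f) → Nonvanishing-y (zeroAt x f) →
        Hyperalgebraic varX Series × Hyperalgebraic varY Series
      x-pole p≡1 (b , c) K-x origin = conclude (zeroAt x f) (proj₁ eqs) (proj₁ (proj₂ eqs)) (proj₁ (proj₂ (proj₂ eqs)))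
        (proj₁ (proj₂ (proj₂ (proj₂ eqs)))) (proj₂ (proj₂ (proj₂ (proj₂ eqs))))
        where
        G : FPS
        G = - (ts * ⟪ (con 1ℤ :+ var x) :^ i ⟫ * r)
        eqs : Σ (ℕ → FPS) λ c → (∀ k → X.δ (c k) ≈ 0#) × (∀ k → Y.δ (c k) ≈ 0#) ×
          ⟪ triangularE (zeroAt x f) 4 ⟫ * TI.Lx ≈ form 4 c α ⟪ ζx ⟫ × ⟪ triangularE (zeroAt x f) 4 ⟫ * TI.Ly ≈ form 4 c β ⟪ ζy ⟫
        eqs = OX.equations K f p i q j b c h α β G p≡1 ∂x³K ∂y³K K-x origin (kernel-unique E) α₀ β₀
          (+-congˡ {⟪ f ⟫} (-‿cong (*-congʳ (*-congˡ (split-power x p i p≡1)))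
            ▹ ring! 4 (λ t x u r → :- (t :* (x :* u) :* r) ≔ x :* :- (t :* u :* r)) ≡.refl ts 𝕩 ⟪ (con 1ℤ :+ var x) :^ i ⟫ r))
          invariants

      y-pole : q ≡ 1 → ∀ b → Restricts y x b → (p ≡ 0 ⊎ (Σ (ℕ × ℕ) (Restricts x y)) × zeroAt y (zeroAt x K) ≐ con 0ℤ) →
        Nonvanishing-x (zeroAt y g) → Nonvanishing-y (zeroAt y g) →
        Hyperalgebraic varX Series × Hyperalgebraic varY Series
      y-pole q≡1 (b , c) K-y origin = conclude (zeroAt y g) (proj₁ eqs) (proj₁ (proj₂ (proj₂ eqs))) (proj₁ (proj₂ eqs))
        (proj₂ (proj₂ (proj₂ (proj₂ eqs)))) (proj₁ (proj₂ (proj₂ (proj₂ eqs))))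
        where
        G : FPS
        G = ts * ⟪ (con 1ℤ :+ var y) :^ j ⟫ * r′
        unique : ∀ P R M → X.δ P ≈ 0# → Y.δ R ≈ 0# → P - R ≈ ⟪ K ⟫ * M → M ≈ 0#
        unique P R M P₀ R₀ d = kernel-unique E (- R) (- P) M (Y.d-neg R ▹ -‿cong R₀ ▹ -0#≈0#) (X.d-neg P ▹ -‿cong P₀ ▹ -0#≈0#)
          (ring! 2 (λ p r → :- r :- :- p ≔ p :- r) ≡.refl P R ▹ d)
        eqs : Σ (ℕ → FPS) λ c → (∀ k → Y.δ (c k) ≈ 0#) × (∀ k → X.δ (c k) ≈ 0#) ×
          ⟪ triangularE (zeroAt y g) 4 ⟫ * TI.Ly ≈ form 4 c β ⟪ ζy ⟫ × ⟪ triangularE (zeroAt y g) 4 ⟫ * TI.Lx ≈ form 4 c α ⟪ ζx ⟫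
        -- Exchanging the coordinates turns I - J into J - I, hence the sign of `h`.
        eqs = OY.equations K g q j p i b c (- h) β α G q≡1 ∂y³K ∂x³K K-y origin unique β₀ α₀
          (+-congˡ {⟪ g ⟫} (*-congʳ (*-congˡ (split-power y q j q≡1))
            ▹ ring! 4 (λ t y u r → t :* (y :* u) :* r ≔ y :* (t :* u :* r)) ≡.refl ts 𝕪 ⟪ (con 1ℤ :+ var y) :^ j ⟫ r′))
          (ring! 2 (λ K h → K :* :- h ≔ :- (K :* h)) ≡.refl ⟪ K ⟫ h ▹ -‿cong invariants
            ▹ ring! 4 (λ a b c d → :- (a :* b :- c :* d) ≔ c :* d :- a :* b) ≡.refl ⟪ ζy ⟫ α ⟪ ζx ⟫ β)

open Decoupling

-- The nine step sets.

open ≡ using (refl)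

-- `leading` involves x, y, t and jets of order 0 and 1; this one point lies off its zero set for
-- all eighteen equations.
sample : DVar → ℤ
sample (inj₁ x) = + 2
sample (inj₁ y) = + 3
sample (inj₁ t) = + 1
sample (inj₂ 0) = + 1
sample (inj₂ _) = + 2

private
  𝐱 𝐲 𝐭 𝟏 : Exp Axis
  𝐱 = var x
  𝐲 = var y
  𝐭 = var t
  𝟏 = con 1ℤ

-- Dividing K = 0 by x isolates the mixed term: t x y = y - t y² - t (1 + x)/x. The second and
-- seventh sets work alike, with 1 + x² and 1 + x + x² in place of 1 + x.
module M₁ = Decoupled.Checked ((1 , 2) ∷ (2 , 1) ∷ (0 , 0) ∷ (1 , 0) ∷ []) 1 1 0 0 0
  𝟏
  (:- (𝐭 :* (𝟏 :+ 𝐱)))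
  (𝐭 :* 𝐲 :^ 2 :- 𝐲)
  refl refl refl refl refl refl refl

model₁ : Hyperalgebraic varX M₁.Series × Hyperalgebraic varY M₁.Series
model₁ = M₁.x-pole refl (0 , 0) refl (inj₁ refl) (nonvanishing _ _ _ _ _ _ _ sample λ ()) (nonvanishing _ _ _ _ _ _ _ sample λ ())

module M₂ = Decoupled.Checked ((1 , 2) ∷ (2 , 1) ∷ (0 , 0) ∷ (2 , 0) ∷ []) 1 1 0 0 0
  𝟏
  (:- (𝐭 :* (𝟏 :+ 𝐱 :^ 2)))
  (𝐭 :* 𝐲 :^ 2 :- 𝐲)
  refl refl refl refl refl refl refl

model₂ : Hyperalgebraic varX M₂.Series × Hyperalgebraic varY M₂.Series
model₂ = M₂.x-pole refl (0 , 0) refl (inj₁ refl) (nonvanishing _ _ _ _ _ _ _ sample λ ()) (nonvanishing _ _ _ _ _ _ _ sample λ ())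

-- Dividing K = 0 by x y gives t x y = 1 - t y - t/x - t/y. The eighth set has the further term - t
-- x.
module M₃ = Decoupled.Checked ((1 , 2) ∷ (2 , 2) ∷ (0 , 1) ∷ (1 , 0) ∷ []) 1 1 0 1 0
  𝟏
  (:- 𝐭)
  (𝐭 :- 𝐲 :+ 𝐭 :* 𝐲 :^ 2)
  refl refl refl refl refl refl refl

model₃ : Hyperalgebraic varX M₃.Series × Hyperalgebraic varY M₃.Series
model₃ = M₃.x-pole refl (1 , 0) refl (inj₂ (((1 , 0) , refl) , refl)) (nonvanishing _ _ _ _ _ _ _ sample λ ()) (nonvanishing _ _ _ _ _ _ _ sample λ ())

-- K/(x y) = 1 - t (y + 1/x + x + x/y) contains no term in x y. Multiplied by y - 1/x, the terms y/x
-- cancel, x/y becomes x and 1/y, and the only mixed term left is - t x y; hence e = x y - 1. The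
-- simple pole is the one in y.
module M₄ = Decoupled.Checked ((1 , 2) ∷ (0 , 1) ∷ (2 , 1) ∷ (2 , 0) ∷ []) 1 2 0 1 0
  (𝐱 :* 𝐲 :- 𝟏)
  (𝐭 :- 𝐱 :+ 𝐭 :* 𝐱 :^ 2 :- 𝐭 :* 𝐱 :^ 3)
  (𝐭 :* 𝐲 :^ 3 :- 𝐲 :^ 2 :- 𝐭)
  refl refl refl refl refl refl refl

model₄ : Hyperalgebraic varX M₄.Series × Hyperalgebraic varY M₄.Series
model₄ = M₄.y-pole refl (2 , 0) refl (inj₂ (((1 , 0) , refl) , refl)) (nonvanishing _ _ _ _ _ _ _ sample λ ()) (nonvanishing _ _ _ _ _ _ _ sample λ ())

-- The monomials x² y² and x² y combine to x² y (1 + y), so the divisor is x (1 + y): t x y = (y - t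
-- y²)/(1 + y) - t/x.
module M₅ = Decoupled.Checked ((1 , 2) ∷ (2 , 2) ∷ (0 , 1) ∷ (2 , 1) ∷ (0 , 0) ∷ []) 1 1 0 0 1
  𝟏
  (:- 𝐭)
  (𝐭 :* 𝐲 :^ 2 :- 𝐲)
  refl refl refl refl refl refl refl

model₅ : Hyperalgebraic varX M₅.Series × Hyperalgebraic varY M₅.Series
model₅ = M₅.x-pole refl (0 , 1) refl (inj₁ refl) (nonvanishing _ _ _ _ _ _ _ sample λ ()) (nonvanishing _ _ _ _ _ _ _ sample λ ())

-- The monomials x y² and x² y² combine to x y² (1 + x), so the divisor is (1 + x) y: t x y = (x -
-- t)/(1 + x) - t/y, with its simple pole in y.
module M₆ = Decoupled.Checked ((1 , 2) ∷ (2 , 2) ∷ (0 , 1) ∷ (0 , 0) ∷ (1 , 0) ∷ []) 1 0 1 1 0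
  𝟏
  (𝐱 :- 𝐭)
  𝐭
  refl refl refl refl refl refl refl

model₆ : Hyperalgebraic varX M₆.Series × Hyperalgebraic varY M₆.Series
model₆ = M₆.y-pole refl (0 , 1) refl (inj₁ refl) (nonvanishing _ _ _ _ _ _ _ sample λ ()) (nonvanishing _ _ _ _ _ _ _ sample λ ())

module M₇ = Decoupled.Checked ((1 , 2) ∷ (2 , 1) ∷ (0 , 0) ∷ (1 , 0) ∷ (2 , 0) ∷ []) 1 1 0 0 0
  𝟏
  (:- (𝐭 :* (𝟏 :+ 𝐱 :+ 𝐱 :^ 2)))
  (𝐭 :* 𝐲 :^ 2 :- 𝐲)
  refl refl refl refl refl refl refl

model₇ : Hyperalgebraic varX M₇.Series × Hyperalgebraic varY M₇.Series
model₇ = M₇.x-pole refl (0 , 0) refl (inj₁ refl) (nonvanishing _ _ _ _ _ _ _ sample λ ()) (nonvanishing _ _ _ _ _ _ _ sample λ ())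

module M₈ = Decoupled.Checked ((1 , 2) ∷ (2 , 2) ∷ (0 , 1) ∷ (2 , 1) ∷ (1 , 0) ∷ []) 1 1 0 1 0
  𝟏
  (:- (𝐭 :* (𝟏 :+ 𝐱 :^ 2)))
  (𝐭 :- 𝐲 :+ 𝐭 :* 𝐲 :^ 2)
  refl refl refl refl refl refl refl

model₈ : Hyperalgebraic varX M₈.Series × Hyperalgebraic varY M₈.Series
model₈ = M₈.x-pole refl (1 , 0) refl (inj₂ (((1 , 0) , refl) , refl)) (nonvanishing _ _ _ _ _ _ _ sample λ ()) (nonvanishing _ _ _ _ _ _ _ sample λ ())

-- Here K/(x y) = 1 - t x - t (1 + x)(y/x + 1/y). The multiplier is t (x y + 1/y)/(1 + x) - (t + 1)
-- x/(1 + x)². The product (y/x + 1/y)(x y + 1/y) = y² + 1/x + x + 1/y² is separated, and the cross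
-- terms sum to t/y + (t + t²) y - t² x y. Hence t² x y decouples, with s = 2.
module M₉ = Decoupled.Checked ((0 , 2) ∷ (1 , 2) ∷ (2 , 1) ∷ (1 , 0) ∷ (2 , 0) ∷ []) 2 1 2 2 0
  (𝐭 :* 𝐱 :^ 2 :* 𝐲 :^ 2 :+ 𝐭 :* 𝐱 :* 𝐲 :^ 2 :- 𝐭 :* 𝐱 :* 𝐲 :- 𝐱 :* 𝐲 :+ 𝐭 :* 𝐱 :+ 𝐭)
  (𝐭 :* 𝐱 :^ 3 :- 𝐭 :* 𝐱 :^ 2 :- 𝐱 :^ 2 :- 𝐭 :^ 2 :* (𝟏 :+ 𝐱 :+ 𝐱 :+ 𝐱 :^ 2 :+ 𝐱 :^ 2 :+ 𝐱 :^ 3 :+ 𝐱 :^ 4))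
  (𝐭 :^ 2 :- 𝐭 :* 𝐲 :- (𝐭 :^ 2 :+ 𝐭) :* 𝐲 :^ 3 :+ 𝐭 :^ 2 :* 𝐲 :^ 4)
  refl refl refl refl refl refl refl

model₉ : Hyperalgebraic varX M₉.Series × Hyperalgebraic varY M₉.Series
model₉ = M₉.x-pole refl (2 , 0) refl (inj₂ (((1 , 1) , refl) , refl)) (nonvanishing _ _ _ _ _ _ _ sample λ ()) (nonvanishing _ _ _ _ _ _ _ sample λ ())

theorem1p2 : (D : StepSet) → D ∈ nineStepSets →
    Hyperalgebraic varX (Q D) × Hyperalgebraic varY (Q D)
theorem1p2 _ (here refl) = model₁
theorem1p2 _ (there (here refl)) = model₂
theorem1p2 _ (there (there (here refl))) = model₃
theorem1p2 _ (there (there (there (here refl)))) = model₄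
theorem1p2 _ (there (there (there (there (here refl))))) = model₅
theorem1p2 _ (there (there (there (there (there (here refl)))))) = model₆
theorem1p2 _ (there (there (there (there (there (there (here refl))))))) = model₇
theorem1p2 _ (there (there (there (there (there (there (there (here refl)))))))) = model₈
theorem1p2 _ (there (there (there (there (there (there (there (there (here refl))))))))) = model₉
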